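{- Let $r\ge2$, let $q\in\mathbb C$ with $0<|q|<1$, and let $a_1,\dots,a_r,b_1,\dots,b_r$ be nonzero complex numbers with $b_r=q$, such that no quotient $b_i/b_j$ with $i\ne j$ is an integral power of $q$. Set $$c_i(q):=q\,b_i^{r-2}\prod_{\substack{1\le j\le r\\ j\ne i}}\frac{1}{b_i-b_j},\qquad i=1,\dots,r.$$ Let $f_i(q;z)$, $g_i(q;z)$ ($1\le i\le r$) be the solutions of the basic hypergeometric equation and of its dual, as defined in the context, and let $H_q$ be the field generated over $\mathbb Q$ by $q$, the $a_i$ and the $b_j$. Then for all $k,l\in\{0,1,\dots,r-1\}$, $$M_{kl}(q):=\sum_{i=1}^r c_i(q)\,f_i(q;zq^k)\,g_i(q;zq^l)\in H_q(z).$$ In particular, $M_{kl}(q)=0$ if $l\le k\le r-1$, except when $(k,l)=(r-1,0)$, in which case $$M_{r-1,0}(q)=\frac{(-1)^{r+1}q^r}{b_1\cdots b_r-a_1\cdots a_r\,q^{r-1}z}.$$ In addition, $$M_{k,k+1}(q)=\frac{1}{1-q^kz},\qquad k=0,1,\dots,r-2.$$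
   Context: $(a;q)_0:=1$ and $(a;q)_n:=(1-a)(1-aq)\cdots(1-aq^{n-1})$ for $n\ge1$. For $1\le i\le r$, $\beta_i$ is thought of as $\log(b_i)/\log(q)$, and $z^{1-\beta_i}$ denotes a formal nonzero solution of $h(qz)=(q/b_i)h(z)$; $z^{\beta_i-1}$ is its inverse, so it satisfies $h(qz)=(b_i/q)h(z)$ and $z^{1-\beta_i}z^{\beta_i-1}=1$. Define $$f_i(q;z):=z^{1-\beta_i}\sum_{n\ge0}\frac{\prod_{j=1}^r(qa_j/b_i;q)_n}{\prod_{j=1}^r(qb_j/b_i;q)_n}z^n,$$ $$g_i(q;z):=z^{\beta_i-1}\sum_{n\ge0}\frac{\prod_{j=1}^r(b_i/a_j;q)_n}{\prod_{j=1}^r(qb_i/b_j;q)_n}\left(\frac{a_1\cdots a_r\,q^{r-2}z}{b_1\cdots b_{r-1}}\right)^n$$ (the factor $j=i$ in each denominator is $(q;q)_n$). Thus $f_i(q;zq^k)g_i(q;zq^l)$ equals $(q/b_i)^{k-l}$ times the product of the first power series evaluated at $q^kz$ and the second evaluated at $q^lz$. Membership in $H_q(z)$ means that the resulting power series in $z$ is the expansion at $z=0$ of a rational function with coefficients in $H_q$. -}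

module Defs where

open import Algebra.Apartness.Bundles using (HeytingField; HeytingCommutativeRing)
open import Algebra.Bundles using (CommutativeRing)
open import Algebra.Consequences.Setoid using (comm∧idˡ⇒id; comm∧distrˡ⇒distr)
open import Algebra.Definitions using (Invertible)
open import Algebra.Structures using (IsAbelianGroup; IsCommutativeRing)
open import Data.Empty using (⊥; ⊥-elim)
open import Data.Fin.Base as Fin using (Fin; toℕ; inject₁; punchIn)
open import Data.Fin.Properties as Fin using (punchInᵢ≢i)
open import Data.Integer.Base as ℤ using (ℤ; +_; -[1+_])
open import Data.List.Base using (List; []; _∷_)
open import Data.List.Relation.Unary.All using (All)
open import Data.Nat.Base as ℕ using (ℕ; zero; suc)
open import Data.Product.Base using (∃; ∃₂; _×_; _,_; proj₁; proj₂)
open import Data.Sum.Base using (_⊎_; inj₁; inj₂; map; swap)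
open import Function.Base using (_∘_)
open import Level as Level using (0ℓ)
open import Relation.Binary.PropositionalEquality.Core as ≡ using (_≡_; _≢_)
open import Relation.Nullary using (¬_; yes; no)
import Algebra.Apartness.Properties.HeytingCommutativeRing as HeytingProperties
import Algebra.Properties.Monoid.Sum as Sum
import Algebra.Properties.Ring as RingProperties
import Algebra.Properties.Semiring.Exp as Exp
import Data.Integer.Properties as ℤ
import Data.Nat.Coprimality as Coprime
import Data.Nat.Properties as ℕ
import Relation.Binary.Reasoning.Setoid as SetoidReasoning

module FieldTheory {ℓ ℓ₁ ℓ₂} (K : HeytingField ℓ ℓ₁ ℓ₂) where

  open HeytingField K public renaming (zero to *-zero)
  open HeytingProperties heytingCommutativeRing public
    using (x-0≈x; 1#0; x#0y#0→xy#0; invertibleˡ⇒#; #-congʳ; #-congˡ)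

  commutativeRing : CommutativeRing ℓ ℓ₁
  commutativeRing = HeytingCommutativeRing.commutativeRing heytingCommutativeRing

  open CommutativeRing commutativeRing public
    using (ring; semiring; +-monoid; *-monoid)
  open Exp semiring public using (_^_)
  open Sum +-monoid public using (sum)
  open Sum *-monoid public using () renaming (sum to product)

  infix  9 _⁻¹[_]
  infixl 7 _/_[_]
  infixr 8 _^_[_]

  _⁻¹[_] : ∀ x → x # 0# → Carrier
  x ⁻¹[ x#0 ] = proj₁ (#⇒invertible x#0)

  _/_[_] : Carrier → ∀ y → y # 0# → Carrier
  x / y [ y#0 ] = x * y ⁻¹[ y#0 ]

  _^_[_] : ∀ x → ℤ → x # 0# → Carrier
  x ^ + n      [ _ ]   = x ^ n
  x ^ -[1+ n ] [ x#0 ] = (x ⁻¹[ x#0 ]) ^ suc n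

  module Units where

    open SetoidReasoning setoid
    open RingProperties ring using (-‿distribˡ-*)

    ⁻¹-inverseˡ : ∀ {x} (x#0 : x # 0#) → x ⁻¹[ x#0 ] * x ≈ 1#
    ⁻¹-inverseˡ {x} x#0 = trans (*-congˡ (sym (x-0≈x x))) (proj₁ (proj₂ (#⇒invertible x#0)))

    ⁻¹-inverseʳ : ∀ {x} (x#0 : x # 0#) → x * x ⁻¹[ x#0 ] ≈ 1#
    ⁻¹-inverseʳ {x} x#0 = trans (*-comm x (x ⁻¹[ x#0 ])) (⁻¹-inverseˡ x#0)

    unit⇒#0 : ∀ {x} y → y * x ≈ 1# → x # 0#
    unit⇒#0 {x} y yx≈1 = invertibleˡ⇒# (y , trans (*-congˡ (x-0≈x x)) yx≈1)

    ⁻¹#0 : ∀ {x} (x#0 : x # 0#) → x ⁻¹[ x#0 ] # 0#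
    ⁻¹#0 {x} x#0 = unit⇒#0 x (⁻¹-inverseʳ x#0)

    #⇒-#0 : ∀ {x y} → x # y → x - y # 0#
    #⇒-#0 x#y = let z , zd≈1 , _ = #⇒invertible x#y in unit⇒#0 z zd≈1

    *-#-cong : ∀ {x y u} → x # y → u # 0# → x * u # y * u
    *-#-cong {x} {y} {u} x#y u#0 = invertibleˡ⇒# (w , eq)
      where
      d#0 : (x - y) * u # 0#
      d#0 = x#0y#0→xy#0 (#⇒-#0 x#y) u#0
      w : Carrier
      w = ((x - y) * u) ⁻¹[ d#0 ]
      eq : w * (x * u - y * u) ≈ 1#
      eq = begin
        w * (x * u - y * u)       ≈⟨ *-congˡ (+-congˡ (-‿distribˡ-* y u)) ⟩
        w * (x * u + (- y) * u)   ≈⟨ *-congˡ (distribʳ u x (- y)) ⟨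
        w * ((x - y) * u)         ≈⟨ ⁻¹-inverseˡ d#0 ⟩
        1# ∎

    ^#0 : ∀ {x} → x # 0# → ∀ n → x ^ n # 0#
    ^#0 x#0 zero    = 1#0
    ^#0 x#0 (suc n) = x#0y#0→xy#0 x#0 (^#0 x#0 n)

    product#0 : ∀ {n} (x : Fin n → Carrier) → (∀ i → x i # 0#) → product x # 0#
    product#0 {zero}  x x#0 = 1#0
    product#0 {suc n} x x#0 = x#0y#0→xy#0 (x#0 Fin.zero) (product#0 (x ∘ Fin.suc) (x#0 ∘ Fin.suc))

    cross : ∀ x y z w → (x * y) * (z * w) ≈ (x * w) * (z * y)
    cross x y z w = begin
      (x * y) * (z * w)  ≈⟨ *-assoc x y (z * w) ⟩
      x * (y * (z * w))  ≈⟨ *-congˡ (*-comm y (z * w)) ⟩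
      x * ((z * w) * y)  ≈⟨ *-congˡ (*-congʳ (*-comm z w)) ⟩
      x * ((w * z) * y)  ≈⟨ *-congˡ (*-assoc w z y) ⟩
      x * (w * (z * y))  ≈⟨ *-assoc x w (z * y) ⟨
      (x * w) * (z * y)  ∎

    ⁻¹^*^≈1 : ∀ {x} (x#0 : x # 0#) n → (x ⁻¹[ x#0 ]) ^ n * x ^ n ≈ 1#
    ⁻¹^*^≈1 x#0 zero = *-identityˡ 1#
    ⁻¹^*^≈1 {x} x#0 (suc n) = begin
      (y * y ^ n) * (x * x ^ n)  ≈⟨ *-congʳ (*-comm y (y ^ n)) ⟩
      (y ^ n * y) * (x * x ^ n)  ≈⟨ cross (y ^ n) y x (x ^ n) ⟩
      (y ^ n * x ^ n) * (x * y)  ≈⟨ *-cong (⁻¹^*^≈1 x#0 n) (⁻¹-inverseʳ x#0) ⟩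
      1# * 1#                    ≈⟨ *-identityˡ 1# ⟩
      1#                         ∎
      where
      y : Carrier
      y = x ⁻¹[ x#0 ]

    quotients≈1 : ∀ {x y} (x#0 : x # 0#) (y#0 : y # 0#) → (x / y [ y#0 ]) * (y / x [ x#0 ]) ≈ 1#
    quotients≈1 {x} {y} x#0 y#0 = begin
      (x * y ⁻¹[ y#0 ]) * (y * x ⁻¹[ x#0 ])  ≈⟨ cross x (y ⁻¹[ y#0 ]) y (x ⁻¹[ x#0 ]) ⟩
      (x * x ⁻¹[ x#0 ]) * (y * y ⁻¹[ y#0 ])  ≈⟨ *-cong (⁻¹-inverseʳ x#0) (⁻¹-inverseʳ y#0) ⟩
      1# * 1#                                ≈⟨ *-identityˡ 1# ⟩
      1#                                     ∎

  -- The smallest subfield containing S. It contains the image of ℚ because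
  -- it contains 1.
  data SubfieldGeneratedBy {p} (S : Carrier → Set p) : Carrier → Set (ℓ Level.⊔ ℓ₁ Level.⊔ ℓ₂ Level.⊔ p) where
    gen-∈     : ∀ {x} → S x → SubfieldGeneratedBy S x
    ≈-∈       : ∀ {x y} → x ≈ y → SubfieldGeneratedBy S x → SubfieldGeneratedBy S y
    0∈        : SubfieldGeneratedBy S 0#
    1∈        : SubfieldGeneratedBy S 1#
    +-∈       : ∀ {x y} → SubfieldGeneratedBy S x → SubfieldGeneratedBy S y → SubfieldGeneratedBy S (x + y)
    neg-∈     : ∀ {x} → SubfieldGeneratedBy S x → SubfieldGeneratedBy S (- x)
    *-∈       : ∀ {x y} → SubfieldGeneratedBy S x → SubfieldGeneratedBy S y → SubfieldGeneratedBy S (x * y)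
    ⁻¹-∈      : ∀ {x} (x#0 : x # 0#) → SubfieldGeneratedBy S x → SubfieldGeneratedBy S (x ⁻¹[ x#0 ])

  Series : Set ℓ
  Series = ℕ → Carrier

  infix  4 _≋_ _IsExpansionOf_÷_
  infixl 7 _⊛_ _•_

  _≋_ : Series → Series → Set ℓ₁
  u ≋ v = ∀ n → u n ≈ v n

  0ₛ : Series
  0ₛ _ = 0#

  _⊛_ : Series → Series → Series
  (u ⊛ v) n = sum {suc n} λ m → u (toℕ m) * v (n ℕ.∸ toℕ m)

  _•_ : Carrier → Series → Series
  (x • u) n = x * u n

  -- The list c₀ ∷ c₁ ∷ … is the polynomial c₀ + c₁ z + ….
  Polynomial : Set ℓ
  Polynomial = List Carrier

  toSeries : Polynomial → Series
  toSeries []      _       = 0#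
  toSeries (x ∷ _) zero    = x
  toSeries (_ ∷ p) (suc n) = toSeries p n

  -- u is the expansion at z = 0 of the rational function P / Q.
  record _IsExpansionOf_÷_ (u : Series) (P Q : Polynomial) : Set (ℓ₁ Level.⊔ ℓ₂) where
    field
      regular   : toSeries Q 0 # 0#
      expansion : toSeries Q ⊛ u ≋ toSeries P

  IsRationalOver : ∀ {p} → (Carrier → Set p) → Series → Set (ℓ Level.⊔ ℓ₁ Level.⊔ ℓ₂ Level.⊔ p)
  IsRationalOver F u = ∃₂ λ P Q → All F P × All F Q × u IsExpansionOf P ÷ Q

  -- A formal product h(z) φ(z) of a power series φ and a fixed nonzero
  -- solution h of h(qz) = μ h(z).
  record Twisted (μ : Carrier) : Set ℓ where
    constructor twisted
    field series : Series

  open Twisted public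

  -- h(z) φ(z) · h′(z) ψ(z), where h′ = h⁻¹.
  _⊙_[_] : ∀ {μ ν} → Twisted μ → Twisted ν → μ * ν ≈ 1# → Series
  φ ⊙ ψ [ _ ] = series φ ⊛ series ψ

  -- The condition 1 # qⁿ⁺¹ on q is what |q| < 1 provides over ℂ.
  module Hypergeometric
    (r-2 : ℕ)
    (q : Carrier) (q#0 : q # 0#) (1#q^ : ∀ n → 1# # q ^ suc n)
    (a b : Fin (suc (suc r-2)) → Carrier) (a#0 : ∀ i → a i # 0#) (b#0 : ∀ i → b i # 0#)
    (b/b#q^ : ∀ i j → i ≢ j → ∀ n → b i / b j [ b#0 j ] # q ^ n [ q#0 ])
    where

    private
      r : ℕ
      r = suc (suc r-2)

    -- (x; q)ₙ
    pochhammer : Carrier → ℕ → Carrier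
    pochhammer x zero    = 1#
    pochhammer x (suc n) = pochhammer x n * (1# - x * q ^ n)

    module Denominators where

      open Units
      open SetoidReasoning setoid

      1#q^*q*b/b : ∀ i j n → 1# # q * b j / b i [ b#0 i ] * q ^ n
      1#q^*q*b/b i j n with j Fin.≟ i
      ... | yes ≡.refl = #-congˡ (sym (begin
        q * b i * b i ⁻¹[ b#0 i ] * q ^ n    ≈⟨ *-congʳ (*-assoc q (b i) _) ⟩
        q * (b i * b i ⁻¹[ b#0 i ]) * q ^ n  ≈⟨ *-congʳ (*-congˡ (⁻¹-inverseʳ (b#0 i))) ⟩
        q * 1# * q ^ n                       ≈⟨ *-congʳ (*-identityʳ q) ⟩
        q * q ^ n                            ∎)) (1#q^ n)
      ... | no j≢i = #-congʳ (⁻¹^*^≈1 q#0 (suc n)) (#-congˡ (begin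
        b j * b i ⁻¹[ b#0 i ] * (q * q ^ n)    ≈⟨ *-assoc _ q (q ^ n) ⟨
        b j * b i ⁻¹[ b#0 i ] * q * q ^ n      ≈⟨ *-congʳ (*-comm _ q) ⟩
        q * (b j * b i ⁻¹[ b#0 i ]) * q ^ n    ≈⟨ *-congʳ (*-assoc q (b j) _) ⟨
        q * b j * b i ⁻¹[ b#0 i ] * q ^ n      ∎)
        (#-sym (*-#-cong (b/b#q^ j i j≢i -[1+ n ]) (^#0 q#0 (suc n)))))

      pochhammer#0 : ∀ x → (∀ n → 1# # x * q ^ n) → ∀ n → pochhammer x n # 0#
      pochhammer#0 x x# zero    = 1#0
      pochhammer#0 x x# (suc n) = x#0y#0→xy#0 (pochhammer#0 x x# n) (#⇒-#0 (x# n))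

      b-b#0 : ∀ {i j} → i ≢ j → b i - b j # 0#
      b-b#0 {i} {j} i≢j = #⇒-#0 (#-congʳ eq (#-congˡ (*-identityˡ (b j))
        (*-#-cong (b/b#q^ i j i≢j (+ 0)) (b#0 j))))
        where
        eq : b i * b j ⁻¹[ b#0 j ] * b j ≈ b i
        eq = trans (*-assoc (b i) _ (b j)) (trans (*-congˡ (⁻¹-inverseˡ (b#0 j))) (*-identityʳ (b i)))

      f-denominator#0 : ∀ i n → product (λ j → pochhammer (q * b j / b i [ b#0 i ]) n) # 0#
      f-denominator#0 i n = product#0 _ λ j → pochhammer#0 _ (1#q^*q*b/b i j) n

      g-denominator#0 : ∀ i n → product (λ j → pochhammer (q * b i / b j [ b#0 j ]) n) # 0#
      g-denominator#0 i n = product#0 _ λ j → pochhammer#0 _ (1#q^*q*b/b j i) n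

    open Denominators

    -- punchIn i enumerates the indices j ≠ i.
    c : Fin r → Carrier
    c i = q * b i ^ r-2 * product λ j → (b i - b (punchIn i j)) ⁻¹[ b-b#0 (punchInᵢ≢i i j ∘ ≡.sym) ]

    f : ∀ i → Twisted (q / b i [ b#0 i ])
    series (f i) n =
      product (λ j → pochhammer (q * a j / b i [ b#0 i ]) n)
        / product (λ j → pochhammer (q * b j / b i [ b#0 i ]) n) [ f-denominator#0 i n ]

    -- b ∘ inject₁ lists b₁, …, bᵣ₋₁.
    g : ∀ i → Twisted (b i / q [ q#0 ])
    series (g i) n =
      product (λ j → pochhammer (b i / a j [ a#0 j ]) n)
        / product (λ j → pochhammer (q * b i / b j [ b#0 j ]) n) [ g-denominator#0 i n ]
      * (product a * q ^ r-2 / product (b ∘ inject₁) [ Units.product#0 (b ∘ inject₁) (b#0 ∘ inject₁) ]) ^ n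

    -- Substitution of z qᵏ for z: h(qᵏz) φ(qᵏz) = h(z) · μᵏ φ(qᵏz).
    _at-zq^_ : ∀ {μ} → Twisted μ → ℕ → Twisted μ
    series (_at-zq^_ {μ} φ k) n = μ ^ k * ((q ^ k) ^ n * series φ n)

    M : ℕ → ℕ → Series
    M k l n = sum λ i → (c i • ((f i at-zq^ k) ⊙ (g i at-zq^ l) [ Units.quotients≈1 q#0 (b#0 i) ])) n

    data Parameter : Carrier → Set ℓ where
      q∈ : Parameter q
      a∈ : ∀ i → Parameter (a i)
      b∈ : ∀ i → Parameter (b i)

    H : Carrier → Set (ℓ Level.⊔ ℓ₁ Level.⊔ ℓ₂)
    H = SubfieldGeneratedBy Parameter

-- The real numbers are Cauchy sequences of rationals, up to null sequences, and
-- ℂ = ℝ × ℝ; ℂ-heytingField is the field of complex numbers. An inverse in ℂ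
-- needs an apartness x # y, the positive form of x ≠ y, so x ≠ y is read as
-- x # y throughout; ¬ (x # y) is equivalent to x ≈ y.
module ComplexNumbers where

  open import Data.Rational.Base
  open import Data.Rational.Properties
  open import Data.Rational.Solver using (module +-*-Solver)
  open +-*-Solver using (solve; _:=_; _:+_; _:*_; _:-_; :-_; con)
  open ≡ using (refl; sym; trans; cong; cong₂; subst)

  module ℚ-lemmas where

    0<1 : 0ℚ < 1ℚ
    0<1 = positive⁻¹ 1ℚ

    +-pos : ∀ {p q} → 0ℚ < p → 0ℚ < q → 0ℚ < p + q
    +-pos = +-mono-<

    *-pos : ∀ {p q} → 0ℚ < p → 0ℚ < q → 0ℚ < p * q
    *-pos {p} {q} p>0 q>0 =
      positive⁻¹ (p * q) {{pos*pos⇒pos p {{positive p>0}} q {{positive q>0}}}}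

    *-nonNeg : ∀ {p q} → 0ℚ ≤ p → 0ℚ ≤ q → 0ℚ ≤ p * q
    *-nonNeg {p} {q} p≥0 q≥0 =
      nonNegative⁻¹ (p * q) {{nonNeg*nonNeg⇒nonNeg p {{nonNegative p≥0}} q {{nonNegative q≥0}}}}

    <-by : ∀ {p q} d → 0ℚ < d → p + d ≡ q → p < q
    <-by {p} d d>0 refl = subst (_< p + d) (+-identityʳ p) (+-monoʳ-< p d>0)

    ≤-by : ∀ {p q} d → 0ℚ ≤ d → p + d ≡ q → p ≤ q
    ≤-by {p} d d≥0 refl = subst (_≤ p + d) (+-identityʳ p) (+-monoʳ-≤ p d≥0)

    <⇒0<- : ∀ {p q} → p < q → 0ℚ < q - p
    <⇒0<- {p} {q} p<q = subst (_< q - p) (+-inverseʳ p) (+-monoˡ-< (- p) p<q)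

    ≤⇒0≤- : ∀ {p q} → p ≤ q → 0ℚ ≤ q - p
    ≤⇒0≤- {p} {q} p≤q = subst (_≤ q - p) (+-inverseʳ p) (+-monoˡ-≤ (- p) p≤q)

    square≥0 : ∀ p → 0ℚ ≤ p * p
    square≥0 p with ≤-total 0ℚ p
    ... | inj₁ 0≤p = *-nonNeg 0≤p 0≤p
    ... | inj₂ p≤0 = subst (0ℚ ≤_) (solve 1 (λ x → (:- x) :* (:- x) := x :* x) refl p)
                       (*-nonNeg (neg-antimono-≤ p≤0) (neg-antimono-≤ p≤0))

    *-mono-<-nonNeg : ∀ {p q r s} → 0ℚ ≤ p → p < q → 0ℚ ≤ r → r < s → p * r < q * s
    *-mono-<-nonNeg {p} {q} {r} {s} p≥0 p<q r≥0 r<s = ≤-<-trans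
      (*-monoʳ-≤-nonNeg r {{nonNegative r≥0}} (<⇒≤ p<q))
      (*-monoʳ-<-pos q {{positive (≤-<-trans p≥0 p<q)}} r<s)

    p≤∣p∣ : ∀ p → p ≤ ∣ p ∣
    p≤∣p∣ p with ≤-total 0ℚ p
    ... | inj₁ 0≤p = ≤-reflexive (sym (0≤p⇒∣p∣≡p 0≤p))
    ... | inj₂ p≤0 = ≤-trans p≤0 (0≤∣p∣ p)

    -p≤∣p∣ : ∀ p → - p ≤ ∣ p ∣
    -p≤∣p∣ p = subst (- p ≤_) (∣-p∣≡∣p∣ p) (p≤∣p∣ (- p))

    ∣∣-lub-< : ∀ {p e} → p < e → - p < e → ∣ p ∣ < e
    ∣∣-lub-< {p} {e} p<e -p<e with ∣p∣≡p∨∣p∣≡-p p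
    ... | inj₁ eq = subst (_< e) (sym eq) p<e
    ... | inj₂ eq = subst (_< e) (sym eq) -p<e

    ∣p-q∣≡∣q-p∣ : ∀ p q → ∣ p - q ∣ ≡ ∣ q - p ∣
    ∣p-q∣≡∣q-p∣ p q = trans (cong ∣_∣ (solve 2 (λ x y → x :- y := :- (y :- x)) refl p q)) (∣-p∣≡∣p∣ (q - p))

    abstract
      reciprocal : ∀ {p} → 0ℚ < p → ∃ λ r → 0ℚ < r × p * r ≡ 1ℚ
      reciprocal {p} p>0 = 1/p , positive⁻¹ 1/p {{1/pos⇒pos p {{p⁺}}}} , *-inverseʳ p {{nz}}
        where
        p⁺ : Positive p
        p⁺ = positive p>0
        nz : NonZero p
        nz = pos⇒nonZero p {{p⁺}}
        1/p : ℚ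
        1/p = (1/ p) {{nz}}

      quotient : ∀ {e B} → 0ℚ < e → 0ℚ < B → ∃ λ d → 0ℚ < d × B * d ≡ e
      quotient {e} {B} e>0 B>0 with reciprocal B>0
      ... | r , r>0 , B*r≡1 = r * e , *-pos r>0 e>0
          , trans (sym (*-assoc B r e)) (trans (cong (_* e) B*r≡1) (*-identityˡ e))

      half : ∀ {e} → 0ℚ < e → ∃ λ d → 0ℚ < d × d + d ≡ e
      half {e} e>0 with quotient e>0 (+-pos 0<1 0<1)
      ... | d , d>0 , eq = d , d>0 , trans (solve 1 (λ x → x :+ x := (con 1ℚ :+ con 1ℚ) :* x) refl d) eq

    inv : ℚ → ℚ
    inv p with p ≟ 0ℚ
    ... | yes _  = 0ℚ
    ... | no p≢0 = (1/ p) {{≢-nonZero p≢0}}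

    inv-inverse : ∀ p → p ≢ 0ℚ → p * inv p ≡ 1ℚ
    inv-inverse p p≢0 with p ≟ 0ℚ
    ... | yes p≡0 = ⊥-elim (p≢0 p≡0)
    ... | no p≢0′ = *-inverseʳ p {{≢-nonZero p≢0′}}

    fromℕ : ℕ → ℚ
    fromℕ zero    = 0ℚ
    fromℕ (suc n) = fromℕ n + 1ℚ

    fromℕ≥0 : ∀ n → 0ℚ ≤ fromℕ n
    fromℕ≥0 zero    = ≤-refl
    fromℕ≥0 (suc n) = +-mono-≤ (fromℕ≥0 n) (<⇒≤ 0<1)

    fromℕ-mono : ∀ {m n} → m ℕ.≤ n → fromℕ m ≤ fromℕ n
    fromℕ-mono {n = n} ℕ.z≤n = fromℕ≥0 n
    fromℕ-mono (ℕ.s≤s m≤n)   = +-monoˡ-≤ 1ℚ (fromℕ-mono m≤n)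

    0<fromℕ-suc : ∀ n → 0ℚ < fromℕ (suc n)
    0<fromℕ-suc n = +-mono-≤-< (fromℕ≥0 n) 0<1

    archimedean : ∀ p → ∃ λ n → p < fromℕ n
    archimedean p@(mkℚ i d-1 _) = suc ℤ.∣ i ∣ , ≤-<-trans p≤ (<-by 1ℚ 0<1 refl)
      where
      emb : ℕ → ℚ
      emb n = mkℚ (+ n) 0 (Coprime.sym (Coprime.1-coprimeTo n))

      emb-suc : ∀ n → emb (suc n) ≡ emb n + 1ℚ
      emb-suc n = ≡.sym (trans (cong (_/ 1) (trans (cong₂ ℤ._+_ (ℤ.*-identityʳ (+ n)) refl) (ℤ.+-comm (+ n) (+ 1)))) (↥p/↧p≡p (emb (suc n))))

      emb≡fromℕ : ∀ n → emb n ≡ fromℕ n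
      emb≡fromℕ zero    = refl
      emb≡fromℕ (suc n) = trans (emb-suc n) (cong (_+ 1ℚ) (emb≡fromℕ n))

      i≤∣i∣ : ∀ i → i ℤ.≤ + ℤ.∣ i ∣
      i≤∣i∣ (+ n)    = ℤ.≤-refl
      i≤∣i∣ -[1+ n ] = ℤ.-≤+

      p≤ : p ≤ fromℕ ℤ.∣ i ∣
      p≤ = subst (p ≤_) (emb≡fromℕ ℤ.∣ i ∣) (*≤*
        (ℤ.≤-trans (ℤ.≤-reflexive (ℤ.*-identityʳ i)) (ℤ.≤-trans (i≤∣i∣ i)
          (subst (ℤ._≤ + ℤ.∣ i ∣ ℤ.* + suc d-1) (ℤ.*-identityʳ (+ ℤ.∣ i ∣))
            (ℤ.*-monoˡ-≤-nonNeg (+ ℤ.∣ i ∣) (ℤ.+≤+ (ℕ.s≤s ℕ.z≤n)))))))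

  open ℚ-lemmas

  -- Eventual statements over an index set I with a decreasing family of tails.
  -- Tail₁ is used for limits of sequences, Tail₂ for the Cauchy condition.
  module Tails {I : Set} (T : ℕ → I → Set) (T-anti : ∀ {M N i} → M ℕ.≤ N → T N i → T M i) where

    Ev : (I → Set) → Set
    Ev P = ∃ λ N → ∀ i → T N i → P i

    Ev-map : ∀ {P Q : I → Set} → (∀ i → P i → Q i) → Ev P → Ev Q
    Ev-map f (N , h) = N , λ i t → f i (h i t)

    Ev-map₂ : ∀ {P Q R : I → Set} → (∀ i → P i → Q i → R i) → Ev P → Ev Q → Ev R
    Ev-map₂ f (M , g) (N , h) = M ℕ.⊔ N , λ i t →
      f i (g i (T-anti (ℕ.m≤m⊔n M N) t)) (h i (T-anti (ℕ.m≤n⊔m M N) t))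

    record Null (u : I → ℚ) : Set where
      constructor null
      field tails : ∀ e → 0ℚ < e → Ev (λ i → ∣ u i ∣ < e)

    record Bounded (u : I → ℚ) : Set where
      constructor bound
      field
        B   : ℚ
        B>0 : 0ℚ < B
        ev  : Ev (λ i → ∣ u i ∣ < B)

    null-resp : ∀ {u v} → Ev (λ i → u i ≡ v i) → Null u → Null v
    null-resp u≡v (null nu) = null λ e e>0 →
      Ev-map₂ (λ i eq lt → subst (λ z → ∣ z ∣ < e) eq lt) u≡v (nu e e>0)

    null-≡ : ∀ {u v} → (∀ i → u i ≡ v i) → Null u → Null v
    null-≡ u≡v = null-resp (0 , λ i _ → u≡v i)

    null-0 : ∀ {u} → (∀ i → u i ≡ 0ℚ) → Null u
    null-0 u≡0 = null λ e e>0 → 0 , λ i _ → subst (λ z → ∣ z ∣ < e) (sym (u≡0 i)) e>0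

    null-+ : ∀ {u v} → Null u → Null v → Null (λ i → u i + v i)
    null-+ {u} {v} (null nu) (null nv) = null sum
      where
      sum : ∀ e → 0ℚ < e → Ev (λ i → ∣ u i + v i ∣ < e)
      sum e e>0 with half e>0
      ... | d , d>0 , refl = Ev-map₂
        (λ i a b → ≤-<-trans (∣p+q∣≤∣p∣+∣q∣ (u i) (v i)) (+-mono-< a b)) (nu d d>0) (nv d d>0)

    null-neg : ∀ {u} → Null u → Null (λ i → - u i)
    null-neg {u} (null nu) = null λ e e>0 → Ev-map (λ i → subst (_< e) (sym (∣-p∣≡∣p∣ (u i)))) (nu e e>0)

    null-* : ∀ {u v} → Bounded u → Null v → Null (λ i → u i * v i)
    null-* {u} {v} (bound B B>0 bu) (null nv) = null product
      where
      product : ∀ e → 0ℚ < e → Ev (λ i → ∣ u i * v i ∣ < e)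
      product e e>0 with quotient e>0 B>0
      ... | d , d>0 , refl = Ev-map₂
        (λ i a b → subst (_< B * d) (sym (∣p*q∣≡∣p∣*∣q∣ (u i) (v i)))
                     (*-mono-<-nonNeg (0≤∣p∣ (u i)) a (0≤∣p∣ (v i)) b)) bu (nv d d>0)

    bounded-* : ∀ {u v} → Bounded u → Bounded v → Bounded (λ i → u i * v i)
    bounded-* {u} {v} (bound B B>0 bu) (bound C C>0 bv) = bound (B * C) (*-pos B>0 C>0) (Ev-map₂
      (λ i a b → subst (_< B * C) (sym (∣p*q∣≡∣p∣*∣q∣ (u i) (v i)))
                   (*-mono-<-nonNeg (0≤∣p∣ (u i)) a (0≤∣p∣ (v i)) b)) bu bv)

  module Tail₁ = Tails {ℕ} ℕ._≤_ ℕ.≤-trans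
  module Tail₂ = Tails {ℕ × ℕ} (λ N (m , n) → N ℕ.≤ m × N ℕ.≤ n)
                   (λ M≤N (N≤m , N≤n) → ℕ.≤-trans M≤N N≤m , ℕ.≤-trans M≤N N≤n)

  Eventually : (ℕ → Set) → Set
  Eventually P = ∃ λ N → ∀ n → N ℕ.≤ n → P n

  IsCauchy : (ℕ → ℚ) → Set
  IsCauchy x = ∀ e → 0ℚ < e → ∃ λ N → ∀ m n → N ℕ.≤ m → N ℕ.≤ n → ∣ x m - x n ∣ < e

  record ℝ : Set where
    no-eta-equality
    field
      seq    : ℕ → ℚ
      cauchy : IsCauchy seq

  open ℝ public

  infix 4 _≈ᵣ_ _<ᵣ_ _#ᵣ_

  record _≈ᵣ_ (x y : ℝ) : Set where
    constructor mk≈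
    field close : ∀ e → 0ℚ < e → Eventually λ n → ∣ seq x n - seq y n ∣ < e

  _<ᵣ_ _#ᵣ_ : ℝ → ℝ → Set
  x <ᵣ y = ∃ λ e → 0ℚ < e × Eventually λ n → e < seq y n - seq x n
  x #ᵣ y = x <ᵣ y ⊎ y <ᵣ x

  module ℝ-lemmas where

    open Tail₁
    module N₂ = Tail₂

    null⇒cauchy : ∀ {u} → N₂.Null (λ (m , n) → u m - u n) → IsCauchy u
    null⇒cauchy (N₂.null nu) e e>0 =
      let N , h = nu e e>0 in N , λ m n N≤m N≤n → h (m , n) (N≤m , N≤n)

    cauchy⇒null : ∀ (x : ℝ) → N₂.Null (λ (m , n) → seq x m - seq x n)
    cauchy⇒null x = N₂.null λ e e>0 →
      let N , h = cauchy x e e>0 in N , λ (m , n) (N≤m , N≤n) → h m n N≤m N≤n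

    ≈⇒null : ∀ {x y} → x ≈ᵣ y → Null (λ n → seq x n - seq y n)
    ≈⇒null (mk≈ p) = null p

    null⇒≈ : ∀ {x y} → Null (λ n → seq x n - seq y n) → x ≈ᵣ y
    null⇒≈ (null p) = mk≈ p

    bounded : ∀ (x : ℝ) → Bounded (seq x)
    bounded x with cauchy x 1ℚ 0<1
    ... | N , h = bound (∣ seq x N ∣ + 1ℚ) (+-mono-≤-< (0≤∣p∣ (seq x N)) 0<1) (N , λ n N≤n →
      ≤-<-trans (subst (_≤ ∣ seq x N ∣ + ∣ seq x n - seq x N ∣)
                  (cong ∣_∣ (solve 2 (λ a b → a :+ (b :- a) := b) refl (seq x N) (seq x n)))
                  (∣p+q∣≤∣p∣+∣q∣ (seq x N) (seq x n - seq x N)))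
                (+-monoʳ-< ∣ seq x N ∣ (h n N N≤n ℕ.≤-refl)))

    pull₁ : ∀ {u} → Bounded u → N₂.Bounded (λ (m , n) → u m)
    pull₁ (bound B B>0 (N , h)) = N₂.bound B B>0 (N , λ (m , n) (N≤m , _) → h m N≤m)

    pull₂ : ∀ {u} → Bounded u → N₂.Bounded (λ (m , n) → u n)
    pull₂ (bound B B>0 (N , h)) = N₂.bound B B>0 (N , λ (m , n) (_ , N≤n) → h n N≤n)

  open ℝ-lemmas

  infixl 6 _+ᵣ_
  infixl 7 _*ᵣ_
  infix  8 -ᵣ_

  constᵣ : ℚ → ℝ
  seq (constᵣ p) _ = p
  cauchy (constᵣ p) = null⇒cauchy {λ _ → p} (N₂.null-0 λ _ → +-inverseʳ p)

  0ᵣ 1ᵣ : ℝ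
  0ᵣ = constᵣ 0ℚ
  1ᵣ = constᵣ 1ℚ

  _+ᵣ_ : ℝ → ℝ → ℝ
  seq (x +ᵣ y) n = seq x n + seq y n
  cauchy (x +ᵣ y) = null⇒cauchy {λ n → seq x n + seq y n} (N₂.null-≡
    (λ (m , n) → solve 4 (λ a b c d → (a :- b) :+ (c :- d) := (a :+ c) :- (b :+ d)) refl
                   (seq x m) (seq x n) (seq y m) (seq y n))
    (N₂.null-+ (cauchy⇒null x) (cauchy⇒null y)))

  _*ᵣ_ : ℝ → ℝ → ℝ
  seq (x *ᵣ y) n = seq x n * seq y n
  cauchy (x *ᵣ y) = null⇒cauchy {λ n → seq x n * seq y n} (N₂.null-≡
    (λ (m , n) → solve 4 (λ a b c d → a :* (c :- d) :+ d :* (a :- b) := a :* c :- b :* d) refl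
                   (seq x m) (seq x n) (seq y m) (seq y n))
    (N₂.null-+ (N₂.null-* (pull₁ (bounded x)) (cauchy⇒null y))
               (N₂.null-* (pull₂ (bounded y)) (cauchy⇒null x))))

  -ᵣ_ : ℝ → ℝ
  seq (-ᵣ x) n = - seq x n
  cauchy (-ᵣ x) = null⇒cauchy {λ n → - seq x n} (N₂.null-≡
    (λ (m , n) → solve 2 (λ a b → :- (a :- b) := (:- a) :- (:- b)) refl (seq x m) (seq x n))
    (N₂.null-neg (cauchy⇒null x)))

  module ℝ-properties where

    open Tail₁

    abstract

      pointwise : ∀ {x y} → (∀ n → seq x n ≡ seq y n) → x ≈ᵣ y
      pointwise {x} {y} eq = null⇒≈ (null-0 λ n → trans (cong (_- seq y n) (eq n)) (+-inverseʳ (seq y n)))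

      ≈ᵣ-refl : ∀ {x} → x ≈ᵣ x
      ≈ᵣ-refl = pointwise λ _ → refl

      ≈ᵣ-sym : ∀ {x y} → x ≈ᵣ y → y ≈ᵣ x
      ≈ᵣ-sym {x} {y} (mk≈ eq) = mk≈ λ e e>0 →
        Ev-map (λ n → subst (_< e) (∣p-q∣≡∣q-p∣ (seq x n) (seq y n))) (eq e e>0)

      ≈ᵣ-trans : ∀ {x y z} → x ≈ᵣ y → y ≈ᵣ z → x ≈ᵣ z
      ≈ᵣ-trans {x} {y} {z} p q = null⇒≈ (null-≡
        (λ n → solve 3 (λ a b c → (a :- b) :+ (b :- c) := a :- c) refl (seq x n) (seq y n) (seq z n))
        (null-+ (≈⇒null p) (≈⇒null q)))

      +ᵣ-cong : ∀ {x y u v} → x ≈ᵣ y → u ≈ᵣ v → x +ᵣ u ≈ᵣ y +ᵣ v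
      +ᵣ-cong {x} {y} {u} {v} p q = null⇒≈ (null-≡
        (λ n → solve 4 (λ a b c d → (a :- b) :+ (c :- d) := (a :+ c) :- (b :+ d)) refl
                 (seq x n) (seq y n) (seq u n) (seq v n))
        (null-+ (≈⇒null p) (≈⇒null q)))

      *ᵣ-cong : ∀ {x y u v} → x ≈ᵣ y → u ≈ᵣ v → x *ᵣ u ≈ᵣ y *ᵣ v
      *ᵣ-cong {x} {y} {u} {v} p q = null⇒≈ (null-≡
        (λ n → solve 4 (λ a b c d → a :* (c :- d) :+ d :* (a :- b) := a :* c :- b :* d) refl
                 (seq x n) (seq y n) (seq u n) (seq v n))
        (null-+ (null-* (bounded x) (≈⇒null q)) (null-* (bounded v) (≈⇒null p))))

      -ᵣ-cong : ∀ {x y} → x ≈ᵣ y → -ᵣ x ≈ᵣ -ᵣ y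
      -ᵣ-cong {x} {y} p = null⇒≈ (null-≡
        (λ n → solve 2 (λ a b → :- (a :- b) := (:- a) :- (:- b)) refl (seq x n) (seq y n)) (null-neg (≈⇒null p)))

      trichotomy : ∀ (d : ℕ → ℚ) g → 0ℚ < g →
        (∃ λ N → ∀ m n → N ℕ.≤ m → N ℕ.≤ n → ∣ d m - d n ∣ < g) →
        Ev (λ n → g < d n) ⊎ Ev (λ n → g < - d n) ⊎ Ev (λ n → ∣ d n ∣ < (g + g) + (g + g))
      trichotomy d g g>0 (N , h) = go (≤-total (d N) (g + g)) (≤-total (- d N) (g + g))
        where
        down : ∀ n → N ℕ.≤ n → d N - d n < g
        down n N≤n = ≤-<-trans (p≤∣p∣ (d N - d n)) (h N n ℕ.≤-refl N≤n)
        up : ∀ n → N ℕ.≤ n → d n - d N < g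
        up n N≤n = ≤-<-trans (p≤∣p∣ (d n - d N)) (h n N N≤n ℕ.≤-refl)
        slack : ∀ {u v} → u - v < g → v ≤ g + g → u < (g + g) + (g + g)
        slack {u} {v} uv v≤ = <-by (((g - (u - v)) + ((g + g) - v)) + g)
          (+-pos (+-mono-<-≤ (<⇒0<- uv) (≤⇒0≤- v≤)) g>0)
          (solve 3 (λ u v g → u :+ (((g :- (u :- v)) :+ ((g :+ g) :- v)) :+ g) := (g :+ g) :+ (g :+ g)) refl u v g)
        above : ∀ {u v} → u - v < g → g + g ≤ u → g < v
        above {u} {v} uv ≤u = <-by ((g - (u - v)) + (u - (g + g)))
          (+-mono-<-≤ (<⇒0<- uv) (≤⇒0≤- ≤u))
          (solve 3 (λ u v g → g :+ ((g :- (u :- v)) :+ (u :- (g :+ g))) := v) refl u v g)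
        flip : ∀ a b → a - b ≡ - b - - a
        flip = solve 2 (λ a b → a :- b := (:- b) :- (:- a)) refl
        go : d N ≤ g + g ⊎ g + g ≤ d N → - d N ≤ g + g ⊎ g + g ≤ - d N →
             Ev (λ n → g < d n) ⊎ Ev (λ n → g < - d n) ⊎ Ev (λ n → ∣ d n ∣ < (g + g) + (g + g))
        go (inj₂ big) _ = inj₁ (N , λ n N≤n → above (down n N≤n) big)
        go (inj₁ _) (inj₂ big) = inj₂ (inj₁ (N , λ n N≤n →
          above (subst (_< g) (flip (d n) (d N)) (up n N≤n)) big))
        go (inj₁ lo) (inj₁ lo′) = inj₂ (inj₂ (N , λ n N≤n → ∣∣-lub-<
          (slack (up n N≤n) lo) (slack (subst (_< g) (flip (d N) (d n)) (down n N≤n)) lo′)))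

      compare : ∀ x y e → 0ℚ < e → x #ᵣ y ⊎ Ev (λ n → ∣ seq x n - seq y n ∣ < e)
      compare x y e e>0 = step (half e>0)
        where
        step : (∃ λ f → 0ℚ < f × f + f ≡ e) → x #ᵣ y ⊎ Ev (λ n → ∣ seq x n - seq y n ∣ < e)
        step (f , f>0 , f+f≡e) = step′ (half f>0)
          where
          step′ : (∃ λ g → 0ℚ < g × g + g ≡ f) → x #ᵣ y ⊎ Ev (λ n → ∣ seq x n - seq y n ∣ < e)
          step′ (g , g>0 , g+g≡f) =
            decide (trichotomy (λ n → seq x n - seq y n) g g>0 (cauchy (x +ᵣ -ᵣ y) g g>0))
            where
            decide : Ev (λ n → g < seq x n - seq y n) ⊎ Ev (λ n → g < - (seq x n - seq y n)) ⊎
                       Ev (λ n → ∣ seq x n - seq y n ∣ < (g + g) + (g + g)) → x #ᵣ y ⊎ Ev (λ n → ∣ seq x n - seq y n ∣ < e)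
            decide (inj₁ pos)        = inj₁ (inj₂ (g , g>0 , pos))
            decide (inj₂ (inj₁ neg)) = inj₁ (inj₁ (g , g>0 , Ev-map
              (λ n → subst (g <_) (solve 2 (λ a b → :- (a :- b) := b :- a) refl (seq x n) (seq y n))) neg))
            decide (inj₂ (inj₂ small)) = inj₂ (Ev-map
              (λ n → subst (∣ seq x n - seq y n ∣ <_) (trans (cong₂ _+_ g+g≡f g+g≡f) f+f≡e)) small)

      Ev-absurd : ∀ {P Q : ℕ → Set} → (∀ n → P n → Q n → ⊥) → Ev P → Ev Q → ⊥
      Ev-absurd f p q with Ev-map₂ f p q
      ... | N , h = h N ℕ.≤-refl

      away⇒# : ∀ x y e → 0ℚ < e → Ev (λ n → e < ∣ seq x n - seq y n ∣) → x #ᵣ y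
      away⇒# x y e e>0 away = decide (compare x y e e>0)
        where
        decide : x #ᵣ y ⊎ Ev (λ n → ∣ seq x n - seq y n ∣ < e) → x #ᵣ y
        decide (inj₁ x#y)  = x#y
        decide (inj₂ near) = ⊥-elim (Ev-absurd (λ _ → <-asym) away near)

      #⇒away : ∀ {x y} → x #ᵣ y → ∃ λ e → 0ℚ < e × Ev (λ n → e < ∣ seq x n - seq y n ∣)
      #⇒away {x} {y} (inj₁ (e , e>0 , ev)) = e , e>0 , Ev-map
        (λ n lt → <-≤-trans lt (subst (seq y n - seq x n ≤_) (∣p-q∣≡∣q-p∣ (seq y n) (seq x n))
                                  (p≤∣p∣ (seq y n - seq x n)))) ev
      #⇒away {x} {y} (inj₂ (e , e>0 , ev)) = e , e>0 , Ev-map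
        (λ n lt → <-≤-trans lt (p≤∣p∣ (seq x n - seq y n))) ev

      #ᵣ-irrefl : ∀ {x y} → x ≈ᵣ y → ¬ (x #ᵣ y)
      #ᵣ-irrefl {x} {y} (mk≈ x≈y) x#y =
        let e , e>0 , ev = #⇒away {x} {y} x#y in Ev-absurd (λ _ → <-asym) ev (x≈y e e>0)

      #ᵣ-sym : ∀ {x y} → x #ᵣ y → y #ᵣ x
      #ᵣ-sym (inj₁ lt) = inj₂ lt
      #ᵣ-sym (inj₂ lt) = inj₁ lt

      #ᵣ-cotrans : ∀ {x y} → x #ᵣ y → ∀ z → x #ᵣ z ⊎ z #ᵣ y
      #ᵣ-cotrans {x} {y} x#y z =
        let e , e>0 , ev = #⇒away {x} {y} x#y ; d , d>0 , d+d≡e = half e>0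
        in decide d d>0 (subst (λ u → Ev (λ n → u < ∣ seq x n - seq y n ∣)) (sym d+d≡e) ev) (compare x z d d>0)
        where
        step : ∀ d n → d + d < ∣ seq x n - seq y n ∣ → ∣ seq x n - seq z n ∣ < d → d < ∣ seq z n - seq y n ∣
        step d n far close = <-by ((∣ a ∣ + ∣ b ∣ - (d + d)) + (d - ∣ a ∣))
          (+-pos (<⇒0<- (<-≤-trans far triangle)) (<⇒0<- close))
          (solve 3 (λ d A B → d :+ ((A :+ B :- (d :+ d)) :+ (d :- A)) := B) refl d ∣ a ∣ ∣ b ∣)
          where
          a b : ℚ
          a = seq x n - seq z n
          b = seq z n - seq y n
          triangle : ∣ seq x n - seq y n ∣ ≤ ∣ a ∣ + ∣ b ∣
          triangle = subst (_≤ ∣ a ∣ + ∣ b ∣)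
            (cong ∣_∣ (solve 3 (λ x y z → (x :- z) :+ (z :- y) := x :- y) refl (seq x n) (seq y n) (seq z n)))
            (∣p+q∣≤∣p∣+∣q∣ a b)
        decide : ∀ d → 0ℚ < d → Ev (λ n → d + d < ∣ seq x n - seq y n ∣) →
                 x #ᵣ z ⊎ Ev (λ n → ∣ seq x n - seq z n ∣ < d) → x #ᵣ z ⊎ z #ᵣ y
        decide d d>0 ev (inj₁ x#z)  = inj₁ x#z
        decide d d>0 ev (inj₂ near) = inj₂ (away⇒# z y d d>0 (Ev-map₂ (step d) ev near))

      tightᵣ : ∀ {x y} → ¬ (x #ᵣ y) → x ≈ᵣ y
      tightᵣ {x} {y} ¬x#y = mk≈ λ e e>0 → decide e (compare x y e e>0)
        where
        decide : ∀ e → x #ᵣ y ⊎ Ev (λ n → ∣ seq x n - seq y n ∣ < e) → Ev (λ n → ∣ seq x n - seq y n ∣ < e)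
        decide e (inj₁ x#y) = ⊥-elim (¬x#y x#y)
        decide e (inj₂ ev)  = ev

  open ℝ-properties
  open Tail₁

  module Reciprocal (x : ℝ) (x#0 : x #ᵣ 0ᵣ) where

    private
      ix : ℕ → ℚ
      ix n = inv (seq x n)

      gap : ℚ
      gap = proj₁ (#⇒away {x} {0ᵣ} x#0)

      gap>0 : 0ℚ < gap
      gap>0 = proj₁ (proj₂ (#⇒away {x} {0ᵣ} x#0))

      away : Ev (λ n → gap < ∣ seq x n ∣)
      away = Ev-map (λ n → subst (λ z → gap < ∣ z ∣) (+-identityʳ (seq x n)))
                    (proj₂ (proj₂ (#⇒away {x} {0ᵣ} x#0)))

      nonzero : ∀ n → gap < ∣ seq x n ∣ → seq x n ≢ 0ℚ
      nonzero n lt eq = <-asym gap>0 (subst (λ z → gap < ∣ z ∣) eq lt)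

      ix-bound : ∀ {r} → 0ℚ < r → gap * r ≡ 1ℚ → ∀ n → gap < ∣ seq x n ∣ → ∣ ix n ∣ < r
      ix-bound {r} r>0 gr≡1 n lt with ∣ ix n ∣ <? r
      ... | yes small = small
      ... | no big = ⊥-elim (<-irrefl (trans gr≡1 (sym one)) (<-≤-trans
              (*-monoˡ-<-pos r {{positive r>0}} lt)
              (*-monoˡ-≤-nonNeg ∣ seq x n ∣ {{nonNegative (0≤∣p∣ (seq x n))}} (≮⇒≥ big))))
        where
        one : ∣ seq x n ∣ * ∣ ix n ∣ ≡ 1ℚ
        one = trans (sym (∣p*q∣≡∣p∣*∣q∣ (seq x n) (ix n))) (cong ∣_∣ (inv-inverse (seq x n) (nonzero n lt)))

      ix-bounded : Bounded ix
      ix-bounded = let r , r>0 , gr≡1 = reciprocal gap>0 in bound r r>0 (Ev-map (ix-bound r>0 gr≡1) away)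

      ix-cauchy : N₂.Null (λ (m , n) → ix m - ix n)
      ix-cauchy = N₂.null-resp
        (proj₁ away , λ (m , n) (N≤m , N≤n) → difference (seq x m) (ix m) (seq x n) (ix n)
          (inv-inverse (seq x m) (nonzero m (proj₂ away m N≤m)))
          (inv-inverse (seq x n) (nonzero n (proj₂ away n N≤n))))
        (N₂.null-* (N₂.bounded-* (pull₁ ix-bounded) (pull₂ ix-bounded)) (N₂.null-neg (cauchy⇒null x)))
        where
        difference : ∀ a b c d → a * b ≡ 1ℚ → c * d ≡ 1ℚ → (b * d) * - (a - c) ≡ b - d
        difference a b c d ab cd = trans
          (solve 4 (λ a b c d → (b :* d) :* (:- (a :- c)) := b :* (c :* d) :- d :* (a :* b)) refl a b c d)
          (trans (cong₂ (λ u v → b * u - d * v) cd ab)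
                 (cong₂ _-_ (*-identityʳ b) (*-identityʳ d)))

    recip : ℝ
    seq recip = ix
    cauchy recip = null⇒cauchy {ix} ix-cauchy

    *-recip : x *ᵣ recip ≈ᵣ 1ᵣ
    *-recip = null⇒≈ (null-resp
      (proj₁ away , λ n N≤n → sym (cong (_- 1ℚ) (inv-inverse (seq x n) (nonzero n (proj₂ away n N≤n)))))
      (null-0 {u = λ _ → 1ℚ - 1ℚ} λ _ → refl))

  module SquareRoot where

    step : ℕ → ℚ
    step n = inv (fromℕ (suc n))

    step-inverse : ∀ n → fromℕ (suc n) * step n ≡ 1ℚ
    step-inverse n = inv-inverse (fromℕ (suc n)) (λ eq → <-irrefl (sym eq) (0<fromℕ-suc n))

    step>0 : ∀ n → 0ℚ < step n
    step>0 n with 0ℚ <? step n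
    ... | yes lt = lt
    ... | no ≮ = ⊥-elim (<-irrefl refl (<-≤-trans 0<1 (subst (_≤ 0ℚ) (step-inverse n)
            (subst (fromℕ (suc n) * step n ≤_) (*-zeroʳ (fromℕ (suc n)))
              (*-monoˡ-≤-nonNeg (fromℕ (suc n)) {{nonNegative (fromℕ≥0 (suc n))}} (≮⇒≥ ≮))))))

    step-null : ∀ e → 0ℚ < e → Ev (λ n → step n < e)
    step-null e e>0 with reciprocal e>0
    ... | r , r>0 , er≡1 with archimedean r
    ... | N , r<N = N , λ n N≤n → small n (<-≤-trans r<N (fromℕ-mono (ℕ.m≤n⇒m≤1+n N≤n)))
      where
      small : ∀ n → r < fromℕ (suc n) → step n < e
      small n r< with step n <? e
      ... | yes lt = lt
      ... | no ≮ = ⊥-elim (<-irrefl (trans er≡1 (trans (sym (step-inverse n)) (*-comm (fromℕ (suc n)) (step n))))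
              (<-≤-trans (*-monoʳ-<-pos e {{positive e>0}} r<)
                (*-monoʳ-≤-nonNeg (fromℕ (suc n)) {{nonNegative (fromℕ≥0 (suc n))}} (≮⇒≥ ≮))))

    -- s is √t up to d, from below.
    Approximates : ℚ → ℚ → ℚ → Set
    Approximates t d s = 0ℚ ≤ s × s * s ≤ t × t < (s + d) * (s + d)

    search : ∀ t d → 0ℚ ≤ t → 0ℚ < d → ∀ K → t < (fromℕ K * d) * (fromℕ K * d) → ∃ (Approximates t d)
    search t d t≥0 d>0 zero t< = ⊥-elim (<-irrefl refl (≤-<-trans t≥0
      (subst (t <_) (solve 1 (λ d → (con 0ℚ :* d) :* (con 0ℚ :* d) := con 0ℚ) refl d) t<)))
    search t d t≥0 d>0 (suc k) t< with (fromℕ k * d) * (fromℕ k * d) ≤? t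
    ... | yes ≤t = fromℕ k * d , *-nonNeg (fromℕ≥0 k) (<⇒≤ d>0) , ≤t , subst (t <_)
            (solve 2 (λ a d → ((a :+ con 1ℚ) :* d) :* ((a :+ con 1ℚ) :* d) := (a :* d :+ d) :* (a :* d :+ d)) refl (fromℕ k) d) t<
    ... | no ≰t = search t d t≥0 d>0 k (≰⇒> ≰t)

    abstract
      approximate : ∀ t d → 0ℚ ≤ t → 0ℚ < d → ∃ (Approximates t d)
      approximate t d t≥0 d>0 with reciprocal d>0
      ... | r , r>0 , dr≡1 with archimedean (t * (r * r))
      ... | K , lt = search t d t≥0 d>0 (suc K) (<-≤-trans t<
              (≤-by (fromℕ K * fromℕ K * (d * d) + (fromℕ K * (d * d) + d * d))
                 (+-mono-≤ (*-nonNeg (*-nonNeg (fromℕ≥0 K) (fromℕ≥0 K)) (square≥0 d))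
                   (+-mono-≤ (*-nonNeg (fromℕ≥0 K) (square≥0 d)) (square≥0 d)))
                 (solve 2 (λ a d → a :* (d :* d) :+ (a :* a :* (d :* d) :+ (a :* (d :* d) :+ d :* d))
                             := ((a :+ con 1ℚ) :* d) :* ((a :+ con 1ℚ) :* d)) refl (fromℕ K) d)))
        where
        t< : t < fromℕ K * (d * d)
        t< = subst (_< fromℕ K * (d * d))
          (trans (solve 3 (λ t r d → (t :* (r :* r)) :* (d :* d) := t :* ((d :* r) :* (d :* r))) refl t r d)
                 (trans (cong (λ u → t * (u * u)) dr≡1) (*-identityʳ t)))
          (*-monoˡ-<-pos (d * d) {{positive (*-pos d>0 d>0)}} lt)

    module _ (x : ℝ) where

      t : ℕ → ℚ
      t n = seq x n ⊔ 0ℚ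

      root : ∀ n → ∃ (Approximates (t n) (step n))
      root n = approximate (t n) (step n) (p≤q⊔p (seq x n) 0ℚ) (step>0 n)

      s : ℕ → ℚ
      s n = proj₁ (root n)

      s≥0 : ∀ n → 0ℚ ≤ s n
      s≥0 n = proj₁ (proj₂ (root n))

      t-close : ∀ m n → t m ≤ t n + ∣ seq x m - seq x n ∣
      t-close m n = ⊔-lub
        (subst (_≤ t n + ∣ seq x m - seq x n ∣)
          (solve 2 (λ a b → b :+ (a :- b) := a) refl (seq x m) (seq x n))
          (+-mono-≤ (p≤p⊔q (seq x n) 0ℚ) (p≤∣p∣ (seq x m - seq x n))))
        (+-mono-≤ (p≤q⊔p (seq x n) 0ℚ) (0≤∣p∣ (seq x m - seq x n)))

      s-close : ∀ {h} → 0ℚ < h → ∀ m n → step n < h → ∣ seq x m - seq x n ∣ < h * h → s m - s n < h + h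
      s-close {h} h>0 m n step<h near = ≰⇒> λ big → <-irrefl refl (<-≤-trans upper (lower big))
        where
        upper : t m < (s n + h) * (s n + h) + h * h
        upper = ≤-<-trans (t-close m n) (+-mono-< (<-trans (proj₂ (proj₂ (proj₂ (root n))))
          (*-mono-<-nonNeg sd≥0 sd< sd≥0 sd<)) near)
          where
          sd≥0 : 0ℚ ≤ s n + step n
          sd≥0 = +-mono-≤ (s≥0 n) (<⇒≤ (step>0 n))
          sd< : s n + step n < s n + h
          sd< = +-monoʳ-< (s n) step<h
        k : ℚ
        k = (s m - s n) - (h + h)
        b≥0 : 0ℚ ≤ s n + (h + h)
        b≥0 = +-mono-≤ (s≥0 n) (<⇒≤ (+-pos h>0 h>0))
        lower : h + h ≤ s m - s n → (s n + h) * (s n + h) + h * h ≤ t m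
        lower big = ≤-trans (≤-by ((k * k + (k * b + k * b)) + (h * (s n + (h + h)) + h * s n))
            (+-mono-≤ (+-mono-≤ (square≥0 k) (+-mono-≤ (*-nonNeg k≥0 b≥0) (*-nonNeg k≥0 b≥0)))
                      (+-mono-≤ (*-nonNeg (<⇒≤ h>0) b≥0) (*-nonNeg (<⇒≤ h>0) (s≥0 n))))
            (solve 3 (λ a b h → ((b :+ h) :* (b :+ h) :+ h :* h)
                          :+ ((((a :- b) :- (h :+ h)) :* ((a :- b) :- (h :+ h))
                            :+ (((a :- b) :- (h :+ h)) :* (b :+ (h :+ h)) :+ ((a :- b) :- (h :+ h)) :* (b :+ (h :+ h))))
                           :+ (h :* (b :+ (h :+ h)) :+ h :* b))
                        := a :* a) refl (s m) (s n) h))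
          (proj₁ (proj₂ (proj₂ (root m))))
          where
          k≥0 : 0ℚ ≤ k
          k≥0 = ≤⇒0≤- big
          b : ℚ
          b = s n + (h + h)

      s-cauchy : IsCauchy s
      s-cauchy e e>0 = let h , h>0 , h+h≡e = half e>0 in
        subst (λ u → ∃ λ N → ∀ m n → N ℕ.≤ m → N ℕ.≤ n → ∣ s m - s n ∣ < u) h+h≡e
          (halves h h>0 (cauchy x (h * h) (*-pos h>0 h>0)) (step-null h h>0))
        where
        halves : ∀ h → 0ℚ < h → (∃ λ N → ∀ m n → N ℕ.≤ m → N ℕ.≤ n → ∣ seq x m - seq x n ∣ < h * h) →
          Ev (λ n → step n < h) → ∃ λ N → ∀ m n → N ℕ.≤ m → N ℕ.≤ n → ∣ s m - s n ∣ < h + h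
        halves h h>0 (M , near) (N , small) = M ℕ.⊔ N , λ m n ≤m ≤n →
          ∣∣-lub-< (s-close h>0 m n (small n (ℕ.≤-trans (ℕ.m≤n⊔m M N) ≤n))
                     (near m n (ℕ.≤-trans (ℕ.m≤m⊔n M N) ≤m) (ℕ.≤-trans (ℕ.m≤m⊔n M N) ≤n)))
                   (subst (_< h + h) (solve 2 (λ a b → b :- a := :- (a :- b)) refl (s m) (s n))
                     (s-close h>0 n m (small m (ℕ.≤-trans (ℕ.m≤n⊔m M N) ≤m))
                       (near n m (ℕ.≤-trans (ℕ.m≤m⊔n M N) ≤n) (ℕ.≤-trans (ℕ.m≤m⊔n M N) ≤m))))

    -- The nonnegative square root of max (x, 0).
    sqrt : ℝ → ℝ
    seq (sqrt x) = s x
    cauchy (sqrt x) = s-cauchy x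

    sqrt² : ∀ x → (∀ n → 0ℚ ≤ seq x n) → sqrt x *ᵣ sqrt x ≈ᵣ x
    sqrt² x x≥0 = mk≈ λ e e>0 →
      Ev-map₂ (λ n lt d<1 → near e e>0 n (root x n) lt d<1) (Null.tails error e e>0) (step-null 1ℚ 0<1)
      where
      error : Null (λ n → ((s x n + s x n) + 1ℚ) * step n)
      error = null-* (bounded ((sqrt x +ᵣ sqrt x) +ᵣ 1ᵣ))
        (null λ d d>0 → Ev-map (λ n → subst (_< d) (sym (0≤p⇒∣p∣≡p (<⇒≤ (step>0 n))))) (step-null d d>0))
      near : ∀ e → 0ℚ < e → ∀ n ((r , _) : ∃ (Approximates (t x n) (step n))) →
             ∣ ((r + r) + 1ℚ) * step n ∣ < e → step n < 1ℚ → ∣ r * r - seq x n ∣ < e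
      near e e>0 n (r , r≥0 , lo , hi) lt d<1 = ∣∣-lub-<
        (≤-<-trans (≤-by (v - r * r) (≤⇒0≤- lo′) (solve 2 (λ r v → (r :* r :- v) :+ (v :- r :* r) := con 0ℚ) refl r v)) e>0)
        (<-trans (<-by (((r + d) * (r + d) - v) + d * (1ℚ - d))
                   (+-pos (<⇒0<- hi′) (*-pos (step>0 n) (<⇒0<- d<1)))
                   (solve 3 (λ r v d → (:- (r :* r :- v)) :+ (((r :+ d) :* (r :+ d) :- v) :+ d :* (con 1ℚ :- d))
                               := ((r :+ r) :+ con 1ℚ) :* d) refl r v d))
                 (≤-<-trans (p≤∣p∣ (((r + r) + 1ℚ) * d)) lt))
        where
        d v : ℚ
        d = step n
        v = seq x n
        v⁺ : v ⊔ 0ℚ ≡ v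
        v⁺ = p≥q⇒p⊔q≡p (x≥0 n)
        lo′ : r * r ≤ v
        lo′ = subst (r * r ≤_) v⁺ lo
        hi′ : v < (r + d) * (r + d)
        hi′ = subst (_< (r + d) * (r + d)) v⁺ hi

  open SquareRoot using (sqrt)

  infix 4 _≈ᶜ_ _#ᶜ_
  infixl 6 _+ᶜ_
  infixl 7 _*ᶜ_
  infix  8 -ᶜ_

  record ℂ : Set where
    no-eta-equality
    constructor _+i_
    field
      re im : ℝ

  open ℂ public

  record _≈ᶜ_ (z w : ℂ) : Set where
    constructor mk≈ᶜ
    field
      re≈ : re z ≈ᵣ re w
      im≈ : im z ≈ᵣ im w

  data _#ᶜ_ (z w : ℂ) : Set where
    re# : re z #ᵣ re w → z #ᶜ w
    im# : im z #ᵣ im w → z #ᶜ w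

  0ᶜ 1ᶜ : ℂ
  0ᶜ = 0ᵣ +i 0ᵣ
  1ᶜ = 1ᵣ +i 0ᵣ

  _+ᶜ_ : ℂ → ℂ → ℂ
  re (z +ᶜ w) = re z +ᵣ re w
  im (z +ᶜ w) = im z +ᵣ im w

  _*ᶜ_ : ℂ → ℂ → ℂ
  re (z *ᶜ w) = re z *ᵣ re w +ᵣ -ᵣ (im z *ᵣ im w)
  im (z *ᶜ w) = re z *ᵣ im w +ᵣ im z *ᵣ re w

  -ᶜ_ : ℂ → ℂ
  re (-ᶜ z) = -ᵣ re z
  im (-ᶜ z) = -ᵣ im z

  normSq : ℂ → ℝ
  normSq z = re z *ᵣ re z +ᵣ im z *ᵣ im z

  ∣_∣ᶜ : ℂ → ℝ
  ∣ z ∣ᶜ = sqrt (normSq z)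

  module ℂ-properties where

    ptᶜ : ∀ {z w} → (∀ n → seq (re z) n ≡ seq (re w) n) → (∀ n → seq (im z) n ≡ seq (im w) n) → z ≈ᶜ w
    ptᶜ p q = mk≈ᶜ (pointwise p) (pointwise q)

    abstract

      *-congᶜ : ∀ {z z′ w w′} → z ≈ᶜ z′ → w ≈ᶜ w′ → (z *ᶜ w) ≈ᶜ (z′ *ᶜ w′)
      *-congᶜ (mk≈ᶜ p q) (mk≈ᶜ p′ q′) = mk≈ᶜ
        (+ᵣ-cong (*ᵣ-cong p p′) (-ᵣ-cong (*ᵣ-cong q q′)))
        (+ᵣ-cong (*ᵣ-cong p q′) (*ᵣ-cong q p′))

      *-assocᶜ : ∀ z w v → ((z *ᶜ w) *ᶜ v) ≈ᶜ (z *ᶜ (w *ᶜ v))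
      *-assocᶜ z w v = ptᶜ
        (λ n → solve 6 (λ a b c d e f → (a :* c :+ (:- (b :* d))) :* e :+ (:- ((a :* d :+ b :* c) :* f))
                          := a :* (c :* e :+ (:- (d :* f))) :+ (:- (b :* (c :* f :+ d :* e)))) refl
                 (seq (re z) n) (seq (im z) n) (seq (re w) n) (seq (im w) n) (seq (re v) n) (seq (im v) n))
        (λ n → solve 6 (λ a b c d e f → (a :* c :+ (:- (b :* d))) :* f :+ (a :* d :+ b :* c) :* e
                          := a :* (c :* f :+ d :* e) :+ b :* (c :* e :+ (:- (d :* f)))) refl
                 (seq (re z) n) (seq (im z) n) (seq (re w) n) (seq (im w) n) (seq (re v) n) (seq (im v) n))

      *-commᶜ : ∀ z w → (z *ᶜ w) ≈ᶜ (w *ᶜ z)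
      *-commᶜ z w = ptᶜ
        (λ n → solve 4 (λ a b c d → a :* c :+ (:- (b :* d)) := c :* a :+ (:- (d :* b))) refl (seq (re z) n) (seq (im z) n) (seq (re w) n) (seq (im w) n))
        (λ n → solve 4 (λ a b c d → a :* d :+ b :* c := c :* b :+ d :* a) refl (seq (re z) n) (seq (im z) n) (seq (re w) n) (seq (im w) n))

      *-identityˡᶜ : ∀ z → (1ᶜ *ᶜ z) ≈ᶜ z
      *-identityˡᶜ z = ptᶜ
        (λ n → solve 2 (λ a b → con 1ℚ :* a :+ (:- (con 0ℚ :* b)) := a) refl (seq (re z) n) (seq (im z) n))
        (λ n → solve 2 (λ a b → con 1ℚ :* b :+ con 0ℚ :* a := b) refl (seq (re z) n) (seq (im z) n))

      distribˡᶜ : ∀ z w v → (z *ᶜ (w +ᶜ v)) ≈ᶜ ((z *ᶜ w) +ᶜ (z *ᶜ v))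
      distribˡᶜ z w v = ptᶜ
        (λ n → solve 6 (λ a b c d e f → a :* (c :+ e) :+ (:- (b :* (d :+ f)))
                          := (a :* c :+ (:- (b :* d))) :+ (a :* e :+ (:- (b :* f)))) refl
                 (seq (re z) n) (seq (im z) n) (seq (re w) n) (seq (im w) n) (seq (re v) n) (seq (im v) n))
        (λ n → solve 6 (λ a b c d e f → a :* (d :+ f) :+ b :* (c :+ e)
                          := (a :* d :+ b :* c) :+ (a :* f :+ b :* e)) refl
                 (seq (re z) n) (seq (im z) n) (seq (re w) n) (seq (im w) n) (seq (re v) n) (seq (im v) n))

    +-isAbelianGroupᶜ : IsAbelianGroup _≈ᶜ_ _+ᶜ_ 0ᶜ -ᶜ_
    +-isAbelianGroupᶜ = record
      { isGroup = record
        { isMonoid = record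
          { isSemigroup = record
            { isMagma = record
              { isEquivalence = record
                { refl  = mk≈ᶜ ≈ᵣ-refl ≈ᵣ-refl
                ; sym   = λ (mk≈ᶜ p q) → mk≈ᶜ (≈ᵣ-sym p) (≈ᵣ-sym q)
                ; trans = λ (mk≈ᶜ p q) (mk≈ᶜ p′ q′) → mk≈ᶜ (≈ᵣ-trans p p′) (≈ᵣ-trans q q′)
                }
              ; ∙-cong = λ (mk≈ᶜ p q) (mk≈ᶜ p′ q′) → mk≈ᶜ (+ᵣ-cong p p′) (+ᵣ-cong q q′)
              }
            ; assoc = λ z w v → ptᶜ (λ n → +-assoc (seq (re z) n) (seq (re w) n) (seq (re v) n))
                                     (λ n → +-assoc (seq (im z) n) (seq (im w) n) (seq (im v) n))
            }
          ; identity = (λ z → ptᶜ (λ n → +-identityˡ (seq (re z) n)) (λ n → +-identityˡ (seq (im z) n)))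
                     , (λ z → ptᶜ (λ n → +-identityʳ (seq (re z) n)) (λ n → +-identityʳ (seq (im z) n)))
          }
        ; inverse = (λ z → ptᶜ (λ n → +-inverseˡ (seq (re z) n)) (λ n → +-inverseˡ (seq (im z) n)))
                  , (λ z → ptᶜ (λ n → +-inverseʳ (seq (re z) n)) (λ n → +-inverseʳ (seq (im z) n)))
        ; ⁻¹-cong = λ (mk≈ᶜ p q) → mk≈ᶜ (-ᵣ-cong p) (-ᵣ-cong q)
        }
      ; comm = λ z w → ptᶜ (λ n → +-comm (seq (re z) n) (seq (re w) n)) (λ n → +-comm (seq (im z) n) (seq (im w) n))
      }

    open IsAbelianGroup +-isAbelianGroupᶜ using ()
      renaming (setoid to ≈ᶜ-setoid; trans to ≈ᶜ-trans; sym to ≈ᶜ-sym; ∙-cong to +-congᶜ)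

    isCommutativeRing : IsCommutativeRing _≈ᶜ_ _+ᶜ_ _*ᶜ_ -ᶜ_ 0ᶜ 1ᶜ
    isCommutativeRing = record
      { isRing = record
        { +-isAbelianGroup = +-isAbelianGroupᶜ
        ; *-cong = *-congᶜ
        ; *-assoc = *-assocᶜ
        ; *-identity = comm∧idˡ⇒id ≈ᶜ-setoid *-commᶜ *-identityˡᶜ
        ; distrib = comm∧distrˡ⇒distr ≈ᶜ-setoid +-congᶜ *-commᶜ distribˡᶜ
        }
      ; *-comm = *-commᶜ
      }

    normSq>0 : ∀ z w → z #ᶜ w → 0ᵣ <ᵣ normSq (z +ᶜ -ᶜ w)
    normSq>0 z w z#w = positive-norm z#w
      where
      enlarge : ∀ {e p} q → 0ℚ < e → e < ∣ p ∣ → e * e < (p * p + q * q) - 0ℚ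
      enlarge {e} {p} q e>0 lt = subst (e * e <_) (sym (+-identityʳ (p * p + q * q)))
        (<-≤-trans (*-mono-<-nonNeg (<⇒≤ e>0) lt (<⇒≤ e>0) lt)
          (≤-by (q * q) (square≥0 q) (cong (_+ q * q) (∣p∣² p))))
        where
        ∣p∣² : ∀ p → ∣ p ∣ * ∣ p ∣ ≡ p * p
        ∣p∣² p = trans (sym (∣p*q∣≡∣p∣*∣q∣ p p)) (0≤p⇒∣p∣≡p (square≥0 p))
      positive-norm : z #ᶜ w → 0ᵣ <ᵣ normSq (z +ᶜ -ᶜ w)
      positive-norm (re# ap) =
        let e , e>0 , ev = #⇒away {re z} {re w} ap
        in e * e , *-pos e>0 e>0 , Ev-map (λ n → enlarge (seq (im z) n - seq (im w) n) e>0) ev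
      positive-norm (im# ap) =
        let e , e>0 , ev = #⇒away {im z} {im w} ap
        in e * e , *-pos e>0 e>0 , Ev-map (λ n lt → subst (λ u → e * e < u - 0ℚ)
             (+-comm ((seq (im z) n - seq (im w) n) * (seq (im z) n - seq (im w) n)) _)
             (enlarge (seq (re z) n - seq (re w) n) e>0 lt)) ev

    inverse : ∀ z → 0ᵣ <ᵣ normSq z → ∃ λ w → (z *ᶜ w) ≈ᶜ 1ᶜ
    inverse z N>0 = w , mk≈ᶜ re≈1 im≈0
      where
      a b : ℝ
      a = re z
      b = im z
      module N = Reciprocal (normSq z) (inj₂ N>0)
      w : ℂ
      w = (a *ᵣ N.recip) +i (-ᵣ (b *ᵣ N.recip))
      re≈1 : re (z *ᶜ w) ≈ᵣ 1ᵣ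
      re≈1 = ≈ᵣ-trans {y = normSq z *ᵣ N.recip}
        (pointwise λ n →
          solve 3 (λ a b r → a :* (a :* r) :+ (:- (b :* (:- (b :* r)))) := (a :* a :+ b :* b) :* r) refl
            (seq a n) (seq b n) (seq N.recip n))
        N.*-recip
      im≈0 : im (z *ᶜ w) ≈ᵣ 0ᵣ
      im≈0 = pointwise λ n →
        solve 3 (λ a b r → a :* (:- (b :* r)) :+ b :* (a :* r) := con 0ℚ) refl (seq a n) (seq b n) (seq N.recip n)

    #ᶜ⇒invertible : ∀ {z w} → z #ᶜ w → Invertible _≈ᶜ_ 1ᶜ _*ᶜ_ (z +ᶜ -ᶜ w)
    #ᶜ⇒invertible {z} {w} z#w =
      let v , eq = inverse (z +ᶜ -ᶜ w) (normSq>0 z w z#w)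
      in v , ≈ᶜ-trans (*-commᶜ v (z +ᶜ -ᶜ w)) eq , eq

    0<1ᵣ : 0ᵣ <ᵣ 1ᵣ
    0<1ᵣ = let h , h>0 , h+h≡1 = half 0<1 in h , h>0 , 0 , λ _ _ → <-by h h>0 h+h≡1

    #-factor : ∀ x y u → (x +ᵣ -ᵣ y) *ᵣ u #ᵣ 0ᵣ → x #ᵣ y
    #-factor x y u ap =
      let e , e>0 , ev     = #⇒away {(x +ᵣ -ᵣ y) *ᵣ u} {0ᵣ} ap
          bound B B>0 bu   = bounded u
          d , d>0 , Bd≡e   = quotient e>0 B>0
      in away⇒# x y d d>0 (Ev-map₂ (λ n lt → large B>0 (seq x n - seq y n) (seq u n)
                                      (subst (_< _) (sym Bd≡e) lt)) ev bu)
      where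
      large : ∀ {B d} → 0ℚ < B → ∀ p q → B * d < ∣ p * q - 0ℚ ∣ → ∣ q ∣ < B → d < ∣ p ∣
      large {B} {d} B>0 p q lt q<B with d <? ∣ p ∣
      ... | yes d< = d<
      ... | no d≮ = ⊥-elim (<-irrefl refl (<-≤-trans lt (subst (_≤ B * d)
              (trans (*-comm ∣ q ∣ ∣ p ∣) (trans (sym (∣p*q∣≡∣p∣*∣q∣ p q)) (cong ∣_∣ (sym (+-identityʳ (p * q))))))
              (≤-trans (*-monoʳ-≤-nonNeg ∣ p ∣ {{nonNegative (0≤∣p∣ p)}} (<⇒≤ q<B))
                       (*-monoˡ-≤-nonNeg B {{nonNegative (<⇒≤ B>0)}} (≮⇒≥ d≮))))))

    #-difference : ∀ x y → x +ᵣ -ᵣ y ≈ᵣ 1ᵣ → 1ᵣ #ᵣ x → y #ᵣ 0ᵣ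
    #-difference x y (mk≈ eq) 1#x =
      let e , e>0 , ev = #⇒away {1ᵣ} {x} 1#x
          h , h>0 , h+h≡e = half e>0
      in away⇒# y 0ᵣ h h>0 (Ev-map₂ (λ n far → large h (seq x n) (seq y n) (subst (_< _) (sym h+h≡e) far)) ev (eq h h>0))
      where
      large : ∀ h p q → h + h < ∣ 1ℚ - p ∣ → ∣ p + - q - 1ℚ ∣ < h → h < ∣ q - 0ℚ ∣
      large h p q far near = <-by ((∣ p + - q - 1ℚ ∣ + ∣ q - 0ℚ ∣ - (h + h)) + (h - ∣ p + - q - 1ℚ ∣))
        (+-pos (<⇒0<- (<-≤-trans far (subst (_≤ ∣ p + - q - 1ℚ ∣ + ∣ q - 0ℚ ∣)
                  (trans (cong ∣_∣ (solve 2 (λ p q → (p :+ (:- q) :- con 1ℚ) :+ (q :- con 0ℚ) := p :- con 1ℚ) refl p q))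
                         (∣p-q∣≡∣q-p∣ p 1ℚ))
                  (∣p+q∣≤∣p∣+∣q∣ (p + - q - 1ℚ) (q - 0ℚ)))))
               (<⇒0<- near))
        (solve 3 (λ h A B → h :+ ((A :+ B :- (h :+ h)) :+ (h :- A)) := B) refl h ∣ p + - q - 1ℚ ∣ ∣ q - 0ℚ ∣)

    invertible⇒#ᶜ : ∀ {z w} → Invertible _≈ᶜ_ 1ᶜ _*ᶜ_ (z +ᶜ -ᶜ w) → z #ᶜ w
    invertible⇒#ᶜ {z} {w} (v , _ , mk≈ᶜ eq _) = split (#ᵣ-cotrans {1ᵣ} {0ᵣ} (inj₂ 0<1ᵣ) ac)
      where
      ac bd : ℝ
      ac = (re z +ᵣ -ᵣ re w) *ᵣ re v
      bd = (im z +ᵣ -ᵣ im w) *ᵣ im v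
      split : 1ᵣ #ᵣ ac ⊎ ac #ᵣ 0ᵣ → z #ᶜ w
      split (inj₂ ac#0) = re# (#-factor (re z) (re w) (re v) ac#0)
      split (inj₁ 1#ac) = im# (#-factor (im z) (im w) (im v) (#-difference ac bd eq 1#ac))

  ℂ-heytingField : HeytingField 0ℓ 0ℓ 0ℓ
  ℂ-heytingField = record
    { Carrier = ℂ
    ; _≈_ = _≈ᶜ_
    ; _#_ = _#ᶜ_
    ; _+_ = _+ᶜ_
    ; _*_ = _*ᶜ_
    ; -_ = -ᶜ_
    ; 0# = 0ᶜ
    ; 1# = 1ᶜ
    ; isHeytingField = record
      { isHeytingCommutativeRing = record
        { isCommutativeRing = isCommutativeRing
        ; isApartnessRelation = record
          { irrefl  = irreflᶜ
          ; sym     = λ where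
              (re# ap) → re# (swap ap)
              (im# ap) → im# (swap ap)
          ; cotrans = cotransᶜ
          }
        ; #⇒invertible = #ᶜ⇒invertible
        ; invertible⇒# = invertible⇒#ᶜ
        }
      ; tight = λ z w →
            (λ ¬z#w → mk≈ᶜ (tightᵣ (¬z#w ∘ re#)) (tightᵣ (¬z#w ∘ im#)))
          , irreflᶜ
      }
    }
    where
    open ℂ-properties
    irreflᶜ : ∀ {z w} → z ≈ᶜ w → ¬ (z #ᶜ w)
    irreflᶜ (mk≈ᶜ p _) (re# ap) = #ᵣ-irrefl p ap
    irreflᶜ (mk≈ᶜ _ q) (im# ap) = #ᵣ-irrefl q ap
    cotransᶜ : ∀ {z w} → z #ᶜ w → ∀ v → z #ᶜ v ⊎ v #ᶜ w
    cotransᶜ {z} {w} (re# ap) v = map re# re# (#ᵣ-cotrans {re z} {re w} ap (re v))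
    cotransᶜ {z} {w} (im# ap) v = map im# im# (#ᵣ-cotrans {im z} {im w} ap (im v))

  module Modulus where

    open ℂ-properties
    open FieldTheory ℂ-heytingField using (_^_)

    abstract

      <ᵣ-respʳ : ∀ {x y z} → y ≈ᵣ z → x <ᵣ y → x <ᵣ z
      <ᵣ-respʳ {x} {y} {z} (mk≈ y≈z) (e , e>0 , ev) =
        let d , d>0 , d+d≡e = half e>0
        in d , d>0 , Ev-map₂ (λ n far near → step d (seq x n) (seq y n) (seq z n) (subst (_< _) (sym d+d≡e) far) near)
                       ev (y≈z d d>0)
        where
        step : ∀ d x y z → d + d < y - x → ∣ y - z ∣ < d → d < z - x
        step d x y z far near = <-by ((y - x - (d + d)) + (d - ∣ y - z ∣) + (∣ y - z ∣ - (y - z)))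
          (+-mono-<-≤ (+-pos (<⇒0<- far) (<⇒0<- near)) (≤⇒0≤- (p≤∣p∣ (y - z))))
          (solve 5 (λ x y z d A → d :+ ((y :- x :- (d :+ d)) :+ (d :- A) :+ (A :- (y :- z))) := z :- x) refl
            x y z d ∣ y - z ∣)

      <ᵣ-respˡ : ∀ {x y z} → x ≈ᵣ z → x <ᵣ y → z <ᵣ y
      <ᵣ-respˡ {x} {y} {z} (mk≈ x≈z) (e , e>0 , ev) =
        let d , d>0 , d+d≡e = half e>0
        in d , d>0 , Ev-map₂ (λ n far near → step d (seq x n) (seq y n) (seq z n) (subst (_< _) (sym d+d≡e) far) near)
                       ev (x≈z d d>0)
        where
        step : ∀ d x y z → d + d < y - x → ∣ x - z ∣ < d → d < y - z
        step d x y z far near = <-by ((y - x - (d + d)) + (d - ∣ x - z ∣) + (∣ x - z ∣ - - (x - z)))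
          (+-mono-<-≤ (+-pos (<⇒0<- far) (<⇒0<- near)) (≤⇒0≤- (-p≤∣p∣ (x - z))))
          (solve 5 (λ x y z d A → d :+ ((y :- x :- (d :+ d)) :+ (d :- A) :+ (A :- (:- (x :- z)))) := y :- z) refl
            x y z d ∣ x - z ∣)

      ∣z∣≥0 : ∀ z n → 0ℚ ≤ seq ∣ z ∣ᶜ n
      ∣z∣≥0 z n = SquareRoot.s≥0 (normSq z) n

      normSq≥0 : ∀ z n → 0ℚ ≤ seq (normSq z) n
      normSq≥0 z n = +-mono-≤ (square≥0 (seq (re z) n)) (square≥0 (seq (im z) n))

      ∣z∣²≈normSq : ∀ z → ∣ z ∣ᶜ *ᵣ ∣ z ∣ᶜ ≈ᵣ normSq z
      ∣z∣²≈normSq z = SquareRoot.sqrt² (normSq z) (normSq≥0 z)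

      0<∣z∣⇒0<normSq : ∀ z → 0ᵣ <ᵣ ∣ z ∣ᶜ → 0ᵣ <ᵣ normSq z
      0<∣z∣⇒0<normSq z (e , e>0 , ev) = <ᵣ-respʳ {0ᵣ} (∣z∣²≈normSq z)
        (e * e , *-pos e>0 e>0 , Ev-map (λ n → step (seq ∣ z ∣ᶜ n)) ev)
        where
        step : ∀ s → e < s - 0ℚ → e * e < s * s - 0ℚ
        step s lt = subst (e * e <_) (sym (+-identityʳ (s * s)))
          (*-mono-<-nonNeg (<⇒≤ e>0) lt′ (<⇒≤ e>0) lt′)
          where
          lt′ : e < s
          lt′ = subst (e <_) (+-identityʳ s) lt

      0<∣z∣⇒z#0 : ∀ {z} → 0ᵣ <ᵣ ∣ z ∣ᶜ → z #ᶜ 0ᶜ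
      0<∣z∣⇒z#0 {z} 0<∣z∣ = invertible⇒#ᶜ (w , ≈.trans (≈.*-comm w (z +ᶜ -ᶜ 0ᶜ)) eq , eq)
        where
        module ≈ = HeytingField ℂ-heytingField
        w : ℂ
        w = proj₁ (inverse z (0<∣z∣⇒0<normSq z 0<∣z∣))
        eq : ((z +ᶜ -ᶜ 0ᶜ) *ᶜ w) ≈ᶜ 1ᶜ
        eq = ≈.trans (*-congᶜ (ptᶜ (λ n → +-identityʳ (seq (re z) n)) (λ n → +-identityʳ (seq (im z) n))) (≈.refl {w}))
                     (proj₂ (inverse z (0<∣z∣⇒0<normSq z 0<∣z∣)))

      ∣z∣<1⇒normSq<1 : ∀ z → ∣ z ∣ᶜ <ᵣ 1ᵣ → normSq z <ᵣ 1ᵣ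
      ∣z∣<1⇒normSq<1 z (e , e>0 , ev) = <ᵣ-respˡ {y = 1ᵣ} (∣z∣²≈normSq z)
        (e , e>0 , Ev-map (λ n lt → step (seq ∣ z ∣ᶜ n) (∣z∣≥0 z n) lt) ev)
        where
        step : ∀ s → 0ℚ ≤ s → e < 1ℚ - s → e < 1ℚ - s * s
        step s s≥0 lt = <-≤-trans lt (≤-by (s * (1ℚ - s)) (*-nonNeg s≥0 (<⇒≤ (<-trans e>0 lt)))
          (solve 1 (λ s → (con 1ℚ :- s) :+ s :* (con 1ℚ :- s) := con 1ℚ :- s :* s) refl s))

      normSq-* : ∀ z w n → seq (normSq (z *ᶜ w)) n ≡ seq (normSq z) n * seq (normSq w) n
      normSq-* z w n = solve 4 (λ a b c d →
          (a :* c :+ (:- (b :* d))) :* (a :* c :+ (:- (b :* d))) :+ (a :* d :+ b :* c) :* (a :* d :+ b :* c)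
            := (a :* a :+ b :* b) :* (c :* c :+ d :* d)) refl
        (seq (re z) n) (seq (im z) n) (seq (re w) n) (seq (im w) n)

      normSq^≤1 : ∀ z n → seq (normSq z) n ≤ 1ℚ → ∀ m → seq (normSq (z ^ m)) n ≤ 1ℚ
      normSq^≤1 z n N≤1 zero    = ≤-refl
      normSq^≤1 z n N≤1 (suc m) = subst (_≤ 1ℚ) (sym (normSq-* z (z ^ m) n))
        (≤-trans (*-monoˡ-≤-nonNeg (seq (normSq z) n) {{nonNegative (normSq≥0 z n)}} (normSq^≤1 z n N≤1 m))
                 (subst (_≤ 1ℚ) (sym (*-identityʳ (seq (normSq z) n))) N≤1))

      ∣z∣<1⇒1#z^ : ∀ {z} → ∣ z ∣ᶜ <ᵣ 1ᵣ → ∀ m → 1ᶜ #ᶜ (z ^ suc m)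
      ∣z∣<1⇒1#z^ {z} ∣z∣<1 m =
        let e , e>0 , ev = ∣z∣<1⇒normSq<1 z ∣z∣<1
            d , d>0 , d+d≡e = half e>0
        in re# (inj₂ (d , d>0 , Ev-map (λ n lt →
             step d (seq (re w) n) (seq (im w) n) (subst (_< _) (sym d+d≡e) (small e>0 n lt))) ev))
        where
        w : ℂ
        w = z ^ suc m
        small : ∀ {e} → 0ℚ < e → ∀ n → e < 1ℚ - seq (normSq z) n → e < 1ℚ - seq (normSq w) n
        small {e} e>0 n lt = <-≤-trans lt (+-monoʳ-≤ 1ℚ (neg-antimono-≤
          (subst (_≤ N) (sym (normSq-* z (z ^ m) n))
            (subst (N * seq (normSq (z ^ m)) n ≤_) (*-identityʳ N)
              (*-monoˡ-≤-nonNeg N {{nonNegative (normSq≥0 z n)}} (normSq^≤1 z n N≤1 m))))))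
          where
          N : ℚ
          N = seq (normSq z) n
          N≤1 : N ≤ 1ℚ
          N≤1 = ≤-by (1ℚ - N) (<⇒≤ (<-trans e>0 lt)) (solve 1 (λ N → N :+ (con 1ℚ :- N) := con 1ℚ) refl N)
        -- 2 (1 - x) = (1 - x² - y²) + (1 - x)² + y²
        step : ∀ d x y → d + d < 1ℚ - (x * x + y * y) → d < 1ℚ - x
        step d x y lt = ≰⇒> λ big → <-irrefl refl (<-≤-trans lt (≤-trans (≤-by ((1ℚ - x) * (1ℚ - x) + y * y)
          (+-mono-≤ (square≥0 (1ℚ - x)) (square≥0 y))
          (solve 2 (λ x y → (con 1ℚ :- (x :* x :+ y :* y)) :+ ((con 1ℚ :- x) :* (con 1ℚ :- x) :+ y :* y)
                              := (con 1ℚ :- x) :+ (con 1ℚ :- x)) refl x y)) (+-mono-≤ big big)))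

open ComplexNumbers public
open ComplexNumbers.Modulus public using (0<∣z∣⇒z#0; ∣z∣<1⇒1#z^)

{-# OPTIONS --safe #-}
module Submission where

-- Up to elementary factors, the n-th coefficient of M k l is a sum of residues.
-- Put
--
--   Ωₙ(x) = ∏_{t=1}^{n} ∏ⱼ (x - aⱼ qᵗ) / ∏_{t=0}^{n} ∏ⱼ (x - bⱼ qᵗ),
--
-- which has the simple poles x = bᵢ qˢ (1 ≤ i ≤ r, 0 ≤ s ≤ n). If s + m = n, the
-- product of cᵢ, of the m-th coefficient of the series of fᵢ and of the s-th
-- coefficient of that of gᵢ is q xʳ⁻² Res Ωₙ at x = bᵢ qˢ (coefficient-residue).
-- The substitutions of z qᵏ and z qˡ contribute the factors (qⁿ⁺¹ / x)ᵏ and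
-- (x / q)ˡ. Hence (M-total)
--
--   qˡ [zⁿ] M k l = q^((n + 1) k + 1) Wₙ(r - 2 + l - k),   Wₙ(e) = ∑ xᵉ Res Ωₙ,
--
-- the sum being over the poles above.
--
-- As Ωₙ is a quotient of monic polynomials whose degrees differ by r, Wₙ(e) is 0
-- for 0 ≤ e < r - 1 and 1 for e = r - 1 (W-order).
-- This is Lagrange interpolation, proved for weights of simple poles by deletion
-- of nodes (partialFraction-order), followed by multiplication with the factors
-- of the numerator (factors-order). It yields the zeros of M and M k (k + 1).
--
-- The relation
--
--   Ωₙ₊₁(x) ∏ⱼ (x - bⱼ qⁿ⁺¹) = Ωₙ(x) ∏ⱼ (x - aⱼ qⁿ⁺¹)
--
-- between residues (total-suc), multiplied by xᵈ and summed, expresses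
-- Wₙ₊₁(r + d) - Wₙ(r + d) through the Wₙ(e) and Wₙ₊₁(e) with e < r + d. By induction on
-- e the sequence n ↦ Wₙ(e) satisfies a linear recurrence with constant
-- coefficients in H (W-recurrent), so that its generating function is rational
-- (Recurrent⇒rational). For (k, l) = (r - 1, 0) the exponent r - 2 + l - k is -1.
-- The same relation multiplied by x⁻¹ gives b₁⋯bᵣ Wₙ₊₁(-1) = a₁⋯aᵣ Wₙ(-1)
-- (V-step), and M (r - 1) 0 is a geometric series.

open import Defs
open import Algebra.Apartness.Bundles using (HeytingField)
open import Algebra.Bundles using (CommutativeMonoid; CommutativeRing)
open import Data.Bool.Base using (true; false; if_then_else_)
open import Data.Fin.Base as Fin using (Fin; fromℕ; toℕ; inject₁; punchIn; combine; remQuot; _↑ˡ_; _↑ʳ_)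
open import Data.Integer.Base using (ℤ)
open import Data.List.Base as List using ([]; _∷_)
open import Data.List.Relation.Unary.All using (All; []; _∷_)
open import Data.Nat.Base as ℕ using (ℕ; zero; suc; _<_; _≤_; z≤n; s≤s)
open import Data.Nat.Induction using (<-rec)
open import Data.Product.Base using (_×_; _,_; proj₁; proj₂; uncurry)
open import Data.Sum.Base using (_⊎_; inj₁; inj₂)
open import Function.Base using (_∘_)
open import Relation.Binary.Definitions using (tri<; tri≈; tri>)
open import Relation.Binary.PropositionalEquality.Core as ≡ using (_≡_; _≢_)
open import Relation.Nullary using (¬_; yes; no; does)
open import Relation.Nullary.Decidable using (dec-true; dec-false)
import Algebra.Properties.CommutativeMonoid.Sum as CommutativeMonoidSum
import Algebra.Properties.CommutativeSemiring.Exp as CommutativeExp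
import Algebra.Properties.Ring as RingProperties
import Algebra.Properties.Semiring.Exp as Exp
import Algebra.Properties.Semiring.Sum as SemiringSum
import Algebra.Solver.CommutativeMonoid as CommutativeMonoidSolver
import Algebra.Solver.Ring.NaturalCoefficients.Default as SemiringSolver
import Data.Fin.Properties as Fin
import Data.Nat.Properties as ℕ
import Level
import Relation.Binary.Reasoning.Setoid as SetoidReasoning

-- Sums over pairs

module PairSums {ℓ ℓ₁} (M : CommutativeMonoid ℓ ℓ₁) where

  open CommutativeMonoid M
  open CommutativeMonoidSum M

  sum-++ : ∀ m {n} (t : Fin (m ℕ.+ n) → Carrier) → sum t ≈ sum (t ∘ (_↑ˡ n)) ∙ sum (t ∘ (m ↑ʳ_))
  sum-++ zero    t = sym (identityˡ _)
  sum-++ (suc m) t = trans (∙-congˡ (sum-++ m (t ∘ Fin.suc))) (sym (assoc _ _ _))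

  sum-combine : ∀ m n (t : Fin (m ℕ.* n) → Carrier) → sum t ≈ sum (λ i → sum (λ j → t (combine {m} {n} i j)))
  sum-combine zero    n t = refl
  sum-combine (suc m) n t = trans (sum-++ n t) (∙-congˡ (sum-combine m n (t ∘ (n ↑ʳ_))))

  sum-remQuot : ∀ m n (f : Fin m × Fin n → Carrier) →
    sum (f ∘ remQuot {m} n) ≈ sum (λ i → sum (λ j → f (i , j)))
  sum-remQuot m n f = trans (sum-combine m n (f ∘ remQuot {m} n))
    (sum-cong-≋ {m} λ i → sum-cong-≋ {n} λ j → reflexive (≡.cong f (Fin.remQuot-combine {m} {n} i j)))

-- The computation over an arbitrary Heyting field K

module FieldLemmas {ℓ ℓ₁ ℓ₂} (K : HeytingField ℓ ℓ₁ ℓ₂) where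

  open FieldTheory K
  open FieldTheory.Units K
  open CommutativeRing commutativeRing
    using (commutativeSemiring; *-commutativeMonoid; +-commutativeMonoid)
  open SetoidReasoning setoid
  open SemiringSolver commutativeSemiring using (solve; _:=_; _:+_; _:*_)
  open CommutativeMonoidSolver *-commutativeMonoid using ()
    renaming (solve to solve*; _⊕_ to infixl 7 _⊗_; _⊜_ to infix 4 _⊜_)
  open RingProperties ring
    using (-‿distribˡ-*; -‿distribʳ-*; -1*x≈-x; -‿involutive; -‿+-comm; +-cancelˡ)
  open Exp semiring using (^-congˡ; ^-congʳ; ^-homo-*; ^-assocʳ)
  open CommutativeExp commutativeSemiring using (^-distrib-*)
  module Sum = SemiringSum semiring
  module Product = CommutativeMonoidSum *-commutativeMonoid
  module PairSum = PairSums +-commutativeMonoid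
  module PairProduct = PairSums *-commutativeMonoid

  -- Linear recurrences and rational functions

  -- The difference operator with root -κ; with this sign, identities between such
  -- operators hold in every commutative semiring.
  Δ : Carrier → Series → Series
  Δ κ u n = u (suc n) + κ * u n

  Δ-cong : ∀ {u v} κ → u ≋ v → Δ κ u ≋ Δ κ v
  Δ-cong κ u≋v n = +-cong (u≋v (suc n)) (*-congˡ (u≋v n))

  module Rationality {p} (S : Carrier → Set p) where

    F : Carrier → Set (ℓ Level.⊔ ℓ₁ Level.⊔ ℓ₂ Level.⊔ p)
    F = SubfieldGeneratedBy S

    -- The sequences over F annihilated by a product of operators Δ κ with κ ∈ F.
    -- Generating functions of such sequences are the rational functions that
    -- are sums of a polynomial and of a fraction whose denominator splits over F;
    -- κ = 0 removes a term of the polynomial part.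
    data Recurrent : Series → Set (ℓ Level.⊔ ℓ₁ Level.⊔ ℓ₂ Level.⊔ p) where
      vanishing : ∀ {u} → u ≋ 0ₛ → Recurrent u
      step      : ∀ {u κ} → F (u 0) → F κ → Recurrent (Δ κ u) → Recurrent u

    Δ-0ₛ : ∀ {u κ} → u ≋ 0ₛ → Δ κ u ≋ 0ₛ
    Δ-0ₛ {u} {κ} u≋0 n = trans (Δ-cong {u} {0ₛ} κ u≋0 n) (trans (+-congˡ (zeroʳ κ)) (+-identityˡ 0#))

    Recurrent-cong : ∀ {u v} → u ≋ v → Recurrent u → Recurrent v
    Recurrent-cong u≋v (vanishing u≋0)      = vanishing λ n → trans (sym (u≋v n)) (u≋0 n)
    Recurrent-cong u≋v (step u₀∈F κ∈F Δu)   =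
      step (≈-∈ (u≋v 0) u₀∈F) κ∈F (Recurrent-cong (Δ-cong _ u≋v) Δu)

    Recurrent⇒∈ : ∀ {u} → Recurrent u → ∀ n → F (u n)
    Recurrent⇒∈ (vanishing u≋0)              n       = ≈-∈ (sym (u≋0 n)) 0∈
    Recurrent⇒∈ (step u₀∈F κ∈F Δu)           zero    = u₀∈F
    Recurrent⇒∈ {u} (step {κ = κ} u₀∈F κ∈F Δu) (suc n) = ≈-∈ eq
      (+-∈ (Recurrent⇒∈ Δu n) (neg-∈ (*-∈ κ∈F (Recurrent⇒∈ (step u₀∈F κ∈F Δu) n))))
      where
      eq : Δ κ u n - κ * u n ≈ u (suc n)
      eq = trans (+-assoc _ _ _) (trans (+-congˡ (-‿inverseʳ _)) (+-identityʳ _))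

    Recurrent-Δ : ∀ {u κ} → F κ → Recurrent u → Recurrent (Δ κ u)
    Recurrent-Δ κ∈F (vanishing u≋0) = vanishing (Δ-0ₛ u≋0)
    Recurrent-Δ {u} {κ} κ∈F R@(step {κ = ν} u₀∈F ν∈F Δu) =
      step (+-∈ (Recurrent⇒∈ R 1) (*-∈ κ∈F u₀∈F)) ν∈F
        (Recurrent-cong commute (Recurrent-Δ κ∈F Δu))
      where
      commute : Δ κ (Δ ν u) ≋ Δ ν (Δ κ u)
      commute n = solve 5 (λ κ ν u₀ u₁ u₂ →
          (u₂ :+ ν :* u₁) :+ κ :* (u₁ :+ ν :* u₀) := (u₂ :+ κ :* u₁) :+ ν :* (u₁ :+ κ :* u₀))
        refl κ ν (u n) (u (suc n)) (u (suc (suc n)))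

    -- By commutativity of the operators, Recurrent-Δ lets both summands be
    -- reduced by the operator that starts the derivation for u.
    Recurrent-+ : ∀ {u v} → Recurrent u → Recurrent v → Recurrent (λ n → u n + v n)
    Recurrent-+ {u} {v} (vanishing u≋0) R =
      Recurrent-cong (λ n → trans (sym (+-identityˡ (v n))) (+-congʳ (sym (u≋0 n)))) R
    Recurrent-+ {u} {v} (step {κ = κ} u₀∈F κ∈F Δu) R =
      step (+-∈ u₀∈F (Recurrent⇒∈ R 0)) κ∈F
        (Recurrent-cong additive (Recurrent-+ Δu (Recurrent-Δ κ∈F R)))
      where
      additive : (λ n → Δ κ u n + Δ κ v n) ≋ Δ κ (λ n → u n + v n)
      additive n = solve 5 (λ κ a b c d →
          (a :+ κ :* b) :+ (c :+ κ :* d) := (a :+ c) :+ κ :* (b :+ d))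
        refl κ (u (suc n)) (u n) (v (suc n)) (v n)

    -- The substitution of ρ z for z, together with a constant factor.
    Recurrent-geometric : ∀ {u κ ρ} → F κ → F ρ → Recurrent u → Recurrent (λ n → κ * ρ ^ n * u n)
    Recurrent-geometric κ∈F ρ∈F (vanishing u≋0) = vanishing λ n → trans (*-congˡ (u≋0 n)) (zeroʳ _)
    Recurrent-geometric {u} {κ} {ρ} κ∈F ρ∈F (step {κ = ν} u₀∈F ν∈F Δu) =
      step (*-∈ (*-∈ κ∈F 1∈) u₀∈F) (*-∈ ν∈F ρ∈F)
        (Recurrent-cong eq (Recurrent-geometric (*-∈ κ∈F ρ∈F) ρ∈F Δu))
      where
      eq : (λ n → κ * ρ * ρ ^ n * Δ ν u n) ≋ Δ (ν * ρ) (λ n → κ * ρ ^ n * u n)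
      eq n = solve 6 (λ κ ρ ν x a b →
          κ :* ρ :* x :* (a :+ ν :* b) := κ :* (ρ :* x) :* a :+ ν :* ρ :* (κ :* x :* b))
        refl κ ρ ν (ρ ^ n) (u (suc n)) (u n)

    Recurrent-• : ∀ {u κ} → F κ → Recurrent u → Recurrent (κ • u)
    Recurrent-• {u} {κ} κ∈F R = Recurrent-cong
      (λ n → *-congʳ (trans (*-congˡ (1^ n)) (*-identityʳ κ)))
      (Recurrent-geometric κ∈F 1∈ R)
      where
      1^ : ∀ n → 1# ^ n ≈ 1#
      1^ zero    = refl
      1^ (suc n) = trans (*-identityˡ _) (1^ n)

    Recurrent-tail : ∀ {u} → Recurrent u → Recurrent (u ∘ suc)
    Recurrent-tail {u} R =
      Recurrent-cong (λ n → trans (+-congˡ (zeroˡ (u n))) (+-identityʳ _)) (Recurrent-Δ 0∈ R)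

    -- Polynomials

    infixl 6 _⊕_

    -- The sum of polynomials.
    _⊕_ : Polynomial → Polynomial → Polynomial
    []      ⊕ Q       = Q
    (x ∷ P) ⊕ []      = x ∷ P
    (x ∷ P) ⊕ (y ∷ Q) = x + y ∷ P ⊕ Q

    scale : Carrier → Polynomial → Polynomial
    scale κ = List.map (κ *_)

    toSeries-⊕ : ∀ P Q n → toSeries (P ⊕ Q) n ≈ toSeries P n + toSeries Q n
    toSeries-⊕ []      Q       n       = sym (+-identityˡ _)
    toSeries-⊕ (x ∷ P) []      n       = sym (+-identityʳ _)
    toSeries-⊕ (x ∷ P) (y ∷ Q) zero    = refl
    toSeries-⊕ (x ∷ P) (y ∷ Q) (suc n) = toSeries-⊕ P Q n

    toSeries-scale : ∀ κ P n → toSeries (scale κ P) n ≈ κ * toSeries P n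
    toSeries-scale κ []      n       = sym (zeroʳ κ)
    toSeries-scale κ (x ∷ P) zero    = refl
    toSeries-scale κ (x ∷ P) (suc n) = toSeries-scale κ P n

    All-⊕ : ∀ {P Q} → All F P → All F Q → All F (P ⊕ Q)
    All-⊕ []         Q∈F        = Q∈F
    All-⊕ (x∈F ∷ P∈F) []         = x∈F ∷ P∈F
    All-⊕ (x∈F ∷ P∈F) (y∈F ∷ Q∈F) = +-∈ x∈F y∈F ∷ All-⊕ P∈F Q∈F

    All-scale : ∀ {κ P} → F κ → All F P → All F (scale κ P)
    All-scale κ∈F []          = []
    All-scale κ∈F (x∈F ∷ P∈F) = *-∈ κ∈F x∈F ∷ All-scale κ∈F P∈F

    -- The coefficients of z Δ κ u + u₀ = (1 + κ z) u, multiplied by a series w.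
    ⊛-Δ : ∀ w κ u n → (w ⊛ Δ κ u) n + w (suc n) * u 0 ≈ (w ⊛ u) (suc n) + κ * (w ⊛ u) n
    ⊛-Δ w κ u zero = trans
      (+-congʳ (+-identityʳ _))
      (trans (solve 5 (λ κ a b x y → a :* (y :+ κ :* x) :+ b :* x := (a :* y :+ b :* x) :+ κ :* (a :* x))
        refl κ (w 0) (w 1) (u 0) (u 1))
      (+-cong (+-congˡ (sym (+-identityʳ _))) (*-congˡ (sym (+-identityʳ _)))))
    ⊛-Δ w κ u (suc n) = begin
      w 0 * Δ κ u (suc n) + (w ∘ suc ⊛ Δ κ u) n + w (suc (suc n)) * u 0
        ≈⟨ +-assoc _ _ _ ⟩
      w 0 * Δ κ u (suc n) + ((w ∘ suc ⊛ Δ κ u) n + w (suc (suc n)) * u 0)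
        ≈⟨ +-congˡ (⊛-Δ (w ∘ suc) κ u n) ⟩
      w 0 * Δ κ u (suc n) + ((w ∘ suc ⊛ u) (suc n) + κ * (w ∘ suc ⊛ u) n)
        ≈⟨ solve 6 (λ κ a x y s t → a :* (y :+ κ :* x) :+ (t :+ κ :* s) := (a :* y :+ t) :+ κ :* (a :* x :+ s))
             refl κ (w 0) (u (suc n)) (u (suc (suc n))) ((w ∘ suc ⊛ u) n) ((w ∘ suc ⊛ u) (suc n)) ⟩
      (w ⊛ u) (suc (suc n)) + κ * (w ⊛ u) (suc n) ∎

    ⊛-+ˡ : ∀ v w u n → ((λ m → v m + w m) ⊛ u) n ≈ (v ⊛ u) n + (w ⊛ u) n
    ⊛-+ˡ v w u n = trans
      (Sum.sum-cong-≋ {suc n} λ m → distribʳ (u (n ℕ.∸ toℕ m)) (v (toℕ m)) (w (toℕ m)))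
      (Sum.∑-distrib-+ {suc n} (λ m → v (toℕ m) * u (n ℕ.∸ toℕ m)) (λ m → w (toℕ m) * u (n ℕ.∸ toℕ m)))

    ⊛-•ˡ : ∀ κ w u n → ((κ • w) ⊛ u) n ≈ κ * (w ⊛ u) n
    ⊛-•ˡ κ w u n = trans
      (Sum.sum-cong-≋ {suc n} λ m → *-assoc κ (w (toℕ m)) (u (n ℕ.∸ toℕ m)))
      (sym (Sum.*-distribˡ-sum {suc n} κ (λ m → w (toℕ m) * u (n ℕ.∸ toℕ m))))

    ⊛-congˡ : ∀ {v w} u → v ≋ w → v ⊛ u ≋ w ⊛ u
    ⊛-congˡ u v≋w n = Sum.sum-cong-≋ {suc n} λ m → *-congʳ {u (n ℕ.∸ toℕ m)} (v≋w (toℕ m))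

    ⊛-congʳ : ∀ {u v} w → u ≋ v → w ⊛ u ≋ w ⊛ v
    ⊛-congʳ w u≋v n = Sum.sum-cong-≋ {suc n} λ m → *-congˡ {w (toℕ m)} (u≋v (n ℕ.∸ toℕ m))

    -- If Δ κ u = P / Q, then u = (u₀ Q + z P) / ((1 + κ z) Q).
    Recurrent⇒rational : ∀ {u} → Recurrent u → IsRationalOver F u
    Recurrent⇒rational {u} (vanishing u≋0) = [] , 1# ∷ [] , [] , 1∈ ∷ [] , record
      { regular   = 1#0
      ; expansion = λ n → trans (⊛-congʳ (toSeries (1# ∷ [])) u≋0 n)
          (trans (Sum.sum-cong-≋ {suc n} λ m → zeroʳ (toSeries (1# ∷ []) (toℕ m))) (Sum.sum-replicate-zero (suc n)))
      }
    Recurrent⇒rational {u} (step {κ = κ} u₀∈F κ∈F Δu)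
      with P , Q , P∈F , Q∈F , Δu≈P/Q ← Recurrent⇒rational Δu =
        P′ , Q′ , All-⊕ (All-scale u₀∈F Q∈F) (0∈ ∷ P∈F) , All-⊕ Q∈F (0∈ ∷ All-scale κ∈F Q∈F) , record
      { regular   = #-congʳ (sym Q′₀) regular
      ; expansion = expands
      }
      where
      open _IsExpansionOf_÷_ Δu≈P/Q
      P′ Q′ : Polynomial
      P′ = scale (u 0) Q ⊕ (0# ∷ P)
      Q′ = Q ⊕ (0# ∷ scale κ Q)
      q : Series
      q = toSeries Q
      Q′₀ : toSeries Q′ 0 ≈ q 0
      Q′₀ = trans (toSeries-⊕ Q _ 0) (+-identityʳ _)
      Q′ₙ₊₁ : ∀ n → toSeries Q′ (suc n) ≈ q (suc n) + κ * q n
      Q′ₙ₊₁ n = trans (toSeries-⊕ Q _ (suc n)) (+-congˡ (toSeries-scale κ Q n))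
      expands : toSeries Q′ ⊛ u ≋ toSeries P′
      expands zero = begin
        toSeries Q′ 0 * u 0 + 0#             ≈⟨ +-congʳ (trans (*-congʳ Q′₀) (*-comm _ _)) ⟩
        u 0 * q 0 + 0#                       ≈⟨ +-congʳ (toSeries-scale (u 0) Q 0) ⟨
        toSeries (scale (u 0) Q) 0 + 0#      ≈⟨ toSeries-⊕ (scale (u 0) Q) (0# ∷ P) 0 ⟨
        toSeries P′ 0                        ∎
      expands (suc n) = begin
        toSeries Q′ 0 * u (suc n) + (toSeries Q′ ∘ suc ⊛ u) n
          ≈⟨ +-cong (*-congʳ Q′₀) (trans (⊛-congˡ u Q′ₙ₊₁ n)
               (trans (⊛-+ˡ (q ∘ suc) (κ • q) u n) (+-congˡ (⊛-•ˡ κ q u n)))) ⟩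
        q 0 * u (suc n) + ((q ∘ suc ⊛ u) n + κ * (q ⊛ u) n)
          ≈⟨ +-assoc _ _ _ ⟨
        (q ⊛ u) (suc n) + κ * (q ⊛ u) n
          ≈⟨ ⊛-Δ q κ u n ⟨
        (q ⊛ Δ κ u) n + q (suc n) * u 0
          ≈⟨ +-comm _ _ ⟩
        q (suc n) * u 0 + (q ⊛ Δ κ u) n
          ≈⟨ +-cong (trans (*-comm _ _) (sym (toSeries-scale (u 0) Q (suc n)))) (expansion n) ⟩
        toSeries (scale (u 0) Q) (suc n) + toSeries P n
          ≈⟨ toSeries-⊕ (scale (u 0) Q) (0# ∷ P) (suc n) ⟨
        toSeries P′ (suc n) ∎

  -- Moments of partial fractions

  -- The moments ∑ᵢ wᵢ xᵢᵉ of the weights w at the nodes x.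
  moment : ∀ {N} → (Fin N → Carrier) → (Fin N → Carrier) → Series
  moment w x e = sum λ i → w i * x i ^ e

  -- μ starts with 0, …, 0, 1, where 1 has the index D.
  record HasOrder (D : ℕ) (μ : Series) : Set ℓ₁ where
    field
      vanishes : ∀ {e} → e < D → μ e ≈ 0#
      leading  : μ D ≈ 1#

  open HasOrder public

  HasOrder-cong : ∀ {D μ ν} → μ ≋ ν → HasOrder D μ → HasOrder D ν
  HasOrder-cong μ≋ν o = record
    { vanishes = λ e<D → trans (sym (μ≋ν _)) (vanishes o e<D)
    ; leading  = trans (sym (μ≋ν _)) (leading o)
    }

  y-x+x≈y : ∀ x y → (y + - x) + x ≈ y
  y-x+x≈y x y = trans (+-assoc y (- x) x) (trans (+-congˡ (-‿inverseˡ x)) (+-identityʳ y))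

  unit-cancelˡ : ∀ {u x y z} → u * x ≈ 1# → x * y ≈ x * z → y ≈ z
  unit-cancelˡ {u} {x} {y} {z} ux≈1 xy≈xz = begin
    y            ≈⟨ *-identityˡ y ⟨
    1# * y       ≈⟨ *-congʳ ux≈1 ⟨
    u * x * y    ≈⟨ *-assoc u x y ⟩
    u * (x * y)  ≈⟨ *-congˡ xy≈xz ⟩
    u * (x * z)  ≈⟨ *-assoc u x z ⟨
    u * x * z    ≈⟨ *-congʳ ux≈1 ⟩
    1# * z       ≈⟨ *-identityˡ z ⟩
    z            ∎

  #0-cancelˡ : ∀ {x y z} → x # 0# → x * y ≈ x * z → y ≈ z
  #0-cancelˡ x#0 = unit-cancelˡ (⁻¹-inverseˡ x#0)

  -- The weights w are the coefficients of the partial fraction decomposition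
  -- of 1 / ∏ᵢ (X - xᵢ). In the matrix d of differences of the nodes, the
  -- diagonal is replaced with 1 in order to have products over all indices.
  record IsPartialFraction {N} (x w : Fin N → Carrier) (d : Fin N → Fin N → Carrier) : Set ℓ₁ where
    field
      diagonal   : ∀ i → d i i ≈ 1#
      difference : ∀ {i j} → i ≢ j → d i j ≈ x i - x j
      weight     : ∀ i → w i * product (d i) ≈ 1#

  open IsPartialFraction public

  -- The weights after deletion of the node k.
  reweigh : ∀ {N} (x w : Fin (suc N) → Carrier) → Fin (suc N) → Fin N → Carrier
  reweigh x w k i = w (punchIn k i) * (x (punchIn k i) - x k)

  delete-node : ∀ {N} {x w : Fin (suc N) → Carrier} {d} k → IsPartialFraction x w d →
    IsPartialFraction (x ∘ punchIn k) (reweigh x w k) (λ i j → d (punchIn k i) (punchIn k j))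
  delete-node {N} {x} {w} {d} k pf = record
    { diagonal   = diagonal pf ∘ punchIn k
    ; difference = λ i≢j → difference pf (i≢j ∘ Fin.punchIn-injective k _ _)
    ; weight     = λ i → begin
        w (punchIn k i) * (x (punchIn k i) - x k) * product (λ j → d (punchIn k i) (punchIn k j))
          ≈⟨ *-assoc _ _ _ ⟩
        w (punchIn k i) * ((x (punchIn k i) - x k) * product (λ j → d (punchIn k i) (punchIn k j)))
          ≈⟨ *-congˡ (*-congʳ (difference pf (Fin.punchInᵢ≢i k i))) ⟨
        w (punchIn k i) * (d (punchIn k i) k * product (λ j → d (punchIn k i) (punchIn k j)))
          ≈⟨ *-congˡ (Product.sum-remove {N} {k} (d (punchIn k i))) ⟨
        w (punchIn k i) * product (d (punchIn k i))
          ≈⟨ weight pf (punchIn k i) ⟩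
        1# ∎
    }

  -- The factor x - c of the weights acts on moments as the operator Δ (- c).
  moment-Δ : ∀ {N} (w x : Fin N → Carrier) c → moment (λ i → w i * (x i - c)) x ≋ Δ (- c) (moment w x)
  moment-Δ {N} w x c e = begin
    sum (λ i → w i * (x i - c) * x i ^ e)
      ≈⟨ Sum.sum-cong-≋ {N} (λ i → solve 4 (λ w x c y → w :* (x :+ c) :* y := w :* (x :* y) :+ c :* (w :* y))
           refl (w i) (x i) (- c) (x i ^ e)) ⟩
    sum (λ i → w i * x i ^ suc e + - c * (w i * x i ^ e))
      ≈⟨ Sum.∑-distrib-+ {N} (λ i → w i * x i ^ suc e) (λ i → - c * (w i * x i ^ e)) ⟩
    moment w x (suc e) + sum (λ i → - c * (w i * x i ^ e))
      ≈⟨ +-congˡ (Sum.*-distribˡ-sum {N} (- c) (λ i → w i * x i ^ e)) ⟨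
    moment w x (suc e) + - c * moment w x e ∎

  -- The weight w k (x k - x k) of the node k is 0.
  moment-delete : ∀ {N} (w x : Fin (suc N) → Carrier) k e →
    moment w x (suc e) ≈ moment (reweigh x w k) (x ∘ punchIn k) e + x k * moment w x e
  moment-delete {N} w x k e = begin
    E (suc e)                                           ≈⟨ y-x+x≈y (x k * E e) (E (suc e)) ⟨
    E (suc e) - x k * E e + x k * E e                   ≈⟨ +-congʳ (+-congˡ (-‿distribˡ-* (x k) (E e))) ⟩
    Δ (- x k) E e + x k * E e                           ≈⟨ +-congʳ (moment-Δ w x (x k) e) ⟨
    moment (λ i → w i * (x i - x k)) x e + x k * E e    ≈⟨ +-congʳ (Sum.sum-remove {N} {k} (λ i → w i * (x i - x k) * x i ^ e)) ⟩
    w k * (x k - x k) * x k ^ e + E′ e + x k * E e      ≈⟨ +-congʳ (+-congʳ (*-congʳ (*-congˡ (-‿inverseʳ (x k))))) ⟩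
    w k * 0# * x k ^ e + E′ e + x k * E e               ≈⟨ +-congʳ (+-congʳ (trans (*-congʳ (zeroʳ (w k))) (zeroˡ _))) ⟩
    0# + E′ e + x k * E e                               ≈⟨ +-congʳ (+-identityˡ (E′ e)) ⟩
    E′ e + x k * E e                                    ∎
    where
    E E′ : Series
    E = moment w x
    E′ = moment (reweigh x w k) (x ∘ punchIn k)

  -- Lagrange interpolation: among N + 1 nodes, ∑ᵢ wᵢ xᵢᵉ is 0 for e < N and 1
  -- for e = N.
  partialFraction-order : ∀ N {x w : Fin (suc N) → Carrier} {d} →
    IsPartialFraction x w d → HasOrder N (moment w x)
  partialFraction-order zero {x} {w} {d} pf = record
    { vanishes = λ ()
    ; leading  = begin
        w Fin.zero * 1# + 0#                      ≈⟨ +-identityʳ _ ⟩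
        w Fin.zero * 1#                           ≈⟨ *-congˡ (trans (*-identityʳ _) (diagonal pf Fin.zero)) ⟨
        w Fin.zero * (d Fin.zero Fin.zero * 1#)   ≈⟨ weight pf Fin.zero ⟩
        1#                                        ∎
    }
  partialFraction-order (suc N) {x} {w} {d} pf = record
    { vanishes = vanish
    ; leading  = trans (moment-delete w x Fin.zero N)
        (trans (+-cong (leading E₀-order) (trans (*-congˡ (vanish (ℕ.n<1+n N))) (zeroʳ _))) (+-identityʳ 1#))
    }
    where
    one : Fin (suc (suc N))
    one = Fin.suc Fin.zero
    x₀ x₁ : Carrier
    x₀ = x Fin.zero
    x₁ = x one
    E E₀ E₁ : Series
    E  = moment w x
    E₀ = moment (reweigh x w Fin.zero) (x ∘ punchIn Fin.zero)
    E₁ = moment (reweigh x w one) (x ∘ punchIn one)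
    E₀-order : HasOrder N E₀
    E₀-order = partialFraction-order N (delete-node Fin.zero pf)
    E₁-order : HasOrder N E₁
    E₁-order = partialFraction-order N (delete-node one pf)
    -- Both orders are N, so the moments agree up to the index N.
    agree : ∀ {e} → e < suc N → E₀ e ≈ E₁ e
    agree (s≤s e≤N) with ℕ.m≤n⇒m<n∨m≡n e≤N
    ... | inj₁ e<N    = trans (vanishes E₀-order e<N) (sym (vanishes E₁-order e<N))
    ... | inj₂ ≡.refl = trans (leading E₀-order) (sym (leading E₁-order))
    x₀-x₁#0 : x₀ - x₁ # 0#
    x₀-x₁#0 = unit⇒#0 (w Fin.zero * (d Fin.zero Fin.zero * rest)) (begin
      w Fin.zero * (d Fin.zero Fin.zero * rest) * (x₀ - x₁)
        ≈⟨ *-congˡ (difference pf λ ()) ⟨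
      w Fin.zero * (d Fin.zero Fin.zero * rest) * d Fin.zero one
        ≈⟨ solve 4 (λ w a r b → w :* (a :* r) :* b := w :* (a :* (b :* r))) refl
             (w Fin.zero) (d Fin.zero Fin.zero) rest (d Fin.zero one) ⟩
      w Fin.zero * product (d Fin.zero)
        ≈⟨ weight pf Fin.zero ⟩
      1# ∎)
      where
      rest : Carrier
      rest = product (λ j → d Fin.zero (Fin.suc (Fin.suc j)))
    -- Deletion of two different nodes gives (x₀ - x₁) E(e) = E₁(e) - E₀(e).
    vanish : ∀ {e} → e < suc N → E e ≈ 0#
    vanish {e} e<1+N = #0-cancelˡ x₀-x₁#0 (trans (begin
      (x₀ - x₁) * E e              ≈⟨ distribʳ (E e) x₀ (- x₁) ⟩
      x₀ * E e + - x₁ * E e        ≈⟨ +-cong x₀E≈x₁E (sym (-‿distribˡ-* x₁ (E e))) ⟩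
      x₁ * E e + - (x₁ * E e)      ≈⟨ -‿inverseʳ _ ⟩
      0#                           ∎) (sym (zeroʳ _)))
      where
      x₀E≈x₁E : x₀ * E e ≈ x₁ * E e
      x₀E≈x₁E = +-cancelˡ (E₀ e) _ _ (begin
        E₀ e + x₀ * E e   ≈⟨ moment-delete w x Fin.zero e ⟨
        E (suc e)         ≈⟨ moment-delete w x one e ⟩
        E₁ e + x₁ * E e   ≈⟨ +-congʳ (agree e<1+N) ⟨
        E₀ e + x₁ * E e   ∎)

  -- The moments after multiplication of the weights by ∏ⱼ (x - cⱼ).
  factors : ∀ {J} → (Fin J → Carrier) → Series → Series
  factors {zero}  c μ = μ
  factors {suc J} c μ = factors (c ∘ Fin.suc) (Δ (- c Fin.zero) μ)

  factors-cong : ∀ {J} (c : Fin J → Carrier) {μ ν} → μ ≋ ν → factors c μ ≋ factors c ν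
  factors-cong {zero}  c μ≋ν = μ≋ν
  factors-cong {suc J} c μ≋ν = factors-cong (c ∘ Fin.suc) (Δ-cong (- c Fin.zero) μ≋ν)

  moment-congˡ : ∀ {N} {v w : Fin N → Carrier} x → (∀ i → v i ≈ w i) → moment v x ≋ moment w x
  moment-congˡ {N} x v≈w e = Sum.sum-cong-≋ {N} λ i → *-congʳ (v≈w i)

  moment-factors : ∀ {J N} (c : Fin J → Carrier) (w x : Fin N → Carrier) →
    moment (λ i → w i * product (λ j → x i - c j)) x ≋ factors c (moment w x)
  moment-factors {zero}  c w x = moment-congˡ x λ i → *-identityʳ (w i)
  moment-factors {suc J} c w x e = begin
    moment (λ i → w i * product (λ j → x i - c j)) x e
      ≈⟨ moment-congˡ x (λ i → sym (*-assoc (w i) (x i - c Fin.zero) _)) e ⟩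
    moment (λ i → w i * (x i - c Fin.zero) * product (λ j → x i - c (Fin.suc j))) x e
      ≈⟨ moment-factors (c ∘ Fin.suc) (λ i → w i * (x i - c Fin.zero)) x e ⟩
    factors (c ∘ Fin.suc) (moment (λ i → w i * (x i - c Fin.zero)) x) e
      ≈⟨ factors-cong (c ∘ Fin.suc) (moment-Δ w x (c Fin.zero)) e ⟩
    factors c (moment w x) e ∎

  x+k*0≈x : ∀ {x y} k → y ≈ 0# → x + k * y ≈ x
  x+k*0≈x k y≈0 = trans (+-congˡ (trans (*-congˡ y≈0) (zeroʳ k))) (+-identityʳ _)

  factors-order : ∀ {J D μ} (c : Fin J → Carrier) → HasOrder (J ℕ.+ D) μ → HasOrder D (factors c μ)
  factors-order {zero}          c o = o
  factors-order {suc J} {D} {μ} c o = factors-order (c ∘ Fin.suc) record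
    { vanishes = λ e<J+D → trans (x+k*0≈x _ (vanishes o (ℕ.m<n⇒m<1+n e<J+D))) (vanishes o (s≤s e<J+D))
    ; leading  = trans (x+k*0≈x _ (vanishes o (ℕ.n<1+n _))) (leading o)
    }

  -- If μ vanishes at 1, …, J, then only the leading term x to the power J + 1 and
  -- the constant term ∏ⱼ (- cⱼ) of ∏ⱼ (x - cⱼ) contribute to the result at 0.
  factors-at-0 : ∀ {J μ} (c : Fin (suc J) → Carrier) → (∀ e → e < J → μ (suc e) ≈ 0#) →
    factors c μ 0 ≈ μ (suc J) + product (λ j → - c j) * μ 0
  factors-at-0 {zero}      c μ≈0 = +-congˡ (*-congʳ (sym (*-identityʳ _)))
  factors-at-0 {suc J} {μ} c μ≈0 = begin
    factors (c ∘ Fin.suc) (Δ c₀ μ) 0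
      ≈⟨ factors-at-0 (c ∘ Fin.suc) (λ e e<J →
           trans (x+k*0≈x c₀ (μ≈0 e (ℕ.m<n⇒m<1+n e<J))) (μ≈0 (suc e) (s≤s e<J))) ⟩
    Δ c₀ μ (suc J) + ∏ * (μ 1 + c₀ * μ 0)
      ≈⟨ +-cong (x+k*0≈x c₀ (μ≈0 J (ℕ.n<1+n J)))
           (*-congˡ (trans (+-congʳ (μ≈0 0 (s≤s z≤n))) (+-identityˡ _))) ⟩
    μ (suc (suc J)) + ∏ * (c₀ * μ 0)
      ≈⟨ +-congˡ (solve 3 (λ p c m → p :* (c :* m) := c :* p :* m) refl ∏ c₀ (μ 0)) ⟩
    μ (suc (suc J)) + c₀ * ∏ * μ 0 ∎
    where
    c₀ ∏ : Carrier
    c₀ = - c Fin.zero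
    ∏ = product (λ j → - c (Fin.suc j))

  module RationalMoments {p} (S : Carrier → Set p) where

    open Rationality S

    -- The J factors x - cⱼ ρⁿ turn μ(D) into μ(J + D) plus a combination of lower
    -- moments, whose coefficients are polynomials in ρⁿ.
    factors-leading : ∀ {J D ρ} {μ : ℕ → Series} (c : Fin J → Carrier) → F ρ → (∀ j → F (c j)) →
      (∀ e → e < J ℕ.+ D → Recurrent (λ n → μ n e)) →
      Recurrent (λ n → factors (λ j → c j * ρ ^ n) (μ n) D - μ n (J ℕ.+ D))
    factors-leading {zero} c ρ∈F c∈F μ∈R = vanishing λ n → -‿inverseʳ _
    factors-leading {suc J} {D} {ρ} {μ} c ρ∈F c∈F μ∈R = Recurrent-cong eq
      (Recurrent-+ (factors-leading (c ∘ Fin.suc) ρ∈F (c∈F ∘ Fin.suc) λ e e<J+D →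
          Recurrent-+ (μ∈R (suc e) (s≤s e<J+D)) (c₀μ∈R e (ℕ.m<n⇒m<1+n e<J+D)))
        (c₀μ∈R (J ℕ.+ D) (ℕ.n<1+n _)))
      where
      c₀ : ℕ → Carrier
      c₀ n = - (c Fin.zero * ρ ^ n)
      c₀μ∈R : ∀ e → e < suc (J ℕ.+ D) → Recurrent (λ n → c₀ n * μ n e)
      c₀μ∈R e e< = Recurrent-cong (λ n → *-congʳ (sym (-‿distribˡ-* (c Fin.zero) (ρ ^ n))))
        (Recurrent-geometric (neg-∈ (c∈F Fin.zero)) ρ∈F (μ∈R e e<))
      eq : (λ n → factors (λ j → c (Fin.suc j) * ρ ^ n) (Δ (c₀ n) (μ n)) D
                    - Δ (c₀ n) (μ n) (J ℕ.+ D) + c₀ n * μ n (J ℕ.+ D))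
         ≋ (λ n → factors (λ j → c j * ρ ^ n) (μ n) D - μ n (suc (J ℕ.+ D)))
      eq n = begin
        f - (m + k) + k       ≈⟨ +-congʳ (+-congˡ (-‿+-comm m k)) ⟨
        f + (- m - k) + k     ≈⟨ +-congʳ (+-assoc f (- m) (- k)) ⟨
        f - m - k + k         ≈⟨ y-x+x≈y k (f - m) ⟩
        f - m                 ∎
        where
        f m k : Carrier
        f = factors (λ j → c j * ρ ^ n) (μ n) D
        m = μ n (suc (J ℕ.+ D))
        k = c₀ n * μ n (J ℕ.+ D)

  -- Finite products

  -- g(0) ⋯ g(n - 1).
  prod : (ℕ → Carrier) → ℕ → Carrier
  prod g zero    = 1#
  prod g (suc n) = prod g n * g n

  prod-cong : ∀ {g h} → (∀ t → g t ≈ h t) → ∀ n → prod g n ≈ prod h n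
  prod-cong g≈h zero    = refl
  prod-cong g≈h (suc n) = *-cong (prod-cong g≈h n) (g≈h n)

  prod-+ : ∀ g m n → prod g (m ℕ.+ n) ≈ prod g m * prod (λ t → g (m ℕ.+ t)) n
  prod-+ g m zero    = trans (reflexive (≡.cong (prod g) (ℕ.+-identityʳ m))) (sym (*-identityʳ _))
  prod-+ g m (suc n) = begin
    prod g (m ℕ.+ suc n)                                    ≡⟨ ≡.cong (prod g) (ℕ.+-suc m n) ⟩
    prod g (m ℕ.+ n) * g (m ℕ.+ n)                          ≈⟨ *-congʳ (prod-+ g m n) ⟩
    prod g m * prod (λ t → g (m ℕ.+ t)) n * g (m ℕ.+ n)     ≈⟨ *-assoc _ _ _ ⟩
    prod g m * prod (λ t → g (m ℕ.+ t)) (suc n)             ∎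

  prod-head : ∀ g n → prod g (suc n) ≈ g 0 * prod (g ∘ suc) n
  prod-head g zero    = *-comm _ _
  prod-head g (suc n) = trans (*-congʳ (prod-head g n)) (*-assoc _ _ _)

  prod-scale : ∀ κ g n → prod (λ t → κ * g t) n ≈ κ ^ n * prod g n
  prod-scale κ g zero    = sym (*-identityˡ 1#)
  prod-scale κ g (suc n) = trans (*-congʳ (prod-scale κ g n))
    (solve* 4 (λ κ x p g → x ⊗ p ⊗ (κ ⊗ g) ⊜ κ ⊗ x ⊗ (p ⊗ g)) refl κ (κ ^ n) (prod g n) (g n))

  prod-reverse : ∀ g n → product {n} (λ t → g (n ℕ.∸ suc (toℕ t))) ≈ prod g n
  prod-reverse g zero    = refl
  prod-reverse g (suc n) = trans (*-congˡ (prod-reverse g n)) (*-comm _ _)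

  -- The product of g(n), …, g(0) with the factor g(s), s = n - m, replaced by y.
  prod-punctured : ∀ g y n (m : Fin (suc n)) (let s = n ℕ.∸ toℕ m) →
    product {suc n} (λ t → if does (m Fin.≟ t) then y else g (n ℕ.∸ toℕ t))
      ≈ y * (prod g s * prod (λ t → g (suc (s ℕ.+ t))) (toℕ m))
  prod-punctured g y n       Fin.zero    = *-congˡ (trans (prod-reverse g n) (sym (*-identityʳ _)))
  prod-punctured g y (suc n) (Fin.suc m) = begin
    g (suc n) * product {suc n} (λ t → if does (m Fin.≟ t) then y else g (n ℕ.∸ toℕ t))
      ≈⟨ *-congˡ (prod-punctured g y n m) ⟩
    g (suc n) * (y * (low * high))
      ≈⟨ solve* 4 (λ x y l h → x ⊗ (y ⊗ (l ⊗ h)) ⊜ y ⊗ (l ⊗ (h ⊗ x))) refl (g (suc n)) y low high ⟩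
    y * (low * (high * g (suc n)))
      ≡⟨ ≡.cong (λ k → y * (low * (high * g (suc k)))) (ℕ.m∸n+n≡m (ℕ.≤-pred (Fin.toℕ<n m))) ⟨
    y * (low * (high * g (suc (n ℕ.∸ toℕ m ℕ.+ toℕ m)))) ∎
    where
    low high : Carrier
    low  = prod g (n ℕ.∸ toℕ m)
    high = prod (λ t → g (suc (n ℕ.∸ toℕ m ℕ.+ t))) (toℕ m)

  product-cong : ∀ {n} {x y : Fin n → Carrier} → (∀ j → x j ≈ y j) → product x ≈ product y
  product-cong {n} = Product.sum-cong-≋ {n}

  product-* : ∀ {n} (x y : Fin n → Carrier) → product (λ j → x j * y j) ≈ product x * product y
  product-* {n} = Product.∑-distrib-+ {n}

  product-const : ∀ n x → product {n} (λ _ → x) ≈ x ^ n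
  product-const zero    x = refl
  product-const (suc n) x = *-congˡ (product-const n x)

  1^n≈1 : ∀ n → 1# ^ n ≈ 1#
  1^n≈1 zero    = refl
  1^n≈1 (suc n) = trans (*-identityˡ _) (1^n≈1 n)

  product-^ : ∀ {n} (x : Fin n → Carrier) k → product (λ j → x j ^ k) ≈ product x ^ k
  product-^ {zero}  x k = sym (1^n≈1 k)
  product-^ {suc n} x k = trans (*-congˡ (product-^ (x ∘ Fin.suc) k)) (sym (^-distrib-* _ _ k))

  product-neg : ∀ {n} (x : Fin n → Carrier) → product (λ j → - x j) ≈ product x * (- 1#) ^ n
  product-neg {n} x = trans (product-cong λ j → trans (sym (-1*x≈-x (x j))) (*-comm _ _))
    (trans (product-* x (λ _ → - 1#)) (*-congˡ (product-const n (- 1#))))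

  ^-swap : ∀ x m n → (x ^ m) ^ n ≈ (x ^ n) ^ m
  ^-swap x m n = trans (^-assocʳ x m n) (trans (^-congʳ x (ℕ.*-comm m n)) (sym (^-assocʳ x n m)))

  -1²≈1 : - 1# * - 1# ≈ 1#
  -1²≈1 = trans (-1*x≈-x (- 1#)) (-‿involutive 1#)

  -1#0 : - 1# # 0#
  -1#0 = unit⇒#0 (- 1#) -1²≈1

  factor#0 : ∀ {x y} → x * y # 0# → y # 0#
  factor#0 {x} {y} xy#0 = unit⇒#0 _ (trans (*-assoc _ x y) (⁻¹-inverseˡ xy#0))

  product-zero : ∀ {n} (x : Fin n → Carrier) i → x i ≈ 0# → product x ≈ 0#
  product-zero {suc n} x i xᵢ≈0 = trans (Product.sum-remove {n} {i} x) (trans (*-congʳ xᵢ≈0) (zeroˡ _))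

  factors-congᶜ : ∀ {J} {c d : Fin J → Carrier} μ → (∀ j → c j ≈ d j) → factors c μ ≋ factors d μ
  factors-congᶜ {zero}          μ c≈d e = refl
  factors-congᶜ {suc J} {c} {d} μ c≈d e = trans
    (factors-cong (c ∘ Fin.suc) (λ n → +-congˡ (*-congʳ (-‿cong (c≈d Fin.zero)))) e)
    (factors-congᶜ (Δ (- d Fin.zero) μ) (c≈d ∘ Fin.suc) e)

  -- The coefficients of the solutions

  module Solutions
    (r-2 : ℕ)
    (q : Carrier) (q#0 : q # 0#) (1#q^ : ∀ n → 1# # q ^ suc n)
    (a b : Fin (suc (suc r-2)) → Carrier) (a#0 : ∀ i → a i # 0#) (b#0 : ∀ i → b i # 0#)
    (b/b#q^ : ∀ i j → i ≢ j → ∀ n → b i / b j [ b#0 j ] # q ^ n [ q#0 ])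
    (bᵣ≈q : b (fromℕ (suc r-2)) ≈ q)
    where

    open Hypergeometric r-2 q q#0 1#q^ a b a#0 b#0 b/b#q^
    open Denominators

    r-1 r : ℕ
    r-1 = suc r-2
    r   = suc r-1

    -- The pole bᵢ qˢ of Ωₙ; s is called its level.
    node : Fin r → ℕ → Carrier
    node i s = b i * q ^ s

    node#0 : ∀ i s → node i s # 0#
    node#0 i s = x#0y#0→xy#0 (b#0 i) (^#0 q#0 s)

    -- Pochhammer symbols as products of differences

    -- The factors 1 - q c qᵗ / bᵢ, multiplied by the node.
    pochhammer-rising : ∀ i c s m → pochhammer (q * c / b i [ b#0 i ]) m * node i s ^ m
                          ≈ prod (λ t → node i s - c * q ^ suc (s ℕ.+ t)) m
    pochhammer-rising i c s zero    = *-identityˡ 1#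
    pochhammer-rising i c s (suc m) = begin
      P * (1# - x * q ^ m) * (X * X ^ m)
        ≈⟨ solve* 4 (λ p y x z → p ⊗ y ⊗ (x ⊗ z) ⊜ p ⊗ z ⊗ (y ⊗ x)) refl P (1# - x * q ^ m) X (X ^ m) ⟩
      P * X ^ m * ((1# - x * q ^ m) * X)
        ≈⟨ *-cong (pochhammer-rising i c s m) eq ⟩
      prod (λ t → X - c * q ^ suc (s ℕ.+ t)) m * (X - c * q ^ suc (s ℕ.+ m)) ∎
      where
      X x P : Carrier
      X = node i s
      x = q * c / b i [ b#0 i ]
      P = pochhammer x m
      eq : (1# - x * q ^ m) * X ≈ X - c * q ^ suc (s ℕ.+ m)
      eq = begin
        (1# - x * q ^ m) * X                    ≈⟨ distribʳ X 1# _ ⟩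
        1# * X + - (x * q ^ m) * X              ≈⟨ +-cong (*-identityˡ X) (sym (-‿distribˡ-* _ X)) ⟩
        X - x * q ^ m * X                       ≈⟨ +-congˡ (-‿cong (begin
          q * c * b i ⁻¹[ b#0 i ] * q ^ m * (b i * q ^ s)
            ≈⟨ solve* 6 (λ q c u x b y → q ⊗ c ⊗ u ⊗ x ⊗ (b ⊗ y) ⊜ b ⊗ u ⊗ (c ⊗ (q ⊗ (y ⊗ x)))) refl
                 q c (b i ⁻¹[ b#0 i ]) (q ^ m) (b i) (q ^ s) ⟩
          b i * b i ⁻¹[ b#0 i ] * (c * (q * (q ^ s * q ^ m)))
            ≈⟨ trans (*-congʳ (⁻¹-inverseʳ (b#0 i))) (*-identityˡ _) ⟩
          c * (q * (q ^ s * q ^ m))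
            ≈⟨ *-congˡ (*-congˡ (^-homo-* q s m)) ⟨
          c * q ^ suc (s ℕ.+ m) ∎)) ⟩
        X - c * q ^ suc (s ℕ.+ m) ∎

    -- q to the power 0 + 1 + … + (s - 1).
    triangular : ℕ → Carrier
    triangular zero    = 1#
    triangular (suc s) = triangular s * q ^ s

    -- With z = q bᵢ / c, the factor bᵢ qˢ - c qᵗ is - c qᵗ (1 - z q^(s - 1 - t)), so that
    -- the order of the factors is reversed.
    pochhammer-falling : ∀ i c z → z * c ≈ q * b i → ∀ s →
      prod (λ t → node i s - c * q ^ t) s ≈ pochhammer z s * ((- c) ^ s * triangular s)
    pochhammer-falling i c z zc≈qb zero    = sym (trans (*-identityˡ _) (*-identityˡ 1#))
    pochhammer-falling i c z zc≈qb (suc s) = begin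
      prod (λ t → node i (suc s) - c * q ^ t) (suc s)
        ≈⟨ prod-head (λ t → node i (suc s) - c * q ^ t) s ⟩
      (node i (suc s) - c * 1#) * prod (λ t → node i (suc s) - c * (q * q ^ t)) s
        ≈⟨ *-cong first (trans (prod-cong scaled s) (prod-scale q _ s)) ⟩
      - c * (1# - z * q ^ s) * (q ^ s * prod (λ t → node i s - c * q ^ t) s)
        ≈⟨ *-congˡ (*-congˡ (pochhammer-falling i c z zc≈qb s)) ⟩
      - c * (1# - z * q ^ s) * (q ^ s * (pochhammer z s * ((- c) ^ s * triangular s)))
        ≈⟨ solve* 6 (λ c y x p d t → c ⊗ y ⊗ (x ⊗ (p ⊗ (d ⊗ t))) ⊜ p ⊗ y ⊗ (c ⊗ d ⊗ (t ⊗ x))) refl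
             (- c) (1# - z * q ^ s) (q ^ s) (pochhammer z s) ((- c) ^ s) (triangular s) ⟩
      pochhammer z (suc s) * ((- c) ^ suc s * triangular (suc s)) ∎
      where
      first : node i (suc s) - c * 1# ≈ - c * (1# - z * q ^ s)
      first = begin
        b i * (q * q ^ s) - c * 1#
          ≈⟨ +-cong (trans (solve* 3 (λ b q x → b ⊗ (q ⊗ x) ⊜ q ⊗ b ⊗ x) refl (b i) q (q ^ s))
               (*-congʳ (sym zc≈qb))) (-‿distribˡ-* c 1#) ⟩
        z * c * q ^ s + - c * 1#
          ≈⟨ +-comm _ _ ⟩
        - c * 1# + z * c * q ^ s
          ≈⟨ +-congˡ (solve* 3 (λ z c x → z ⊗ c ⊗ x ⊜ c ⊗ (z ⊗ x)) refl z c (q ^ s)) ⟩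
        - c * 1# + c * (z * q ^ s)
          ≈⟨ +-congˡ (trans (*-congʳ (sym (-‿involutive c))) (trans (sym (-‿distribˡ-* (- c) _)) (-‿distribʳ-* (- c) _))) ⟩
        - c * 1# + - c * - (z * q ^ s)
          ≈⟨ distribˡ (- c) 1# _ ⟨
        - c * (1# - z * q ^ s) ∎
      scaled : ∀ t → node i (suc s) - c * (q * q ^ t) ≈ q * (node i s - c * q ^ t)
      scaled t = begin
        b i * (q * q ^ s) - c * (q * q ^ t)
          ≈⟨ +-cong (solve* 3 (λ b q x → b ⊗ (q ⊗ x) ⊜ q ⊗ (b ⊗ x)) refl (b i) q (q ^ s))
               (-‿cong (solve* 3 (λ b q x → b ⊗ (q ⊗ x) ⊜ q ⊗ (b ⊗ x)) refl c q (q ^ t))) ⟩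
        q * node i s - q * (c * q ^ t)
          ≈⟨ +-congˡ (-‿distribʳ-* q _) ⟩
        q * node i s + q * - (c * q ^ t)
          ≈⟨ distribˡ q _ _ ⟨
        q * (node i s - c * q ^ t) ∎

    -- Coefficients as residues

    -- The differences of the node bᵢ qˢ and the nodes of index j on its own level
    -- (with 1 in place of the difference with itself), on the s levels below and
    -- on the m levels above.
    level : Fin r → ℕ → Fin r → Carrier
    level i s j = if does (i Fin.≟ j) then 1# else node i s - node j s

    below : Fin r → ℕ → Fin r → Carrier
    below i s j = prod (λ t → node i s - node j t) s

    above : Fin r → ℕ → ℕ → Fin r → Carrier
    above i s m j = prod (λ t → node i s - node j (suc (s ℕ.+ t))) m

    level-≡ : ∀ i s → level i s i ≡ 1#
    level-≡ i s = ≡.cong (λ z → if z then 1# else node i s - node i s) (dec-true (i Fin.≟ i) ≡.refl)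

    level-≢ : ∀ {i j} s → i ≢ j → level i s j ≡ node i s - node j s
    level-≢ {i} {j} s i≢j = ≡.cong (λ z → if z then 1# else node i s - node j s) (dec-false (i Fin.≟ j) i≢j)

    ≢punchIn : ∀ (i : Fin r) j → i ≢ punchIn i j
    ≢punchIn i j = Fin.punchInᵢ≢i i j ∘ ≡.sym

    -- The factors 1 / (bᵢ - bⱼ), j ≠ i, of c i.
    b-b⁻¹ : (i : Fin r) → Fin r-1 → Carrier
    b-b⁻¹ i j = (b i - b (punchIn i j)) ⁻¹[ b-b#0 (Fin.punchInᵢ≢i i j ∘ ≡.sym) ]

    product-b-b⁻¹ : ∀ i (v : Fin r-1 → Carrier) y → (∀ j → b-b⁻¹ i j * v j ≈ y) →
      product (b-b⁻¹ i) * product v ≈ y * y ^ r-2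
    product-b-b⁻¹ i v y cancel = trans (sym (product-* (b-b⁻¹ i) v))
        (trans (product-cong cancel) (product-const r-1 y))

    b-b⁻¹*level : ∀ i s j → b-b⁻¹ i j * level i s (punchIn i j) ≈ q ^ s
    b-b⁻¹*level i s j = begin
      b-b⁻¹ i j * level i s (punchIn i j)                    ≡⟨ ≡.cong (b-b⁻¹ i j *_) (level-≢ s (≢punchIn i j)) ⟩
      b-b⁻¹ i j * (b i * q ^ s - b (punchIn i j) * q ^ s)    ≈⟨ *-congˡ (+-congˡ (-‿distribˡ-* (b (punchIn i j)) (q ^ s))) ⟩
      b-b⁻¹ i j * (b i * q ^ s + - b (punchIn i j) * q ^ s)  ≈⟨ *-congˡ (distribʳ (q ^ s) (b i) (- b (punchIn i j))) ⟨
      b-b⁻¹ i j * ((b i - b (punchIn i j)) * q ^ s)          ≈⟨ *-assoc (b-b⁻¹ i j) (b i - b (punchIn i j)) (q ^ s) ⟨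
      b-b⁻¹ i j * (b i - b (punchIn i j)) * q ^ s            ≈⟨ *-congʳ inverse ⟩
      1# * q ^ s                                             ≈⟨ *-identityˡ (q ^ s) ⟩
      q ^ s                                                  ∎
      where
      inverse : b-b⁻¹ i j * (b i - b (punchIn i j)) ≈ 1#
      inverse = ⁻¹-inverseˡ {b i - b (punchIn i j)} (b-b#0 (Fin.punchInᵢ≢i i j ∘ ≡.sym))

    b-b⁻¹-level : ∀ i s → product (b-b⁻¹ i) * product (λ j → level i s (punchIn i j)) ≈ q ^ s * (q ^ s) ^ r-2
    b-b⁻¹-level i s = product-b-b⁻¹ i (λ j → level i s (punchIn i j)) (q ^ s) (b-b⁻¹*level i s)

    c-product : ∀ i → c i ≡ q * b i ^ r-2 * product (b-b⁻¹ i)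
    c-product i = ≡.refl

    level-product : ∀ i s → product (level i s) ≈ product (λ j → level i s (punchIn i j))
    level-product i s = trans (Product.sum-remove {r-1} {i} (level i s))
      (trans (*-congʳ (reflexive (level-≡ i s))) (*-identityˡ (product (λ j → level i s (punchIn i j)))))

    c-level : ∀ i s → c i * product (level i s) ≈ q * node i s ^ r-2 * q ^ s
    c-level i s = begin
      c i * product (level i s)
        ≡⟨ ≡.cong (_* product (level i s)) (c-product i) ⟩
      q * b i ^ r-2 * product (b-b⁻¹ i) * product (level i s)
        ≈⟨ *-congˡ (level-product i s) ⟩
      q * b i ^ r-2 * product (b-b⁻¹ i) * product (λ j → level i s (punchIn i j))
        ≈⟨ *-assoc (q * b i ^ r-2) (product (b-b⁻¹ i)) (product (λ j → level i s (punchIn i j))) ⟩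
      q * b i ^ r-2 * (product (b-b⁻¹ i) * product (λ j → level i s (punchIn i j)))
        ≈⟨ *-congˡ (b-b⁻¹-level i s) ⟩
      q * b i ^ r-2 * (q ^ s * (q ^ s) ^ r-2)
        ≈⟨ solve* 4 (λ q x y z → q ⊗ x ⊗ (y ⊗ z) ⊜ q ⊗ (x ⊗ z) ⊗ y) refl q (b i ^ r-2) (q ^ s) ((q ^ s) ^ r-2) ⟩
      q * (b i ^ r-2 * (q ^ s) ^ r-2) * q ^ s
        ≈⟨ *-congʳ (*-congˡ (^-distrib-* (b i) (q ^ s) r-2)) ⟨
      q * node i s ^ r-2 * q ^ s ∎

    /-cancel : ∀ x {y} (y#0 : y # 0#) → x / y [ y#0 ] * y ≈ x
    /-cancel x {y} y#0 = trans (*-assoc x (y ⁻¹[ y#0 ]) y) (trans (*-congˡ {x} (⁻¹-inverseˡ {y} y#0)) (*-identityʳ x))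

    fraction-cancel : ∀ x {y} (y#0 : y # 0#) z → x / y [ y#0 ] * (y * z) ≈ x * z
    fraction-cancel x {y} y#0 z = begin
      x * y ⁻¹[ y#0 ] * (y * z)  ≈⟨ *-assoc (x * y ⁻¹[ y#0 ]) y z ⟨
      x * y ⁻¹[ y#0 ] * y * z    ≈⟨ *-congʳ (/-cancel x y#0) ⟩
      x * z                      ∎

    above≈ : ∀ i s m → product (above i s m)
      ≈ product (λ j → pochhammer (q * b j / b i [ b#0 i ]) m) * product {r} (λ _ → node i s ^ m)
    above≈ i s m = trans (product-cong λ j → sym (pochhammer-rising i (b j) s m))
      (product-* (λ j → pochhammer (q * b j / b i [ b#0 i ]) m) (λ _ → node i s ^ m))

    f-above : ∀ i s m → series (f i) m * product (above i s m)
                ≈ product (λ j → prod (λ t → node i s - a j * q ^ suc (s ℕ.+ t)) m)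
    f-above i s m = begin
      N * D⁻¹ * product (above i s m)  ≈⟨ *-congˡ (above≈ i s m) ⟩
      N * D⁻¹ * (D * Z)                ≈⟨ fraction-cancel N {D} (f-denominator#0 i m) Z ⟩
      N * Z                            ≈⟨ product-* (λ j → pochhammer (q * a j / b i [ b#0 i ]) m) (λ _ → node i s ^ m) ⟨
      product (λ j → pochhammer (q * a j / b i [ b#0 i ]) m * node i s ^ m)
                                       ≈⟨ product-cong (λ j → pochhammer-rising i (a j) s m) ⟩
      product (λ j → prod (λ t → node i s - a j * q ^ suc (s ℕ.+ t)) m) ∎
      where
      N D D⁻¹ Z : Carrier
      N = product (λ j → pochhammer (q * a j / b i [ b#0 i ]) m)
      D = product (λ j → pochhammer (q * b j / b i [ b#0 i ]) m)
      D⁻¹ = D ⁻¹[ f-denominator#0 i m ]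
      Z = product {r} (λ _ → node i s ^ m)

    -- The product over j of pochhammer-falling.
    product-falling : ∀ i (x z : Fin r → Carrier) → (∀ j → z j * x j ≈ q * b i) → ∀ s →
      product (λ j → prod (λ t → node i s - x j * q ^ t) s)
        ≈ product (λ j → pochhammer (z j) s) * (product (λ j → - x j) ^ s * triangular s ^ r)
    product-falling i x z zx≈qb s = begin
      product (λ j → prod (λ t → node i s - x j * q ^ t) s)
        ≈⟨ product-cong (λ j → pochhammer-falling i (x j) (z j) (zx≈qb j) s) ⟩
      product (λ j → pochhammer (z j) s * ((- x j) ^ s * triangular s))
        ≈⟨ product-* (λ j → pochhammer (z j) s) (λ j → (- x j) ^ s * triangular s) ⟩
      product (λ j → pochhammer (z j) s) * product (λ j → (- x j) ^ s * triangular s)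
        ≈⟨ *-congˡ (trans (product-* (λ j → (- x j) ^ s) (λ _ → triangular s))
             (*-cong (product-^ (λ j → - x j) s) (product-const r (triangular s)))) ⟩
      product (λ j → pochhammer (z j) s) * (product (λ j → - x j) ^ s * triangular s ^ r) ∎

    below≈ : ∀ i s → product (below i s)
      ≈ product (λ j → pochhammer (q * b i / b j [ b#0 j ]) s) * (product (λ j → - b j) ^ s * triangular s ^ r)
    below≈ i s = product-falling i b (λ j → q * b i / b j [ b#0 j ]) (λ j → /-cancel (q * b i) (b#0 j)) s

    -- The only use of bᵣ = q.
    product-b : product b ≈ product (b ∘ inject₁) * q
    product-b = trans (Product.sum-init-last {r-1} b) (*-congˡ bᵣ≈q)

    -- The argument of the power series of g is κ z.
    κ : Carrier
    κ = product a * q ^ r-2 / product (b ∘ inject₁) [ product#0 (b ∘ inject₁) (b#0 ∘ inject₁) ]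

    κ-product : κ * product (λ j → - b j) * q ≈ product (λ j → - (a j * q))
    κ-product = begin
      κ * product (λ j → - b j) * q
        ≈⟨ *-congʳ (*-congˡ (trans (product-neg b) (*-congʳ product-b))) ⟩
      κ * (B′ * q * (- 1#) ^ r) * q
        ≈⟨ solve* 4 (λ κ b q σ → κ ⊗ (b ⊗ q ⊗ σ) ⊗ q ⊜ κ ⊗ b ⊗ (q ⊗ q) ⊗ σ) refl κ B′ q ((- 1#) ^ r) ⟩
      κ * B′ * (q * q) * (- 1#) ^ r
        ≈⟨ *-congʳ (*-congʳ (/-cancel (product a * q ^ r-2) (product#0 (b ∘ inject₁) (b#0 ∘ inject₁)))) ⟩
      product a * q ^ r-2 * (q * q) * (- 1#) ^ r
        ≈⟨ *-congʳ (solve* 3 (λ a x q → a ⊗ x ⊗ (q ⊗ q) ⊜ a ⊗ (q ⊗ (q ⊗ x))) refl (product a) (q ^ r-2) q) ⟩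
      product a * q ^ r * (- 1#) ^ r
        ≈⟨ *-congʳ (trans (product-* a (λ _ → q)) (*-congˡ (product-const r q))) ⟨
      product (λ j → a j * q) * (- 1#) ^ r
        ≈⟨ product-neg (λ j → a j * q) ⟨
      product (λ j → - (a j * q)) ∎
      where
      B′ : Carrier
      B′ = product (b ∘ inject₁)

    g-below : ∀ i s → series (g i) s * product (below i s) * q ^ s
                ≈ product (λ j → prod (λ t → node i s - a j * q ^ suc t) s)
    g-below i s = begin
      N * D⁻¹ * κ ^ s * product (below i s) * q ^ s
        ≈⟨ *-congʳ (*-congˡ (below≈ i s)) ⟩
      N * D⁻¹ * κ ^ s * (D * (β ^ s * τ)) * q ^ s
        ≈⟨ solve* 6 (λ n k d β τ y → n ⊗ k ⊗ (d ⊗ (β ⊗ τ)) ⊗ y ⊜ n ⊗ (d ⊗ (k ⊗ β ⊗ y ⊗ τ))) refl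
             (N * D⁻¹) (κ ^ s) D (β ^ s) τ (q ^ s) ⟩
      N * D⁻¹ * (D * (κ ^ s * β ^ s * q ^ s * τ))
        ≈⟨ fraction-cancel N {D} (g-denominator#0 i s) (κ ^ s * β ^ s * q ^ s * τ) ⟩
      N * (κ ^ s * β ^ s * q ^ s * τ)
        ≈⟨ *-congˡ (*-congʳ (trans (^-distrib-* (κ * β) q s) (*-congʳ (^-distrib-* κ β s)))) ⟨
      N * ((κ * β * q) ^ s * τ)
        ≈⟨ *-congˡ (*-congʳ (^-congˡ s κ-product)) ⟩
      N * (product (λ j → - (a j * q)) ^ s * τ)
        ≈⟨ product-falling i (λ j → a j * q) (λ j → b i / a j [ a#0 j ])
             (λ j → trans (sym (*-assoc _ _ _)) (trans (*-congʳ (/-cancel (b i) (a#0 j))) (*-comm _ _))) s ⟨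
      product (λ j → prod (λ t → node i s - a j * q * q ^ t) s)
        ≈⟨ product-cong {r} (λ j → prod-cong (λ t → +-congˡ {node i s} (-‿cong (*-assoc (a j) q (q ^ t)))) s) ⟩
      product (λ j → prod (λ t → node i s - a j * q ^ suc t) s) ∎
      where
      N D D⁻¹ β τ : Carrier
      N = product (λ j → pochhammer (b i / a j [ a#0 j ]) s)
      D = product (λ j → pochhammer (q * b i / b j [ b#0 j ]) s)
      D⁻¹ = D ⁻¹[ g-denominator#0 i s ]
      β = product (λ j → - b j)
      τ = triangular s ^ r

    -- Ωₙ and its residues

    -- The numerator ∏ⱼ ∏_{t=1}^{n} (x - aⱼ qᵗ) of Ωₙ.
    numerator : ℕ → Carrier → Carrier
    numerator n x = product (λ j → prod (λ t → x - a j * q ^ suc t) n)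

    -- The factors ∏ⱼ (x - aⱼ qᵏ) and ∏ⱼ (x - bⱼ qᵏ) of the numerator and of the
    -- denominator.
    aFactor bFactor : ℕ → Carrier → Carrier
    aFactor k x = product (λ j → x - a j * q ^ k)
    bFactor k x = product (λ j → x - node j k)

    numerator-+ : ∀ s m x → numerator (s ℕ.+ m) x
      ≈ numerator s x * product (λ j → prod (λ t → x - a j * q ^ suc (s ℕ.+ t)) m)
    numerator-+ s m x = trans (product-cong λ j → prod-+ (λ t → x - a j * q ^ suc t) s m)
      (product-* (λ j → prod (λ t → x - a j * q ^ suc t) s) (λ j → prod (λ t → x - a j * q ^ suc (s ℕ.+ t)) m))

    numerator-suc : ∀ n x → numerator (suc n) x ≈ numerator n x * aFactor (suc n) x
    numerator-suc n x = product-* (λ j → prod (λ t → x - a j * q ^ suc t) n) (λ j → x - a j * q ^ suc n)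

    numerator-0 : ∀ x → numerator 0 x ≈ 1#
    numerator-0 x = trans (product-const r 1#) (1^n≈1 r)

    -- The poles of Ωₙ. The index (i , m) stands for bᵢ qⁿ⁻ᵐ, because m is the exponent
    -- of z in the series of f i; so (i , suc m) stands for the same pole of Ωₙ₊₁.
    Index : ℕ → Set
    Index n = Fin r × Fin (suc n)

    point : ∀ n → Index n → Carrier
    point n (i , m) = node i (n ℕ.∸ toℕ m)

    -- The differences of the poles of Ωₙ, with 1 on the diagonal.
    difference-matrix : ∀ n → Index n → Index n → Carrier
    difference-matrix n (i , m) (j , t) =
      if does (m Fin.≟ t) then level i (n ℕ.∸ toℕ m) j else node i (n ℕ.∸ toℕ m) - node j (n ℕ.∸ toℕ t)

    difference-diagonal : ∀ n u → difference-matrix n u u ≡ 1#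
    difference-diagonal n (i , m) = ≡.trans
      (≡.cong (λ z → if z then level i (n ℕ.∸ toℕ m) i else point n (i , m) - point n (i , m)) (dec-true (m Fin.≟ m) ≡.refl))
      (level-≡ i (n ℕ.∸ toℕ m))

    difference-off : ∀ n {u v} → u ≢ v → difference-matrix n u v ≡ point n u - point n v
    difference-off n {i , m} {j , t} u≢v with m Fin.≟ t
    ... | yes ≡.refl = level-≢ (n ℕ.∸ toℕ m) λ where ≡.refl → u≢v ≡.refl
    ... | no _       = ≡.refl

    -- The derivative of ∏_{t=0}^{n} ∏ⱼ (x - bⱼ qᵗ) at a pole.
    denominator : ∀ n → Index n → Carrier
    denominator n u = product {r} λ j → product {suc n} λ t → difference-matrix n u (j , t)

    denominator-split : ∀ n i m (let s = n ℕ.∸ toℕ m) → denominator n (i , m)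
      ≈ product (level i s) * (product (below i s) * product (above i s (toℕ m)))
    denominator-split n i m = trans
      (product-cong λ j → prod-punctured (λ t → node i s - node j t) (level i s j) n m)
      (trans (product-* (level i s) (λ j → below i s j * above i s (toℕ m) j))
        (*-congˡ (product-* (below i s) (above i s (toℕ m)))))
      where
      s : ℕ
      s = n ℕ.∸ toℕ m

    -- The coefficients of f i and g i carry the factors on the levels above and below
    -- the pole, and c i those on its level.
    coefficient-levels : ∀ i s m →
      c i * (series (f i) m * series (g i) s) * (product (level i s) * (product (below i s) * product (above i s m)))
        ≈ q * node i s ^ r-2 * numerator (s ℕ.+ m) (node i s)
    coefficient-levels i s m = trans
      (rearrange (c i) (series (f i) m) (series (g i) s) (product (level i s)) (product (below i s)) (product (above i s m))
        (c-level i s) (g-below i s) (f-above i s m))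
      (*-congˡ (sym (numerator-+ s m (node i s))))
      where
      rearrange : ∀ c α γ E B A {x y l h} → c * E ≈ x * y → γ * B * y ≈ l → α * A ≈ h →
        c * (α * γ) * (E * (B * A)) ≈ x * (l * h)
      rearrange c α γ E B A {x} {y} {l} {h} cE γB αA = begin
        c * (α * γ) * (E * (B * A))
          ≈⟨ solve* 6 (λ c α γ e b a → c ⊗ (α ⊗ γ) ⊗ (e ⊗ (b ⊗ a)) ⊜ c ⊗ e ⊗ (γ ⊗ b ⊗ (α ⊗ a))) refl c α γ E B A ⟩
        c * E * (γ * B * (α * A))
          ≈⟨ *-congʳ cE ⟩
        x * y * (γ * B * (α * A))
          ≈⟨ solve* 4 (λ x y u v → x ⊗ y ⊗ (u ⊗ v) ⊜ x ⊗ (u ⊗ y ⊗ v)) refl x y (γ * B) (α * A) ⟩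
        x * (γ * B * y * (α * A))
          ≈⟨ *-congˡ (*-cong γB αA) ⟩
        x * (l * h) ∎

    coefficient-denominator : ∀ n i m (let s = n ℕ.∸ toℕ m) →
      c i * (series (f i) (toℕ m) * series (g i) s) * denominator n (i , m)
        ≈ q * node i s ^ r-2 * numerator n (node i s)
    coefficient-denominator n i m = trans
      (*-congˡ (denominator-split n i m))
      (trans (coefficient-levels i (n ℕ.∸ toℕ m) (toℕ m))
        (*-congˡ (reflexive (≡.cong (λ k → numerator k (node i (n ℕ.∸ toℕ m))) (ℕ.m∸n+n≡m (ℕ.≤-pred (Fin.toℕ<n m)))))))

    neg#0 : ∀ {x} → x # 0# → - x # 0#
    neg#0 {x} x#0 = #-congʳ (-1*x≈-x x) (x#0y#0→xy#0 -1#0 x#0)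

    triangular#0 : ∀ s → triangular s # 0#
    triangular#0 zero    = 1#0
    triangular#0 (suc s) = x#0y#0→xy#0 (triangular#0 s) (^#0 q#0 s)

    denominator-levels#0 : ∀ i s m → product (level i s) * (product (below i s) * product (above i s m)) # 0#
    denominator-levels#0 i s m = x#0y#0→xy#0
      (factor#0 {c i} (#-congʳ (sym (c-level i s))
        (x#0y#0→xy#0 (x#0y#0→xy#0 q#0 (^#0 (node#0 i s) r-2)) (^#0 q#0 s))))
      (x#0y#0→xy#0
        (#-congʳ (sym (below≈ i s)) (x#0y#0→xy#0 (g-denominator#0 i s)
          (x#0y#0→xy#0 (^#0 (product#0 (λ j → - b j) (neg#0 ∘ b#0)) s) (^#0 (triangular#0 s) r))))
        (#-congʳ (sym (above≈ i s m)) (x#0y#0→xy#0 (f-denominator#0 i m)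
          (product#0 {r} (λ _ → node i s ^ m) (λ _ → ^#0 (node#0 i s) m)))))

    abstract
      denominator#0 : ∀ n u → denominator n u # 0#
      denominator#0 n (i , m) =
        #-congʳ (sym (denominator-split n i m)) (denominator-levels#0 i (n ℕ.∸ toℕ m) (toℕ m))

    -- The residues of the reciprocal of the denominator of Ωₙ.
    weights : ∀ n → Index n → Carrier
    weights n u = denominator n u ⁻¹[ denominator#0 n u ]

    weights-denominator : ∀ n u → weights n u * denominator n u ≈ 1#
    weights-denominator n u = ⁻¹-inverseˡ {denominator n u} (denominator#0 n u)

    -- The residue of Ωₙ at a pole.
    residue : ∀ n → Index n → Carrier
    residue n u = weights n u * numerator n (point n u)

    coefficient-residue : ∀ n i m (let s = n ℕ.∸ toℕ m) →
      c i * (series (f i) (toℕ m) * series (g i) s) ≈ q * node i s ^ r-2 * residue n (i , m)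
    coefficient-residue n i m = isolate (c i * (series (f i) (toℕ m) * series (g i) (n ℕ.∸ toℕ m)))
      (weights-denominator n (i , m)) (denominator#0 n (i , m)) (coefficient-denominator n i m)
      where
      isolate : ∀ x {D w y p} → w * D ≈ 1# → D # 0# → x * D ≈ y * p → x ≈ y * (w * p)
      isolate x {D} {w} {y} {p} wD≈1 D#0 xD≈yp = #0-cancelˡ D#0 (begin
        D * x                      ≈⟨ *-comm D x ⟩
        x * D                      ≈⟨ xD≈yp ⟩
        y * p                      ≈⟨ *-identityˡ (y * p) ⟨
        1# * (y * p)               ≈⟨ *-congʳ wD≈1 ⟨
        w * D * (y * p)            ≈⟨ solve* 4 (λ w d y p → w ⊗ d ⊗ (y ⊗ p) ⊜ d ⊗ (y ⊗ (w ⊗ p))) refl w D y p ⟩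
        D * (y * (w * p))          ∎)

    -- Sums of residues

    -- A function of the pole bᵢ qˢ.
    Weighting : Set ℓ
    Weighting = Fin r → ℕ → Carrier

    -- The sum of θ Res Ωₙ over all poles.
    total : ℕ → Weighting → Carrier
    total n θ = sum {r} λ i → sum {suc n} λ m → residue n (i , m) * θ i (n ℕ.∸ toℕ m)

    total-cong : ∀ n {θ η : Weighting} → (∀ i s → θ i s ≈ η i s) → total n θ ≈ total n η
    total-cong n θ≈η = Sum.sum-cong-≋ {r} λ i → Sum.sum-cong-≋ {suc n} λ m → *-congˡ {residue n (i , m)} (θ≈η i (n ℕ.∸ toℕ m))

    -- The r (n + 1) poles in a single enumeration.
    index : ∀ n → Fin (r ℕ.* suc n) → Index n
    index n = remQuot {r} (suc n)

    weighted : ∀ n → Weighting → Index n → Carrier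
    weighted n θ (i , m) = residue n (i , m) * θ i (n ℕ.∸ toℕ m)

    -- The sums of xᵉ θ Res Ωₙ.
    moments : ℕ → Weighting → Series
    moments n θ = moment (weighted n θ ∘ index n) (point n ∘ index n)

    total≈moments : ∀ n (θ : Weighting) e → total n (λ i s → θ i s * node i s ^ e) ≈ moments n θ e
    total≈moments n θ e = trans
      (Sum.sum-cong-≋ {r} λ i → Sum.sum-cong-≋ {suc n} λ m →
        sym (*-assoc (residue n (i , m)) (θ i (n ℕ.∸ toℕ m)) (node i (n ℕ.∸ toℕ m) ^ e)))
      (sym (PairSum.sum-remQuot r (suc n) (λ u → weighted n θ u * point n u ^ e)))

    index-injective : ∀ n {p p′} → index n p ≡ index n p′ → p ≡ p′
    index-injective n {p} {p′} eq = ≡.trans (≡.sym (Fin.combine-remQuot {r} (suc n) p))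
      (≡.trans (≡.cong (uncurry combine) eq) (Fin.combine-remQuot {r} (suc n) p′))

    partialFraction : ∀ n → IsPartialFraction (point n ∘ index n) (weights n ∘ index n)
      (λ p p′ → difference-matrix n (index n p) (index n p′))
    partialFraction n = record
      { diagonal   = λ p → reflexive (difference-diagonal n (index n p))
      ; difference = λ p≢p′ → reflexive (difference-off n (p≢p′ ∘ index-injective n))
      ; weight     = λ p → trans
          (*-congˡ (PairProduct.sum-remQuot r (suc n) (difference-matrix n (index n p))))
          (weights-denominator n (index n p))
      }

    numerator-order : ∀ n {N D} (v x : Fin N → Carrier) →
      HasOrder (n ℕ.* r ℕ.+ D) (moment v x) → HasOrder D (moment (λ i → v i * numerator n (x i)) x)
    numerator-order zero    v x o = HasOrder-cong
      (moment-congˡ x λ i → sym (trans (*-congˡ (numerator-0 (x i))) (*-identityʳ (v i)))) o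
    numerator-order (suc n) {D = D} v x o = HasOrder-cong
      (λ e → sym (trans
        (moment-congˡ x (λ i → trans (*-congˡ (numerator-suc n (x i))) (sym (*-assoc (v i) _ _))) e)
        (moment-factors (λ j → a j * q ^ suc n) (λ i → v i * numerator n (x i)) x e)))
      (factors-order (λ j → a j * q ^ suc n)
        (numerator-order n v x (≡.subst (λ k → HasOrder k (moment v x)) exchange o)))
      where
      exchange : suc n ℕ.* r ℕ.+ D ≡ n ℕ.* r ℕ.+ (r ℕ.+ D)
      exchange = ≡.trans (≡.cong (ℕ._+ D) (ℕ.+-comm r (n ℕ.* r))) (ℕ.+-assoc (n ℕ.* r) r D)

    -- The sums of xᵉ Res Ωₙ.
    W : ℕ → Series
    W n = moments n (λ _ _ → 1#)

    W-order : ∀ n → HasOrder r-1 (W n)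
    W-order n = HasOrder-cong
      (moment-congˡ (point n ∘ index n) λ p → sym (*-identityʳ (residue n (index n p))))
      (numerator-order n (weights n ∘ index n) (point n ∘ index n)
        (≡.subst (λ k → HasOrder k (moment (weights n ∘ index n) (point n ∘ index n))) count
          (partialFraction-order (n ℕ.+ r-1 ℕ.* suc n) (partialFraction n))))
      where
      -- One less than the number r (n + 1) of nodes.
      count : n ℕ.+ r-1 ℕ.* suc n ≡ n ℕ.* r ℕ.+ r-1
      count = ℕ.suc-injective (≡.trans (ℕ.*-comm r (suc n))
        (≡.cong suc (ℕ.+-comm r-1 (n ℕ.* r))))

    -- The relation between Ωₙ₊₁ and Ωₙ

    -- The poles of Ωₙ₊₁ that are not poles of Ωₙ are those with m = 0.
    denominator-suc : ∀ n i m → denominator (suc n) (i , Fin.suc m)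
      ≈ bFactor (suc n) (point n (i , m)) * denominator n (i , m)
    denominator-suc n i m = product-* (λ j → point n (i , m) - node j (suc n))
      (λ j → product {suc n} λ t → difference-matrix n (i , m) (j , t))

    residue-suc : ∀ n i m → residue (suc n) (i , Fin.suc m) * bFactor (suc n) (point n (i , m))
      ≈ residue n (i , m) * aFactor (suc n) (point n (i , m))
    residue-suc n i m = begin
      w′ * numerator (suc n) x * B    ≈⟨ *-congʳ (*-congˡ (numerator-suc n x)) ⟩
      w′ * (p * A) * B                ≈⟨ solve* 4 (λ w p a b → w ⊗ (p ⊗ a) ⊗ b ⊜ w ⊗ b ⊗ p ⊗ a) refl w′ p A B ⟩
      w′ * B * p * A                  ≈⟨ *-congʳ (*-congʳ w′B≈w) ⟩
      w * p * A                       ∎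
      where
      w w′ x p A B D : Carrier
      w = weights n (i , m)
      w′ = weights (suc n) (i , Fin.suc m)
      x = point n (i , m)
      p = numerator n x
      A = aFactor (suc n) x
      B = bFactor (suc n) x
      D = denominator n (i , m)
      w′B≈w : w′ * B ≈ w
      w′B≈w = #0-cancelˡ (denominator#0 n (i , m)) (begin
        D * (w′ * B)   ≈⟨ solve* 3 (λ d w b → d ⊗ (w ⊗ b) ⊜ w ⊗ (b ⊗ d)) refl D w′ B ⟩
        w′ * (B * D)   ≈⟨ *-congˡ (denominator-suc n i m) ⟨
        w′ * denominator (suc n) (i , Fin.suc m)
                       ≈⟨ weights-denominator (suc n) (i , Fin.suc m) ⟩
        1#             ≈⟨ weights-denominator n (i , m) ⟨
        w * D          ≈⟨ *-comm w D ⟩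
        D * w          ∎)

    bFactor-node : ∀ i k → bFactor k (node i k) ≈ 0#
    bFactor-node i k = product-zero (λ j → node i k - node j k) i (-‿inverseʳ (node i k))

    vanishing-term : ∀ x {y} z → y ≈ 0# → x * (y * z) ≈ 0#
    vanishing-term x z y≈0 = trans (*-congˡ (trans (*-congʳ y≈0) (zeroˡ z))) (zeroʳ x)

    -- At the new poles of Ωₙ₊₁ the factor bFactor (suc n) vanishes.
    total-suc : ∀ n (θ : Weighting) → total (suc n) (λ i s → bFactor (suc n) (node i s) * θ i s)
      ≈ total n (λ i s → aFactor (suc n) (node i s) * θ i s)
    total-suc n θ = Sum.sum-cong-≋ {r} λ i → trans
      (+-cong (vanishing-term (residue (suc n) (i , Fin.zero)) (θ i (suc n)) (bFactor-node i (suc n)))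
        (Sum.sum-cong-≋ {suc n} λ m → shift i m))
      (+-identityˡ _)
      where
      shift : ∀ i m (let s = n ℕ.∸ toℕ m) →
        residue (suc n) (i , Fin.suc m) * (bFactor (suc n) (node i s) * θ i s)
          ≈ residue n (i , m) * (aFactor (suc n) (node i s) * θ i s)
      shift i m = trans (sym (*-assoc _ _ _)) (trans (*-congʳ (residue-suc n i m)) (*-assoc _ _ _))

    total-zero : ∀ (θ : Weighting) → total 0 (λ i s → bFactor 0 (node i s) * θ i s) ≈ 0#
    total-zero θ = trans
      (Sum.sum-cong-≋ {r} λ i → trans (+-identityʳ _)
        (vanishing-term (residue 0 (i , Fin.zero)) (θ i 0) (bFactor-node i 0)))
      (Sum.sum-replicate-zero r)

    moments-factors : ∀ n (θ : Weighting) (d : Fin r → Carrier) e →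
      total n (λ i s → product (λ j → node i s - d j) * (θ i s * node i s ^ e)) ≈ factors d (moments n θ) e
    moments-factors n θ d e = begin
      total n (λ i s → product (λ j → node i s - d j) * (θ i s * node i s ^ e))
        ≈⟨ total-cong n (λ i s → solve* 3 (λ p t x → p ⊗ (t ⊗ x) ⊜ t ⊗ p ⊗ x) refl
             (product (λ j → node i s - d j)) (θ i s) (node i s ^ e)) ⟩
      total n (λ i s → θ i s * product (λ j → node i s - d j) * node i s ^ e)
        ≈⟨ total≈moments n (λ i s → θ i s * product (λ j → node i s - d j)) e ⟩
      moments n (λ i s → θ i s * product (λ j → node i s - d j)) e
        ≈⟨ moment-congˡ (point n ∘ index n) (λ p → sym (reassociate (index n p))) e ⟩
      moment (λ p → weighted n θ (index n p) * product (λ j → point n (index n p) - d j)) (point n ∘ index n) e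
        ≈⟨ moment-factors d (weighted n θ ∘ index n) (point n ∘ index n) e ⟩
      factors d (moments n θ) e ∎
      where
      reassociate : ∀ u → weighted n θ u * product (λ j → point n u - d j)
        ≈ weighted n (λ i s → θ i s * product (λ j → node i s - d j)) u
      reassociate (i , m) = *-assoc (residue n (i , m)) (θ i (n ℕ.∸ toℕ m)) (product (λ j → point n (i , m) - d j))

    -- The relation between Ωₙ₊₁ and Ωₙ, multiplied by xᵉ θ and summed over the poles.
    moments-suc : ∀ n (θ : Weighting) → factors (λ j → node j (suc n)) (moments (suc n) θ)
      ≋ factors (λ j → a j * q ^ suc n) (moments n θ)
    moments-suc n θ e = trans (sym (moments-factors (suc n) θ (λ j → node j (suc n)) e))
      (trans (total-suc n (λ i s → θ i s * node i s ^ e))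
        (moments-factors n θ (λ j → a j * q ^ suc n) e))

    -- Ω₀(x) ∏ⱼ (x - bⱼ) = 1 has no residues.
    moments-zero : ∀ (θ : Weighting) → factors (λ j → node j 0) (moments 0 θ) ≋ 0ₛ
    moments-zero θ e = trans (sym (moments-factors 0 θ (λ j → node j 0) e))
      (total-zero (λ i s → θ i s * node i s ^ e))

    -- The sum of x⁻¹ Res Ωₙ

    reciprocal : Weighting
    reciprocal i s = node i s ⁻¹[ node#0 i s ]

    node*reciprocal : ∀ i s → node i s * reciprocal i s ≈ 1#
    node*reciprocal i s = ⁻¹-inverseʳ {node i s} (node#0 i s)

    -- V n e is the sum of xᵉ⁻¹ Res Ωₙ.
    V : ℕ → Series
    V n = moments n reciprocal

    V-suc : ∀ n e → V n (suc e) ≈ W n e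
    V-suc n e = Sum.sum-cong-≋ {r ℕ.* suc n} λ p → lower (index n p)
      where
      lower : ∀ u → weighted n reciprocal u * point n u ^ suc e ≈ weighted n (λ _ _ → 1#) u * point n u ^ e
      lower (i , m) = trans
        (solve* 4 (λ w u x y → w ⊗ u ⊗ (x ⊗ y) ⊜ w ⊗ (x ⊗ u) ⊗ y) refl
          (residue n (i , m)) (reciprocal i (n ℕ.∸ toℕ m)) (point n (i , m)) (point n (i , m) ^ e))
        (*-congʳ (*-congˡ (node*reciprocal i (n ℕ.∸ toℕ m))))

    -- Only the extreme terms of ∏ⱼ (x - dⱼ) contribute, by W-order.
    V-factors : ∀ n (d : Fin r → Carrier) → factors d (V n) 0 ≈ 1# + product (λ j → - d j) * V n 0
    V-factors n d = trans
      (factors-at-0 d λ e e<r-1 → trans (V-suc n e) (vanishes (W-order n) e<r-1))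
      (+-congʳ (trans (V-suc n r-1) (leading (W-order n))))

    product-neg-scale : ∀ (x : Fin r → Carrier) y → product (λ j → - (x j * y)) ≈ y ^ r * (- 1#) ^ r * product x
    product-neg-scale x y = begin
      product (λ j → - (x j * y))                ≈⟨ product-neg (λ j → x j * y) ⟩
      product (λ j → x j * y) * (- 1#) ^ r       ≈⟨ *-congʳ (trans (product-* x (λ _ → y)) (*-congˡ (product-const r y))) ⟩
      product x * y ^ r * (- 1#) ^ r             ≈⟨ solve* 3 (λ a b c → a ⊗ b ⊗ c ⊜ b ⊗ c ⊗ a) refl (product x) (y ^ r) ((- 1#) ^ r) ⟩
      y ^ r * (- 1#) ^ r * product x             ∎

    scale#0 : ∀ k → (q ^ k) ^ r * (- 1#) ^ r # 0#
    scale#0 k = x#0y#0→xy#0 (^#0 (^#0 q#0 k) r) (^#0 -1#0 r)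

    V-step : ∀ n → product b * V (suc n) 0 ≈ product a * V n 0
    V-step n = #0-cancelˡ (scale#0 (suc n)) (begin
      k * (product b * V (suc n) 0)                              ≈⟨ *-assoc k (product b) (V (suc n) 0) ⟨
      k * product b * V (suc n) 0                                ≈⟨ *-congʳ (product-neg-scale b (q ^ suc n)) ⟨
      product (λ j → - node j (suc n)) * V (suc n) 0             ≈⟨ +-cancelˡ 1# _ _ equal ⟩
      product (λ j → - (a j * q ^ suc n)) * V n 0                ≈⟨ *-congʳ (product-neg-scale a (q ^ suc n)) ⟩
      k * product a * V n 0                                      ≈⟨ *-assoc k (product a) (V n 0) ⟩
      k * (product a * V n 0)                                    ∎)
      where
      k : Carrier
      k = (q ^ suc n) ^ r * (- 1#) ^ r
      equal : 1# + product (λ j → - node j (suc n)) * V (suc n) 0 ≈ 1# + product (λ j → - (a j * q ^ suc n)) * V n 0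
      equal = trans (sym (V-factors (suc n) (λ j → node j (suc n))))
        (trans (moments-suc n reciprocal 0) (V-factors n (λ j → a j * q ^ suc n)))

    V-zero : product b * V 0 0 ≈ (- 1#) ^ suc r
    V-zero = #0-cancelˡ (scale#0 0) (begin
      k * (product b * V 0 0)                  ≈⟨ *-assoc k (product b) (V 0 0) ⟨
      k * product b * V 0 0                    ≈⟨ *-congʳ (product-neg-scale b (q ^ 0)) ⟨
      product (λ j → - node j 0) * V 0 0       ≈⟨ inverse ⟩
      - 1#                                     ≈⟨ *-identityʳ (- 1#) ⟨
      - 1# * 1#                                ≈⟨ *-congˡ (trans (^-congˡ r -1²≈1) (1^n≈1 r)) ⟨
      - 1# * (- 1# * - 1#) ^ r                 ≈⟨ *-congˡ (^-distrib-* (- 1#) (- 1#) r) ⟩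
      - 1# * ((- 1#) ^ r * (- 1#) ^ r)         ≈⟨ solve* 2 (λ x y → x ⊗ (y ⊗ y) ⊜ y ⊗ (x ⊗ y)) refl (- 1#) ((- 1#) ^ r) ⟩
      (- 1#) ^ r * (- 1#) ^ suc r              ≈⟨ *-congʳ (trans (*-congʳ (1^n≈1 r)) (*-identityˡ _)) ⟨
      k * (- 1#) ^ suc r                       ∎)
      where
      k : Carrier
      k = (q ^ 0) ^ r * (- 1#) ^ r
      inverse : product (λ j → - node j 0) * V 0 0 ≈ - 1#
      inverse = +-cancelˡ 1# _ _ (trans (sym (V-factors 0 (λ j → node j 0)))
        (trans (moments-zero reciprocal 0) (sym (-‿inverseʳ 1#))))

    -- The coefficients of M

    f-power : ∀ i k s m → ((q / b i [ b#0 i ]) ^ k * (q ^ k) ^ m) * node i s ^ k ≈ (q ^ suc (s ℕ.+ m)) ^ k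
    f-power i k s m = begin
      (μ ^ k * (q ^ k) ^ m) * node i s ^ k     ≈⟨ *-congʳ (*-congˡ (^-swap q k m)) ⟩
      (μ ^ k * (q ^ m) ^ k) * node i s ^ k     ≈⟨ *-congʳ (^-distrib-* μ (q ^ m) k) ⟨
      (μ * q ^ m) ^ k * node i s ^ k           ≈⟨ ^-distrib-* (μ * q ^ m) (node i s) k ⟨
      (μ * q ^ m * node i s) ^ k               ≈⟨ ^-congˡ k eq ⟩
      (q ^ suc (s ℕ.+ m)) ^ k                  ∎
      where
      μ : Carrier
      μ = q / b i [ b#0 i ]
      eq : μ * q ^ m * node i s ≈ q ^ suc (s ℕ.+ m)
      eq = begin
        μ * q ^ m * (b i * q ^ s)   ≈⟨ solve* 4 (λ u x b y → u ⊗ x ⊗ (b ⊗ y) ⊜ u ⊗ b ⊗ (y ⊗ x)) refl μ (q ^ m) (b i) (q ^ s) ⟩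
        μ * b i * (q ^ s * q ^ m)   ≈⟨ *-cong (/-cancel q (b#0 i)) (sym (^-homo-* q s m)) ⟩
        q * q ^ (s ℕ.+ m)           ∎

    g-power : ∀ i l s → ((b i / q [ q#0 ]) ^ l * (q ^ l) ^ s) * q ^ l ≈ node i s ^ l
    g-power i l s = begin
      (ν ^ l * (q ^ l) ^ s) * q ^ l            ≈⟨ *-congʳ (*-congˡ (^-swap q l s)) ⟩
      (ν ^ l * (q ^ s) ^ l) * q ^ l            ≈⟨ *-congʳ (^-distrib-* ν (q ^ s) l) ⟨
      (ν * q ^ s) ^ l * q ^ l                  ≈⟨ ^-distrib-* (ν * q ^ s) q l ⟨
      (ν * q ^ s * q) ^ l                      ≈⟨ ^-congˡ l eq ⟩
      node i s ^ l                             ∎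
      where
      ν : Carrier
      ν = b i / q [ q#0 ]
      eq : ν * q ^ s * q ≈ node i s
      eq = trans (solve* 3 (λ u x q → u ⊗ x ⊗ q ⊜ u ⊗ q ⊗ x) refl ν (q ^ s) q) (*-congʳ (/-cancel (b i) q#0))

    -- The weighting θ is x to the power r - 2 + l - k, which may be negative.
    module _ (k l : ℕ) (θ : Weighting)
             (θ-power : ∀ i s → node i s ^ r-2 * node i s ^ l ≈ θ i s * node i s ^ k) where

      M-term : ∀ n i m (let s = n ℕ.∸ toℕ m) →
        c i * (series (f i at-zq^ k) (toℕ m) * series (g i at-zq^ l) s) * q ^ l
          ≈ q * (q ^ suc n) ^ k * (residue n (i , m) * θ i s)
      M-term n i m = rearrange
        (c i) ((q / b i [ b#0 i ]) ^ k) ((q ^ k) ^ toℕ m) (series (f i) (toℕ m))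
        ((b i / q [ q#0 ]) ^ l) ((q ^ l) ^ (n ℕ.∸ toℕ m)) (series (g i) (n ℕ.∸ toℕ m))
        (coefficient-residue n i m)
        (trans (f-power i k (n ℕ.∸ toℕ m) (toℕ m))
          (^-congˡ k (reflexive (≡.cong (λ t → q ^ suc t) (ℕ.m∸n+n≡m (ℕ.≤-pred (Fin.toℕ<n m)))))))
        (g-power i l (n ℕ.∸ toℕ m))
        (θ-power i (n ℕ.∸ toℕ m))
        where
        rearrange : ∀ c μ x α ν y γ {ρ X Xₖ Xₗ Y θ z} →
          c * (α * γ) ≈ q * X * ρ → (μ * x) * Xₖ ≈ Y → (ν * y) * z ≈ Xₗ → X * Xₗ ≈ θ * Xₖ →
          c * (μ * (x * α) * (ν * (y * γ))) * z ≈ q * Y * (ρ * θ)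
        rearrange c μ x α ν y γ {ρ} {X} {Xₖ} {Xₗ} {Y} {θ} {z} cαγ fₖ gₗ XXₗ = begin
          c * (μ * (x * α) * (ν * (y * γ))) * z
            ≈⟨ *-congʳ (*-congˡ (*-cong (sym (*-assoc μ x α)) (sym (*-assoc ν y γ)))) ⟩
          c * (μ * x * α * (ν * y * γ)) * z
            ≈⟨ solve* 6 (λ c u α v γ z → c ⊗ (u ⊗ α ⊗ (v ⊗ γ)) ⊗ z ⊜ c ⊗ (α ⊗ γ) ⊗ (u ⊗ (v ⊗ z))) refl
                 c (μ * x) α (ν * y) γ z ⟩
          c * (α * γ) * (μ * x * (ν * y * z))
            ≈⟨ *-cong cαγ (*-congˡ gₗ) ⟩
          q * X * ρ * (μ * x * Xₗ)
            ≈⟨ solve* 5 (λ q X ρ u L → q ⊗ X ⊗ ρ ⊗ (u ⊗ L) ⊜ q ⊗ u ⊗ (ρ ⊗ (X ⊗ L))) refl q X ρ (μ * x) Xₗ ⟩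
          q * (μ * x) * (ρ * (X * Xₗ))
            ≈⟨ *-congˡ (*-congˡ XXₗ) ⟩
          q * (μ * x) * (ρ * (θ * Xₖ))
            ≈⟨ solve* 5 (λ q u ρ t K → q ⊗ u ⊗ (ρ ⊗ (t ⊗ K)) ⊜ q ⊗ (u ⊗ K) ⊗ (ρ ⊗ t)) refl q (μ * x) ρ θ Xₖ ⟩
          q * (μ * x * Xₖ) * (ρ * θ)
            ≈⟨ *-congʳ (*-congˡ fₖ) ⟩
          q * Y * (ρ * θ) ∎

      M-total : ∀ n → M k l n * q ^ l ≈ q * (q ^ suc n) ^ k * total n θ
      M-total n = begin
        M k l n * q ^ l
          ≈⟨ Sum.*-distribʳ-sum {r} (q ^ l) (λ i → c i * sum (fg i)) ⟩
        sum (λ i → c i * sum (fg i) * q ^ l)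
          ≈⟨ Sum.sum-cong-≋ {r} inner ⟩
        sum (λ i → y * sum {suc n} (λ m → residue n (i , m) * θ i (n ℕ.∸ toℕ m)))
          ≈⟨ Sum.*-distribˡ-sum {r} y (λ i → sum {suc n} (λ m → residue n (i , m) * θ i (n ℕ.∸ toℕ m))) ⟨
        y * total n θ ∎
        where
        y : Carrier
        y = q * (q ^ suc n) ^ k
        fg : Fin r → Fin (suc n) → Carrier
        fg i m = series (f i at-zq^ k) (toℕ m) * series (g i at-zq^ l) (n ℕ.∸ toℕ m)
        inner : ∀ i → c i * sum (fg i) * q ^ l ≈ y * sum {suc n} (λ m → residue n (i , m) * θ i (n ℕ.∸ toℕ m))
        inner i = begin
          c i * sum (fg i) * q ^ l
            ≈⟨ *-congʳ (Sum.*-distribˡ-sum {suc n} (c i) (fg i)) ⟩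
          sum (λ m → c i * fg i m) * q ^ l
            ≈⟨ Sum.*-distribʳ-sum {suc n} (q ^ l) (λ m → c i * fg i m) ⟩
          sum (λ m → c i * fg i m * q ^ l)
            ≈⟨ Sum.sum-cong-≋ {suc n} (M-term n i) ⟩
          sum {suc n} (λ m → y * (residue n (i , m) * θ i (n ℕ.∸ toℕ m)))
            ≈⟨ Sum.*-distribˡ-sum {suc n} y (λ m → residue n (i , m) * θ i (n ℕ.∸ toℕ m)) ⟨
          y * sum {suc n} (λ m → residue n (i , m) * θ i (n ℕ.∸ toℕ m)) ∎

    M-moment : ∀ k l e → e ℕ.+ k ≡ r-2 ℕ.+ l → ∀ n → M k l n * q ^ l ≈ q * (q ^ suc n) ^ k * W n e
    M-moment k l e e+k≡r-2+l n = trans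
      (M-total k l (λ i s → node i s ^ e) exponents n)
      (*-congˡ (trans (total-cong n (λ i s → sym (*-identityˡ (node i s ^ e)))) (total≈moments n (λ _ _ → 1#) e)))
      where
      exponents : ∀ i s → node i s ^ r-2 * node i s ^ l ≈ node i s ^ e * node i s ^ k
      exponents i s = trans (sym (^-homo-* (node i s) r-2 l))
        (trans (^-congʳ (node i s) (≡.sym e+k≡r-2+l)) (^-homo-* (node i s) e k))

    -- For (k, l) = (r - 1, 0) the exponent r - 2 + l - k is -1.
    M-corner : ∀ n → M r-1 0 n ≈ q * (q ^ suc n) ^ r-1 * V n 0
    M-corner n = trans (sym (*-identityʳ (M r-1 0 n))) (trans
      (M-total r-1 0 reciprocal exponents n)
      (*-congˡ (trans (total-cong n (λ i s → sym (*-identityʳ (reciprocal i s)))) (total≈moments n reciprocal 0))))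
      where
      exponents : ∀ i s → node i s ^ r-2 * 1# ≈ reciprocal i s * node i s ^ r-1
      exponents i s = begin
        node i s ^ r-2 * 1#                                ≈⟨ *-congˡ (node*reciprocal i s) ⟨
        node i s ^ r-2 * (node i s * reciprocal i s)       ≈⟨ solve* 3 (λ y x u → y ⊗ (x ⊗ u) ⊜ u ⊗ (x ⊗ y)) refl
                                                                (node i s ^ r-2) (node i s) (reciprocal i s) ⟩
        reciprocal i s * node i s ^ r-1                    ∎

    -- Rationality over H

    open Rationality Parameter
    open RationalMoments Parameter

    sum-∈ : ∀ {n} (x : Fin n → Carrier) → (∀ i → H (x i)) → H (sum x)
    sum-∈ {zero}  x x∈H = 0∈
    sum-∈ {suc n} x x∈H = +-∈ (x∈H Fin.zero) (sum-∈ (x ∘ Fin.suc) (x∈H ∘ Fin.suc))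

    product-∈ : ∀ {n} (x : Fin n → Carrier) → (∀ i → H (x i)) → H (product x)
    product-∈ {zero}  x x∈H = 1∈
    product-∈ {suc n} x x∈H = *-∈ (x∈H Fin.zero) (product-∈ (x ∘ Fin.suc) (x∈H ∘ Fin.suc))

    ^-∈ : ∀ {x} → H x → ∀ n → H (x ^ n)
    ^-∈ x∈H zero    = 1∈
    ^-∈ x∈H (suc n) = *-∈ x∈H (^-∈ x∈H n)

    prod-∈ : ∀ {x} → (∀ t → H (x t)) → ∀ n → H (prod x n)
    prod-∈ x∈H zero    = 1∈
    prod-∈ x∈H (suc n) = *-∈ (prod-∈ x∈H n) (x∈H n)

    q∈H : H q
    q∈H = gen-∈ q∈

    node-∈ : ∀ i s → H (node i s)
    node-∈ i s = *-∈ (gen-∈ (b∈ i)) (^-∈ q∈H s)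

    -∈ : ∀ {x y} → H x → H y → H (x - y)
    -∈ x∈H y∈H = +-∈ x∈H (neg-∈ y∈H)

    if-∈ : ∀ z {x y} → H x → H y → H (if z then x else y)
    if-∈ true  x∈H y∈H = x∈H
    if-∈ false x∈H y∈H = y∈H

    difference-∈ : ∀ n u v → H (difference-matrix n u v)
    difference-∈ n (i , m) (j , t) = if-∈ (does (m Fin.≟ t))
      (if-∈ (does (i Fin.≟ j)) 1∈ (-∈ (node-∈ i (n ℕ.∸ toℕ m)) (node-∈ j (n ℕ.∸ toℕ m))))
      (-∈ (node-∈ i (n ℕ.∸ toℕ m)) (node-∈ j (n ℕ.∸ toℕ t)))

    weights-∈ : ∀ n u → H (weights n u)
    weights-∈ n u = ⁻¹-∈ {x = denominator n u} (denominator#0 n u)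
      (product-∈ {r} (λ j → product {suc n} λ t → difference-matrix n u (j , t))
        λ j → product-∈ {suc n} (λ t → difference-matrix n u (j , t)) λ t → difference-∈ n u (j , t))

    residue-∈ : ∀ n u → H (residue n u)
    residue-∈ n (i , m) = *-∈ (weights-∈ n (i , m))
      (product-∈ {r} (λ j → prod (λ t → point n (i , m) - a j * q ^ suc t) n) λ j →
        prod-∈ (λ t → -∈ (node-∈ i (n ℕ.∸ toℕ m)) (*-∈ (gen-∈ (a∈ j)) (^-∈ q∈H (suc t)))) n)

    W-∈ : ∀ n e → H (W n e)
    W-∈ n e = sum-∈ {r ℕ.* suc n} (λ p → weighted n (λ _ _ → 1#) (index n p) * point n (index n p) ^ e)
      λ p → *-∈ (*-∈ (residue-∈ n (index n p)) 1∈)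
                (^-∈ (node-∈ (proj₁ (index n p)) (n ℕ.∸ toℕ (proj₂ (index n p)))) e)

    W-recurrent : ∀ e → Recurrent (λ n → W n e)
    W-recurrent = <-rec (λ e → Recurrent (λ n → W n e)) recurrent
      where
      -- Below r - 1 and at r - 1 the sequence is constant; for e = r + D it is
      -- reduced to smaller exponents by the relation between Ωₙ₊₁ and Ωₙ.
      recurrent : ∀ e → (∀ {d} → d < e → Recurrent (λ n → W n d)) → Recurrent (λ n → W n e)
      recurrent e lower with ℕ.<-cmp e r-1
      ... | tri< e<r-1 _ _ = vanishing λ n → vanishes (W-order n) e<r-1
      ... | tri≈ _ ≡.refl _ = step (W-∈ 0 r-1) (neg-∈ 1∈) (vanishing λ n → trans
              (+-cong (leading (W-order (suc n))) (trans (-1*x≈-x (W n r-1)) (-‿cong (leading (W-order n)))))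
              (-‿inverseʳ 1#))
      ... | tri> _ _ r≤e = ≡.subst (λ d → Recurrent (λ n → W n d)) (ℕ.m+[n∸m]≡n r≤e)
              (step (W-∈ 0 (r ℕ.+ D)) (neg-∈ 1∈)
                (Recurrent-cong step-difference (Recurrent-+ fa (Recurrent-• (neg-∈ 1∈) fb))))
        where
        D : ℕ
        D = e ℕ.∸ r
        low : ∀ d → d < r ℕ.+ D → Recurrent (λ n → W n d)
        low d d<e = lower (≡.subst (d <_) (ℕ.m+[n∸m]≡n r≤e) d<e)
        -- Both sides of the relation multiplied by x to the power D.
        A B : ℕ → Carrier
        A n = factors (λ j → a j * q * q ^ n) (W n) D
        B n = factors (λ j → b j * q * q ^ n) (W (suc n)) D
        A≈B : ∀ n → A n ≈ B n
        A≈B n = trans (factors-congᶜ (W n) (λ j → *-assoc (a j) q (q ^ n)) D)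
          (trans (sym (moments-suc n (λ _ _ → 1#) D))
            (factors-congᶜ (W (suc n)) (λ j → sym (*-assoc (b j) q (q ^ n))) D))
        fa : Recurrent (λ n → A n - W n (r ℕ.+ D))
        fa = factors-leading (λ j → a j * q) q∈H (λ j → *-∈ (gen-∈ (a∈ j)) q∈H) low
        fb : Recurrent (λ n → B n - W (suc n) (r ℕ.+ D))
        fb = factors-leading (λ j → b j * q) q∈H (λ j → *-∈ (gen-∈ (b∈ j)) q∈H)
               λ d d<e → Recurrent-tail (low d d<e)
        step-difference : (λ n → (A n - W n (r ℕ.+ D)) + (- 1# • λ n → B n - W (suc n) (r ℕ.+ D)) n)
          ≋ Δ (- 1#) (λ n → W n (r ℕ.+ D))
        step-difference n = cancel-common (A≈B n)
          where
          cancel-common : ∀ {x y v w} → x ≈ y → (x - v) + - 1# * (y - w) ≈ w + - 1# * v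
          cancel-common {x} {y} {v} {w} x≈y = begin
            (x - v) + - 1# * (y - w)      ≈⟨ +-congˡ (trans (-1*x≈-x _) (trans (sym (-‿+-comm y (- w))) (+-congˡ (-‿involutive w)))) ⟩
            (x - v) + (- y + w)           ≈⟨ +-congʳ (+-comm x (- v)) ⟩
            (- v + x) + (- y + w)         ≈⟨ trans (+-assoc (- v) x _) (+-congˡ (sym (+-assoc x (- y) w))) ⟩
            - v + ((x - y) + w)           ≈⟨ +-congˡ (trans (+-congʳ (trans (+-congʳ x≈y) (-‿inverseʳ y))) (+-identityˡ w)) ⟩
            - v + w                       ≈⟨ +-comm (- v) w ⟩
            w + - v                       ≈⟨ +-congˡ (-1*x≈-x v) ⟨
            w + - 1# * v                  ∎

    -- The entries of M

    -- A geometric progression of ratio y / x is the expansion of z / (x - y t), where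
    -- t is the variable of the power series.
    geometric-expansion : ∀ {u x y z} → x # 0# → x * u 0 ≈ z → (∀ n → x * u (suc n) ≈ y * u n) →
      u IsExpansionOf (z ∷ []) ÷ (x ∷ - y ∷ [])
    geometric-expansion {u} {x} {y} {z} x#0 xu₀≈z xuₙ₊₁≈yuₙ = record
      { regular   = x#0
      ; expansion = λ where
          zero    → trans (+-identityʳ (x * u 0)) xu₀≈z
          (suc n) → begin
            x * u (suc n) + (- y * u n + sum {n} (λ m → 0# * u (n ℕ.∸ suc (toℕ m))))
              ≈⟨ +-cong (xuₙ₊₁≈yuₙ n) (trans (+-congˡ (zeros n)) (+-identityʳ _)) ⟩
            y * u n + - y * u n
              ≈⟨ trans (+-congˡ (sym (-‿distribˡ-* y (u n)))) (-‿inverseʳ (y * u n)) ⟩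
            0# ∎
      }
      where
      zeros : ∀ n → sum {n} (λ m → 0# * u (n ℕ.∸ suc (toℕ m))) ≈ 0#
      zeros n = trans (Sum.sum-cong-≋ {n} λ m → zeroˡ (u (n ℕ.∸ suc (toℕ m)))) (Sum.sum-replicate-zero n)

    q^#0 : ∀ l → q ^ l # 0#
    q^#0 = ^#0 q#0

    M-corner-expansion : M r-1 0 IsExpansionOf ((- 1#) ^ suc r * q ^ r ∷ []) ÷ (product b ∷ - (product a * q ^ r-1) ∷ [])
    M-corner-expansion = geometric-expansion (product#0 b b#0)
      (begin
        product b * M r-1 0 0                       ≈⟨ *-congˡ (M-corner 0) ⟩
        product b * (q * (q * 1#) ^ r-1 * V 0 0)    ≈⟨ solve* 3 (λ b x v → b ⊗ (x ⊗ v) ⊜ b ⊗ v ⊗ x) refl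
                                                         (product b) (q * (q * 1#) ^ r-1) (V 0 0) ⟩
        product b * V 0 0 * (q * (q * 1#) ^ r-1)    ≈⟨ *-cong V-zero (*-congˡ (^-congˡ r-1 (*-identityʳ q))) ⟩
        (- 1#) ^ suc r * q ^ r                      ∎)
      λ n → begin
        product b * M r-1 0 (suc n)                               ≈⟨ *-congˡ (M-corner (suc n)) ⟩
        product b * (q * (q * q ^ suc n) ^ r-1 * V (suc n) 0)     ≈⟨ *-congˡ (*-congʳ (*-congˡ (^-distrib-* q (q ^ suc n) r-1))) ⟩
        product b * (q * (q ^ r-1 * (q ^ suc n) ^ r-1) * V (suc n) 0)
          ≈⟨ solve* 5 (λ b q x y v → b ⊗ (q ⊗ (x ⊗ y) ⊗ v) ⊜ b ⊗ v ⊗ (q ⊗ (x ⊗ y))) refl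
               (product b) q (q ^ r-1) ((q ^ suc n) ^ r-1) (V (suc n) 0) ⟩
        product b * V (suc n) 0 * (q * (q ^ r-1 * (q ^ suc n) ^ r-1))
          ≈⟨ *-congʳ (V-step n) ⟩
        product a * V n 0 * (q * (q ^ r-1 * (q ^ suc n) ^ r-1))
          ≈⟨ solve* 5 (λ a v q x y → a ⊗ v ⊗ (q ⊗ (x ⊗ y)) ⊜ a ⊗ x ⊗ (q ⊗ y ⊗ v)) refl
               (product a) (V n 0) q (q ^ r-1) ((q ^ suc n) ^ r-1) ⟩
        product a * q ^ r-1 * (q * (q ^ suc n) ^ r-1 * V n 0)
          ≈⟨ *-congˡ (M-corner n) ⟨
        product a * q ^ r-1 * M r-1 0 n ∎

    M-corner-rational : IsRationalOver H (M r-1 0)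
    M-corner-rational = _ , _
      , *-∈ (^-∈ (neg-∈ 1∈) (suc r)) (^-∈ q∈H r) ∷ []
      , product-∈ b (gen-∈ ∘ b∈) ∷ neg-∈ (*-∈ (product-∈ a (gen-∈ ∘ a∈)) (^-∈ q∈H r-1)) ∷ []
      , M-corner-expansion

    r-1≤r-2+1+l : ∀ l → r-1 ≤ r-2 ℕ.+ suc l
    r-1≤r-2+1+l l = ℕ.≤-trans (s≤s (ℕ.m≤m+n r-2 l)) (ℕ.≤-reflexive (≡.sym (ℕ.+-suc r-2 l)))

    M-off-corner-rational : ∀ k l → k ≤ r-2 ℕ.+ l → IsRationalOver H (M k l)
    M-off-corner-rational k l k≤ = Recurrent⇒rational (Recurrent-cong {v = M k l} eq
      (Recurrent-geometric {κ = Q⁻¹ * (q * q ^ k)} {ρ = q ^ k}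
        (*-∈ (⁻¹-∈ {x = q ^ l} (q^#0 l) (^-∈ q∈H l)) (*-∈ q∈H (^-∈ q∈H k))) (^-∈ q∈H k) (W-recurrent e)))
      where
      e : ℕ
      e = r-2 ℕ.+ l ℕ.∸ k
      Q⁻¹ : Carrier
      Q⁻¹ = (q ^ l) ⁻¹[ q^#0 l ]
      eq : (λ n → Q⁻¹ * (q * q ^ k) * (q ^ k) ^ n * W n e) ≋ M k l
      eq n = #0-cancelˡ (q^#0 l) (begin
        q ^ l * (Q⁻¹ * (q * q ^ k) * (q ^ k) ^ n * W n e)
          ≈⟨ solve* 6 (λ y u q x z w → y ⊗ (u ⊗ (q ⊗ x) ⊗ z ⊗ w) ⊜ y ⊗ u ⊗ (q ⊗ (x ⊗ z) ⊗ w)) refl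
               (q ^ l) Q⁻¹ q (q ^ k) ((q ^ k) ^ n) (W n e) ⟩
        q ^ l * Q⁻¹ * (q * (q ^ k * (q ^ k) ^ n) * W n e)
          ≈⟨ trans (*-congʳ (⁻¹-inverseʳ {q ^ l} (q^#0 l))) (*-identityˡ _) ⟩
        q * (q ^ k) ^ suc n * W n e
          ≈⟨ *-congʳ (*-congˡ (^-swap q k (suc n))) ⟩
        q * (q ^ suc n) ^ k * W n e
          ≈⟨ M-moment k l e (ℕ.m∸n+n≡m k≤) n ⟨
        M k l n * q ^ l
          ≈⟨ *-comm (M k l n) (q ^ l) ⟩
        q ^ l * M k l n ∎)
    M-rational : ∀ k l → k < r → l < r → IsRationalOver H (M k l)
    M-rational k (suc l) (s≤s k≤r-1) _ = M-off-corner-rational k (suc l) (ℕ.≤-trans k≤r-1 (r-1≤r-2+1+l l))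
    M-rational k zero (s≤s k≤r-1) _ = cases (ℕ.m≤n⇒m<n∨m≡n k≤r-1)
      where
      cases : k < r-1 ⊎ k ≡ r-1 → IsRationalOver H (M k 0)
      cases (inj₁ (s≤s k≤r-2)) = M-off-corner-rational k 0 (ℕ.≤-trans k≤r-2 (ℕ.m≤m+n r-2 0))
      cases (inj₂ ≡.refl)      = M-corner-rational

    M-zero : ∀ k l → k ≤ r-1 → l ≤ k → ¬ (k ≡ r-1 × l ≡ 0) → M k l ≋ 0ₛ
    M-zero k l k≤r-1 l≤k not-corner n = #0-cancelˡ (q^#0 l) (begin
      q ^ l * M k l n                ≈⟨ *-comm (q ^ l) (M k l n) ⟩
      M k l n * q ^ l                ≈⟨ M-moment k l e (ℕ.m∸n+n≡m (bound l not-corner)) n ⟩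
      q * (q ^ suc n) ^ k * W n e    ≈⟨ *-congˡ (vanishes (W-order n) e<r-1) ⟩
      q * (q ^ suc n) ^ k * 0#       ≈⟨ zeroʳ _ ⟩
      0#                             ≈⟨ zeroʳ (q ^ l) ⟨
      q ^ l * 0#                     ∎)
      where
      e : ℕ
      e = r-2 ℕ.+ l ℕ.∸ k
      bound : ∀ l → ¬ (k ≡ r-1 × l ≡ 0) → k ≤ r-2 ℕ.+ l
      bound zero    nc = ≡.subst (k ≤_) (≡.sym (ℕ.+-identityʳ r-2))
        (ℕ.≤-pred (ℕ.≤∧≢⇒< k≤r-1 (λ k≡r-1 → nc (k≡r-1 , ≡.refl))))
      bound (suc l) nc = ℕ.≤-trans k≤r-1 (r-1≤r-2+1+l l)
      e<r-1 : e < r-1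
      e<r-1 = s≤s (ℕ.m≤n+o⇒m∸n≤o (r-2 ℕ.+ l) k
        (≡.subst (r-2 ℕ.+ l ≤_) (ℕ.+-comm r-2 k) (ℕ.+-monoʳ-≤ r-2 l≤k)))

    M-superdiagonal : ∀ k → k ≤ r-2 → M k (suc k) IsExpansionOf (1# ∷ []) ÷ (1# ∷ - (q ^ k) ∷ [])
    M-superdiagonal k _ = geometric-expansion 1#0
      (trans (*-identityˡ _) (power 0))
      (λ n → trans (*-identityˡ _) (trans (power (suc n)) (*-congˡ (sym (power n)))))
      where
      power : ∀ n → M k (suc k) n ≈ (q ^ k) ^ n
      power n = #0-cancelˡ (q^#0 (suc k)) (begin
        q ^ suc k * M k (suc k) n         ≈⟨ *-comm (q ^ suc k) (M k (suc k) n) ⟩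
        M k (suc k) n * q ^ suc k         ≈⟨ M-moment k (suc k) r-1 (≡.sym (ℕ.+-suc r-2 k)) n ⟩
        q * (q ^ suc n) ^ k * W n r-1     ≈⟨ trans (*-congˡ (leading (W-order n))) (*-identityʳ _) ⟩
        q * (q ^ suc n) ^ k               ≈⟨ *-congˡ (^-swap q (suc n) k) ⟩
        q * (q ^ k * (q ^ k) ^ n)         ≈⟨ *-assoc q (q ^ k) ((q ^ k) ^ n) ⟨
        q ^ suc k * (q ^ k) ^ n           ∎)

open FieldTheory ℂ-heytingField using (_≈_; _#_; _*_; -_; 0#; 1#; _^_; _/_[_]; _^_[_]; product; _≋_; 0ₛ; IsRationalOver; _IsExpansionOf_÷_; module Hypergeometric)

theorem1p2 :
    (r-2 : ℕ) (let r-1 = suc r-2) (let r = suc r-1)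
    (q : ℂ) (0<∣q∣ : 0ᵣ <ᵣ ∣ q ∣ᶜ) (∣q∣<1 : ∣ q ∣ᶜ <ᵣ 1ᵣ) (let q#0 = 0<∣z∣⇒z#0 0<∣q∣)
    (a b : Fin r → ℂ) (a#0 : ∀ i → a i # 0#) (b#0 : ∀ i → b i # 0#)
    (bᵣ≈q : b (fromℕ r-1) ≈ q)
    (b/b#q^ : ∀ i j → i ≢ j → (n : ℤ) → b i / b j [ b#0 j ] # q ^ n [ q#0 ]) →
    let open Hypergeometric r-2 q q#0 (∣z∣<1⇒1#z^ ∣q∣<1) a b a#0 b#0 b/b#q^ in
    (∀ k l → k < r → l < r → IsRationalOver H (M k l))
    × (∀ k l → k ≤ r-1 → l ≤ k → ¬ (k ≡ r-1 × l ≡ 0) → M k l ≋ 0ₛ)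
    × M r-1 0 IsExpansionOf ((- 1#) ^ suc r * q ^ r ∷ []) ÷ (product b ∷ - (product a * q ^ r-1) ∷ [])
    × (∀ k → k ≤ r-2 → M k (suc k) IsExpansionOf (1# ∷ []) ÷ (1# ∷ - (q ^ k) ∷ []))
theorem1p2 r-2 q 0<∣q∣ ∣q∣<1 a b a#0 b#0 bᵣ≈q b/b#q^ =
  M-rational , M-zero , M-corner-expansion , M-superdiagonal
  where
  open FieldLemmas.Solutions ℂ-heytingField r-2 q (0<∣z∣⇒z#0 0<∣q∣) (∣z∣<1⇒1#z^ ∣q∣<1) a b a#0 b#0 b/b#q^ bᵣ≈q
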